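{- Let $G$, $H$, $F$, $A$, $B$, $D$ be as in the context and let $\tau$ be the number of connected components of $G[D]$. Then $$def_H(G)=\tau+\sum_{v\in B}\bigl(mH(v)-d_{G-A}(v)\bigr)-\sum_{v\in A}MH(v).$$
   Context: $G$ is a finite simple graph and $H:V(G)\to 2^{\mathbb{N}}$ assigns to each vertex $x$ a nonempty finite set $H(x)$ of nonnegative integers. Write $mH(x)=\min H(x)$, $MH(x)=\max H(x)$. $H$ satisfies property $(*)$: for every vertex $x$ and every integer $i$ with $mH(x)\le i\le MH(x)$, if $i\notin H(x)$ then $i+1\in H(x)$. For a spanning subgraph $F$ of $G$ and $x\in V(G)$, $def(F;x)=dist(d_F(x),H(x))=\min_{h\in H(x)}|d_F(x)-h|$; $def_H[F]=\sum_{x\in V(G)}def(F;x)$; $def_H(G)=\min\{def_H[F]: F \text{ spanning subgraph of } G\}$ (the total deficiency). An $H$-factor is a spanning subgraph $F$ with $d_F(x)\in H(x)$ for all $x$. $d_{G-A}(v)$ is the degree of $v$ in the graph obtained from $G$ by deleting the vertices of $A$. Standing assumptions: $G$ has no $H$-factor, and $F$ is a fixed spanning subgraph of $G$ chosen as follows: among all spanning subgraphs with $d_F(v)\le MH(v)$ for all $v$, $F$ minimizes $def_H[F]$, and subject to this $E(F)$ is (inclusion-)minimal. Let $B_0=\{x: d_F(x)\notin H(x)\}$. For a trail $P$ (walk with no repeated edge), $F\triangle P$ is the spanning subgraph with edge set $E(F)\triangle E(P)$. A trail $P=v_0v_1\dots v_k$ is a changeable trail if: (a) $v_0\in B_0$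 and $v_0v_1\notin E(F)$; (b) $def(F;x)=def(F\triangle P;x)=0$ for every vertex $x$ of $P$ other than $v_0,v_k$; (c) if $v_0=v_i\ne v_k$ for some $i$, then $def(F;v_0)>def(F\triangle P;v_0)$; (d) every initial subtrail $v_0\dots v_l$, $l\le k$, also satisfies (a)–(c). A changeable trail is odd if its last edge is not in $F$, even otherwise; length-zero trails are even changeable trails. "A changeable trail from $B_0$ to $v$" means a changeable trail ending at $v$. $D$ is the set of vertices $v$ satisfying at least one of: (i) there exist both an even and an odd changeable trail from $B_0$ to $v$; (ii) $mH(v)<d_F(v)\le MH(v)$ and there is an even changeable trail from $B_0$ to $v$; (iii) $mH(v)\le d_F(v)<MH(v)$ and there is an odd changeable trail from $B_0$ to $v$. $B=\{v: \text{some even changeable trail ends at } v\}\setminus D$, $A=\{v: \text{some odd changeable trail ends at } v\}\setminus D$. -}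

module Defs where

open import Data.Nat using (ℕ; zero; suc; _+_; _≤_; _<_; _⊓_; _⊔_; ∣_-_∣)
open import Data.Integer as ℤ using (ℤ; +_)
open import Data.Bool using (Bool; true; false; _∧_; _∨_; _xor_; not; if_then_else_)
open import Data.Fin using (Fin; _≟_)
open import Data.Nat.ListAction using (sum)
open import Data.List using (List; []; _∷_; map; foldr; take; length; allFin)
open import Data.List.NonEmpty using (List⁺; _∷_; toList; foldr₁; last)
import Data.List.NonEmpty as L⁺
open import Data.List.Membership.Propositional using (_∈_)
open import Data.List.Relation.Unary.All using (All)
open import Data.List.Relation.Unary.AllPairs using (AllPairs)
open import Data.Product using (Σ; ∃; _×_; _,_)
open import Data.Sum using (_⊎_)
open import Data.Empty using (⊥)
open import Data.Unit using (⊤)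
open import Relation.Nullary using (¬_; Dec)
open import Relation.Nullary.Decidable using (⌊_⌋)
open import Relation.Binary.PropositionalEquality using (_≡_; _≢_)
open import Function.Bundles using (_⇔_)

record Graph (n : ℕ) : Set where
  field
    adj    : Fin n → Fin n → Bool
    sym    : ∀ x y → adj x y ≡ adj y x
    irrefl : ∀ x → adj x x ≡ false
open Graph public

record Spanning {n : ℕ} (G : Graph n) : Set where
  field
    E    : Fin n → Fin n → Bool
    symE : ∀ x y → E x y ≡ E y x
    subE : ∀ x y → E x y ≡ true → adj G x y ≡ true
open Spanning public

b2n : Bool → ℕ
b2n true  = 1
b2n false = 0

deg : {n : ℕ} → (Fin n → Fin n → Bool) → Fin n → ℕ
deg {n} E x = sum (map (λ y → b2n (E x y)) (allFin n))

-- Degree prescriptions H : V → nonempty finite sets of naturals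

Pres : ℕ → Set
Pres n = Fin n → List⁺ ℕ

mH MH : {n : ℕ} → Pres n → Fin n → ℕ
mH H x = foldr₁ _⊓_ (H x)
MH H x = foldr₁ _⊔_ (H x)

Star : {n : ℕ} → Pres n → Set
Star {n} H = ∀ (x : Fin n) (i : ℕ) → mH H x ≤ i → i ≤ MH H x →
             ¬ (i ∈ toList (H x)) → suc i ∈ toList (H x)

dist : ℕ → List⁺ ℕ → ℕ
dist d S = foldr₁ _⊓_ (L⁺.map (λ h → ∣ d - h ∣) S)

defE : {n : ℕ} → Pres n → (Fin n → Fin n → Bool) → Fin n → ℕ
defE H E x = dist (deg E x) (H x)

defSum : {n : ℕ} → Pres n → (Fin n → Fin n → Bool) → ℕ
defSum {n} H E = sum (map (defE H E) (allFin n))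

IsTotalDef : {n : ℕ} → Graph n → Pres n → ℕ → Set
IsTotalDef G H k =
  Σ (Spanning G) (λ F → defSum H (E F) ≡ k) ×
  (∀ (F : Spanning G) → k ≤ defSum H (E F))

HasHFactor : {n : ℕ} → Graph n → Pres n → Set
HasHFactor G H = Σ (Spanning G) (λ F → ∀ x → deg (E F) x ∈ toList (H x))

Bounded : {n : ℕ} → {G : Graph n} → Pres n → Spanning G → Set
Bounded H F = ∀ x → deg (E F) x ≤ MH H x

IsChosen : {n : ℕ} → (G : Graph n) → Pres n → Spanning G → Set
IsChosen G H F =
  Bounded H F ×
  (∀ (F' : Spanning G) → Bounded H F' → defSum H (E F) ≤ defSum H (E F')) ×
  (∀ (F' : Spanning G) → Bounded H F' → defSum H (E F') ≡ defSum H (E F) →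
     (∀ x y → E F' x y ≡ true → E F x y ≡ true) →
     (∀ x y → E F x y ≡ true → E F' x y ≡ true))

-- Walks / trails, given as nonempty vertex lists v₀ ∷ v₁ … v_k

edges : {n : ℕ} → List (Fin n) → List (Fin n × Fin n)
edges (a ∷ b ∷ r) = (a , b) ∷ edges (b ∷ r)
edges _           = []

eqF : {n : ℕ} → Fin n → Fin n → Bool
eqF a b = ⌊ a ≟ b ⌋

sameEdge : {n : ℕ} → Fin n × Fin n → Fin n × Fin n → Bool
sameEdge (a , b) (c , d) = (eqF a c ∧ eqF b d) ∨ (eqF a d ∧ eqF b c)

anyB : {A : Set} → (A → Bool) → List A → Bool
anyB p = foldr (λ a r → p a ∨ r) false

inP : {n : ℕ} → List⁺ (Fin n) → Fin n → Fin n → Bool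
inP P u v = anyB (sameEdge (u , v)) (edges (toList P))

symDiff : {n : ℕ} → (Fin n → Fin n → Bool) → List⁺ (Fin n) → Fin n → Fin n → Bool
symDiff F P x y = F x y xor inP P x y

IsTrail : {n : ℕ} → Graph n → List⁺ (Fin n) → Set
IsTrail G P =
  All (λ e → adj G (Data.Product.proj₁ e) (Data.Product.proj₂ e) ≡ true) (edges (toList P)) ×
  AllPairs (λ e e' → sameEdge e e' ≡ false) (edges (toList P))

module _ {n : ℕ} {G : Graph n} (H : Pres n) (F : Spanning G) where

  B₀ : Fin n → Set
  B₀ x = ¬ (deg (E F) x ∈ toList (H x))

  CondA : List⁺ (Fin n) → Set
  CondA (v₀ ∷ [])       = B₀ v₀
  CondA (v₀ ∷ (v₁ ∷ _)) = B₀ v₀ × E F v₀ v₁ ≡ false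

  CondB : List⁺ (Fin n) → Set
  CondB P = ∀ x → x ∈ toList P → x ≢ L⁺.head P → x ≢ last P →
            (defE H (E F) x ≡ 0) × (defE H (symDiff (E F) P) x ≡ 0)

  CondC : List⁺ (Fin n) → Set
  CondC (v₀ ∷ vs) = v₀ ∈ vs → v₀ ≢ last (v₀ ∷ vs) →
                    defE H (symDiff (E F) (v₀ ∷ vs)) v₀ < defE H (E F) v₀

  CondABC : List⁺ (Fin n) → Set
  CondABC P = CondA P × CondB P × CondC P

  Changeable : List⁺ (Fin n) → Set
  Changeable (v₀ ∷ vs) = IsTrail G (v₀ ∷ vs) ×
    (∀ m → m ≤ length vs → CondABC (v₀ ∷ take m vs))

  LastOdd : List (Fin n) → Set
  LastOdd (a ∷ b ∷ [])    = E F a b ≡ false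
  LastOdd (a ∷ b ∷ c ∷ r) = LastOdd (b ∷ c ∷ r)
  LastOdd _               = ⊥

  LastEven : List (Fin n) → Set
  LastEven (a ∷ [])        = ⊤
  LastEven (a ∷ b ∷ [])    = E F a b ≡ true
  LastEven (a ∷ b ∷ c ∷ r) = LastEven (b ∷ c ∷ r)
  LastEven []              = ⊥

  EvenTo OddTo : Fin n → Set
  EvenTo v = Σ (List⁺ (Fin n)) λ P → Changeable P × LastEven (toList P) × last P ≡ v
  OddTo  v = Σ (List⁺ (Fin n)) λ P → Changeable P × LastOdd (toList P) × last P ≡ v

  D : Fin n → Set
  D v = (EvenTo v × OddTo v)
      ⊎ (mH H v < deg (E F) v × deg (E F) v ≤ MH H v × EvenTo v)
      ⊎ (mH H v ≤ deg (E F) v × deg (E F) v < MH H v × OddTo v)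

  Bset Aset : Fin n → Set
  Bset v = EvenTo v × ¬ D v
  Aset v = OddTo v × ¬ D v

  ConnD : Fin n → Fin n → Set
  ConnD u v = Σ (List⁺ (Fin n)) λ P →
    L⁺.head P ≡ u × last P ≡ v × All D (toList P) ×
    All (λ e → adj G (Data.Product.proj₁ e) (Data.Product.proj₂ e) ≡ true) (edges (toList P))

  -- G[D] has exactly τ connected components: c labels the vertices of D
  -- by Fin τ, surjectively, with equal labels iff same component
  ComponentLabelling : (τ : ℕ) → ((v : Fin n) → D v → Fin τ) → Set
  ComponentLabelling τ c =
    (∀ (i : Fin τ) → Σ (Fin n) λ v → Σ (D v) λ dv → c v dv ≡ i) ×
    (∀ u (du : D u) v (dv : D v) → (c u du ≡ c v dv) ⇔ ConnD u v)

sumℤ : List ℤ → ℤ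
sumℤ = foldr ℤ._+_ (+ 0)

sumOver : {n : ℕ} {S : Fin n → Set} → (∀ v → Dec (S v)) → (Fin n → ℤ) → ℤ
sumOver {n} dec f = sumℤ (map (λ v → if ⌊ dec v ⌋ then f v else + 0) (allFin n))

degMinus : {n : ℕ} → Graph n → {A : Fin n → Set} → (∀ v → Dec (A v)) → Fin n → ℕ
degMinus G decA v = deg (λ x y → adj G x y ∧ not ⌊ decA y ⌋) v
-- (number of neighbours of v outside A; used for v ∉ A)

{-# OPTIONS --safe #-}
module Submission where

-- Edmonds-style search for changeable trails. Starting from the vertices of B₀ (all of which have
-- degree below mH, by edge-minimality of F) we grow a forest whose nodes are single vertices
-- entered along a non-F-edge (type A) or an F-edge (type B), and blossoms (type D), whose vertices
-- can be left along both kinds of edges; a vertex where the gaps of H permit a degree change by 2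
-- is a blossom by itself. An edge joining two exits either closes an alternating cycle, which is
-- shrunk into a blossom, or completes a trail that lowers the deficiency of F, which is impossible.
-- When no step is possible, every changeable trail enters a blossom only through its unique entry
-- edge, so the types of the nodes are exactly the sets A, B and D of the paper, the blossoms are the
-- components of G[D], and each of them has either one deficient vertex of deficiency 1, or one
-- entry edge, a non-F-edge from B or an F-edge from A. Counting edges around A and B gives the formula.

-- The three kinds are dictated by property (*). A vertex `y` newly reached along an edge of type
-- `t` cannot have `d y + σ t` in `H y`, since the trail could stop there and improve `F`. By (*),
-- either `d y` is already the extreme of `H y` in that direction, and then only the opposite type
-- leads out, or `d y` shifted twice lies in `H y`, and then both types do. Forest trails are
-- explicit constructions, but a changeable trail may revisit vertices and use edges outside the
-- forest, so it cannot be compared with a tree path. Instead the signed number of its edges at each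
-- A- and B-vertex is tracked: conditions (a) to (c) force every visit there to alternate, and an
-- entered blossom cannot be left backwards through its entry edge because trails do not repeat
-- edges. In the count, F-edges between A and B appear once from each end with opposite signs. What
-- survives is minus one for each blossom that has an entry edge; the blossoms without one have
-- deficiency 1, and both sorts together make up τ.

open import Defs renaming (sym to adj-sym)
open import Data.Bool as Bool using (Bool; true; false; _∧_; _∨_; _xor_; not; if_then_else_)
open import Data.Bool.Properties using (∧-comm; ∨-comm)
open import Data.Empty using (⊥; ⊥-elim)
open import Data.Fin using (Fin; zero; suc; _≟_)
open import Data.Fin.Properties using (any?)
open import Data.Integer as ℤ using (ℤ; +_; -_; _+_; _-_; _*_; _≤_; _<_)
open import Data.Integer.Properties as ℤ using (+-identityˡ; +-identityʳ)
open import Data.Integer.Tactic.RingSolver using (solve-∀)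
open import Data.List using (List; []; _∷_; _++_; map; allFin; tabulate; length; take; [_])
open import Data.List.Properties using (∷-injectiveʳ; ++-identityʳ; ++-assoc; length-++; map-tabulate)
open import Data.List.NonEmpty as L⁺ using (List⁺; _∷_; toList; foldr₁; last; snocView; _∷ʳ′_)
open import Data.List.Membership.DecPropositional using (_∈?_)
open import Data.List.Membership.Propositional using (_∈_; _∉_)
open import Data.List.Membership.Propositional.Properties using (∈-++⁺ˡ; ∈-++⁺ʳ; ∈-++⁻)
open import Data.List.Relation.Unary.All as All using (All; []; _∷_)
open import Data.List.Relation.Unary.AllPairs using (AllPairs; []; _∷_)
open import Data.List.Relation.Unary.Any as Any using (Any; here; there)
open import Data.Maybe using (Maybe; just; nothing)
open import Data.Maybe.Properties using (≡-dec; just-injective)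
open import Data.Nat as ℕ using (ℕ; zero; suc; z≤n; s≤s; _∸_; _⊓_; _⊔_; ∣_-_∣)
open import Data.Nat.Induction using (<-wellFounded)
open import Data.Nat.ListAction using (sum)
import Data.Nat.Properties as ℕ
open import Data.Product using (Σ; ∃; _×_; _,_; proj₁; proj₂)
open import Data.Sum using (_⊎_; inj₁; inj₂; swap)
open import Data.Unit using (⊤; tt)
open import Function using (_∘_; id; case_of_)
open import Function.Bundles using (Equivalence)
open import Induction.WellFounded using (Acc; acc)
open import Relation.Binary.PropositionalEquality hiding ([_])
open import Relation.Nullary using (¬_; Dec; yes; no)
open import Relation.Nullary.Decidable using (⌊_⌋; _×-dec_)

-- Distances to finite sets

min∈ : ∀ a xs → foldr₁ _⊓_ (a ∷ xs) ∈ a ∷ xs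
min∈ a []       = here refl
min∈ a (b ∷ xs) with ℕ.⊓-sel a (foldr₁ _⊓_ (b ∷ xs))
... | inj₁ e = here e
... | inj₂ e = there (subst (_∈ b ∷ xs) (sym e) (min∈ b xs))

min≤ : ∀ a xs {h} → h ∈ a ∷ xs → foldr₁ _⊓_ (a ∷ xs) ℕ.≤ h
min≤ a []       (here refl) = ℕ.≤-refl
min≤ a (b ∷ xs) (here refl) = ℕ.m⊓n≤m a _
min≤ a (b ∷ xs) (there h∈)  = ℕ.≤-trans (ℕ.m⊓n≤n a _) (min≤ b xs h∈)

≤max : ∀ a xs {h} → h ∈ a ∷ xs → h ℕ.≤ foldr₁ _⊔_ (a ∷ xs)
≤max a []       (here refl) = ℕ.≤-refl
≤max a (b ∷ xs) (here refl) = ℕ.m≤m⊔n a _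
≤max a (b ∷ xs) (there h∈)  = ℕ.≤-trans (≤max b xs h∈) (ℕ.m≤n⊔m a _)

mH≤ : ∀ {n} (H : Pres n) {x h} → h ∈ toList (H x) → mH H x ℕ.≤ h
mH≤ H = min≤ _ _

≤MH : ∀ {n} (H : Pres n) {x h} → h ∈ toList (H x) → h ℕ.≤ MH H x
≤MH H = ≤max _ _

dist≤ : ∀ d S {h} → h ∈ toList S → dist d S ℕ.≤ ∣ d - h ∣
dist≤ d (a ∷ [])     (here refl) = ℕ.≤-refl
dist≤ d (a ∷ b ∷ xs) (here refl) = ℕ.m⊓n≤m ∣ d - a ∣ _
dist≤ d (a ∷ b ∷ xs) (there h∈)  = ℕ.≤-trans (ℕ.m⊓n≤n ∣ d - a ∣ _) (dist≤ d (b ∷ xs) h∈)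

dist-attained : ∀ d S → Σ ℕ λ h → h ∈ toList S × dist d S ≡ ∣ d - h ∣
dist-attained d (a ∷ xs) = go a xs
  where
  go : ∀ a xs → Σ ℕ λ h → h ∈ a ∷ xs × dist d (a ∷ xs) ≡ ∣ d - h ∣
  go a [] = a , here refl , refl
  go a (b ∷ xs) with ℕ.⊓-sel ∣ d - a ∣ (dist d (b ∷ xs)) | go b xs
  ... | inj₁ e | _           = a , here refl , e
  ... | inj₂ e | h , h∈ , e₁ = h , there h∈ , trans e e₁

∈⇒dist≡0 : ∀ {d} S → d ∈ toList S → dist d S ≡ 0
∈⇒dist≡0 {d} S d∈ = ℕ.n≤0⇒n≡0 (ℕ.≤-trans (dist≤ d S d∈) (ℕ.≤-reflexive (ℕ.∣n-n∣≡0 d)))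

dist≡0⇒∈ : ∀ {d} S → dist d S ≡ 0 → d ∈ toList S
dist≡0⇒∈ {d} S e with dist-attained d S
... | h , h∈ , e₁ = subst (_∈ toList S) (sym (ℕ.∣m-n∣≡0⇒m≡n (trans (sym e₁) e))) h∈

dist-lipschitz : ∀ d d′ S → dist d S ℕ.≤ ∣ d - d′ ∣ ℕ.+ dist d′ S
dist-lipschitz d d′ S with dist-attained d′ S
... | h , h∈ , e = begin
  dist d S                  ≤⟨ dist≤ d S h∈ ⟩
  ∣ d - h ∣                 ≤⟨ ℕ.∣-∣-triangle d d′ h ⟩
  ∣ d - d′ ∣ ℕ.+ ∣ d′ - h ∣   ≡⟨ cong (∣ d - d′ ∣ ℕ.+_) (sym e) ⟩
  ∣ d - d′ ∣ ℕ.+ dist d′ S    ∎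
  where open ℕ.≤-Reasoning

∣n-1+n∣≡1 : ∀ n → ∣ n - suc n ∣ ≡ 1
∣n-1+n∣≡1 zero    = refl
∣n-1+n∣≡1 (suc n) = ∣n-1+n∣≡1 n

dist-pred≤ : ∀ d S → dist d S ℕ.≤ suc (dist (suc d) S)
dist-pred≤ d S = subst (λ z → dist d S ℕ.≤ z ℕ.+ dist (suc d) S) (∣n-1+n∣≡1 d) (dist-lipschitz d (suc d) S)

-- Below the minimum, the nearest element of `S` is the minimum itself. The additive form avoids
-- truncated subtraction.
min-distance : ∀ d S → d ℕ.≤ foldr₁ _⊓_ S → d ℕ.+ dist d S ≡ foldr₁ _⊓_ S
min-distance d S@(a ∷ xs) d≤m = ℕ.≤-antisym upper lower
  where
  upper : d ℕ.+ dist d S ℕ.≤ foldr₁ _⊓_ S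
  upper = ℕ.≤-trans (ℕ.+-monoʳ-≤ d (dist≤ d S (min∈ a xs)))
                  (ℕ.≤-reflexive (trans (cong (d ℕ.+_) (ℕ.m≤n⇒∣m-n∣≡n∸m d≤m)) (ℕ.m+[n∸m]≡n d≤m)))
  lower : foldr₁ _⊓_ S ℕ.≤ d ℕ.+ dist d S
  lower with dist-attained d S
  ... | h , h∈ , e = ℕ.≤-trans m≤h
        (ℕ.≤-reflexive (trans (sym (ℕ.m+[n∸m]≡n d≤h))
          (cong (d ℕ.+_) (sym (trans e (ℕ.m≤n⇒∣m-n∣≡n∸m d≤h))))))
    where m≤h = min≤ a xs h∈
          d≤h = ℕ.≤-trans d≤m m≤h

dist-suc< : ∀ {d} S → d ℕ.< foldr₁ _⊓_ S → suc (dist (suc d) S) ≡ dist d S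
dist-suc< {d} S d<m = ℕ.+-cancelˡ-≡ d _ _ (begin
  d ℕ.+ suc (dist (suc d) S)  ≡⟨ ℕ.+-suc d _ ⟩
  suc d ℕ.+ dist (suc d) S    ≡⟨ min-distance (suc d) S d<m ⟩
  foldr₁ _⊓_ S              ≡⟨ min-distance d S (ℕ.<⇒≤ d<m) ⟨
  d ℕ.+ dist d S              ∎)
  where open ≡-Reasoning

-- From the maximum upwards all of `S` lies on one side, so raising the degree moves away from every
-- element at once.
dist-above : ∀ {d} S → foldr₁ _⊔_ S ℕ.≤ d → dist d S ℕ.< dist (suc d) S
dist-above {d} S@(a ∷ xs) M≤d with dist-attained (suc d) S
... | h , h∈ , e = ℕ.≤-trans (s≤s (dist≤ d S h∈)) (ℕ.≤-reflexive (begin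
  suc ∣ d - h ∣   ≡⟨ cong suc (ℕ.m≤n⇒∣n-m∣≡n∸m h≤d) ⟩
  suc (d ∸ h)     ≡⟨ ℕ.+-∸-assoc 1 h≤d ⟨
  suc d ∸ h       ≡⟨ ℕ.m≤n⇒∣n-m∣≡n∸m (ℕ.m≤n⇒m≤1+n h≤d) ⟨
  ∣ suc d - h ∣   ≡⟨ e ⟨
  dist (suc d) S  ∎))
  where
  open ≡-Reasoning
  h≤d = ℕ.≤-trans (≤max a xs h∈) M≤d

-- Sums over Fin n

∑ : ∀ {n} → (Fin n → ℤ) → ℤ
∑ {zero}  f = + 0
∑ {suc n} f = f zero + ∑ (f ∘ suc)

sumℤ-∑ : ∀ {n} (f : Fin n → ℤ) → sumℤ (map f (allFin n)) ≡ ∑ f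
sumℤ-∑ f = trans (cong sumℤ (map-tabulate id f)) (go f)
  where
  go : ∀ {n} (f : Fin n → ℤ) → sumℤ (tabulate f) ≡ ∑ f
  go {zero}  f = refl
  go {suc n} f = cong (_+_ (f zero)) (go (f ∘ suc))

sum-∑ : ∀ {n} (f : Fin n → ℕ) → + sum (map f (allFin n)) ≡ ∑ (λ i → + f i)
sum-∑ f = trans (cong (λ l → + sum l) (map-tabulate id f)) (go f)
  where
  go : ∀ {n} (f : Fin n → ℕ) → + sum (tabulate f) ≡ ∑ (λ i → + f i)
  go {zero}  f = refl
  go {suc n} f = cong (_+_ (+ f zero)) (go (f ∘ suc))

∑-cong : ∀ {n} {f g : Fin n → ℤ} → (∀ i → f i ≡ g i) → ∑ f ≡ ∑ g
∑-cong {zero}  e = refl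
∑-cong {suc n} e = cong₂ _+_ (e zero) (∑-cong (e ∘ suc))

∑-0 : ∀ {n} {f : Fin n → ℤ} → (∀ i → f i ≡ + 0) → ∑ f ≡ + 0
∑-0 {zero}  e = refl
∑-0 {suc n} e = cong₂ _+_ (e zero) (∑-0 (e ∘ suc))

interchange : ∀ a b c d → (a + b) + (c + d) ≡ (a + c) + (b + d)
interchange = solve-∀

∑-+ : ∀ {n} (f g : Fin n → ℤ) → ∑ (λ i → f i + g i) ≡ ∑ f + ∑ g
∑-+ {zero}  f g = refl
∑-+ {suc n} f g = trans (cong (_+_ (f zero + g zero)) (∑-+ (f ∘ suc) (g ∘ suc)))
                        (interchange (f zero) (g zero) _ _)

∑-neg : ∀ {n} (f : Fin n → ℤ) → ∑ (λ i → - f i) ≡ - ∑ f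
∑-neg {zero}  f = refl
∑-neg {suc n} f = trans (cong (_+_ (- f zero)) (∑-neg (f ∘ suc))) (sym (ℤ.neg-distrib-+ (f zero) _))

∑-mono : ∀ {n} {f g : Fin n → ℤ} → (∀ i → f i ≤ g i) → ∑ f ≤ ∑ g
∑-mono {zero}  e = ℤ.≤-refl
∑-mono {suc n} e = ℤ.+-mono-≤ (e zero) (∑-mono (e ∘ suc))

∑-mono-< : ∀ {n} {f g : Fin n → ℤ} → (∀ i → f i ≤ g i) → ∀ j → f j < g j → ∑ f < ∑ g
∑-mono-< e zero    lt = ℤ.+-mono-<-≤ lt (∑-mono (e ∘ suc))
∑-mono-< e (suc j) lt = ℤ.+-mono-≤-< (e zero) (∑-mono-< (e ∘ suc) j lt)

∑-swap : ∀ {m n} (f : Fin m → Fin n → ℤ) → ∑ (λ i → ∑ (f i)) ≡ ∑ (λ j → ∑ (λ i → f i j))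
∑-swap {zero}  {n} f = sym (∑-0 {n} {λ _ → + 0} (λ _ → refl))
∑-swap {suc m} f = trans (cong (_+_ (∑ (f zero))) (∑-swap (f ∘ suc))) (sym (∑-+ (f zero) _))

∑-single : ∀ {n} {f : Fin n → ℤ} j → (∀ i → i ≢ j → f i ≡ + 0) → ∑ f ≡ f j
∑-single {f = f} zero    z = trans (cong (_+_ (f zero)) (∑-0 (λ i → z (suc i) (λ ())))) (+-identityʳ _)
∑-single {f = f} (suc j) z =
  trans (cong₂ _+_ (z zero (λ ())) (∑-single j (λ i ne → z (suc i) (λ { refl → ne refl })))) (+-identityˡ _)

bit : Bool → ℤ
bit b = + b2n b

δ : ∀ {n} → Fin n → Fin n → ℤ
δ z a = bit (eqF z a)

eqF-refl : ∀ {n} (a : Fin n) → eqF a a ≡ true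
eqF-refl a with a ≟ a
... | yes _  = refl
... | no  ne = ⊥-elim (ne refl)

eqF-≢ : ∀ {n} {a b : Fin n} → a ≢ b → eqF a b ≡ false
eqF-≢ {a = a} {b} ne with a ≟ b
... | yes e = ⊥-elim (ne e)
... | no  _ = refl

δ-refl : ∀ {n} (a : Fin n) → δ a a ≡ + 1
δ-refl a = cong bit (eqF-refl a)

δ-≢ : ∀ {n} {a b : Fin n} → a ≢ b → δ a b ≡ + 0
δ-≢ ne = cong bit (eqF-≢ ne)

-- The change of the degree of an endpoint when an edge is toggled.
σ : Bool → ℤ
σ true  = - + 1
σ false = + 1

-- Degrees of symmetric differences

true≢false : ∀ {b} → b ≡ true → ¬ b ≡ false
true≢false refl ()

b2n≤1 : ∀ b → b2n b ℕ.≤ 1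
b2n≤1 true  = ℕ.≤-refl
b2n≤1 false = z≤n

SameEnds : ∀ {n} (a b c d : Fin n) → Set
SameEnds a b c d = (a ≡ c × b ≡ d) ⊎ (a ≡ d × b ≡ c)

module _ {n : ℕ} where

  sameEdge⇒ : ∀ {a b c d : Fin n} → sameEdge (a , b) (c , d) ≡ true → SameEnds a b c d
  sameEdge⇒ {a} {b} {c} {d} e with a ≟ c | b ≟ d | a ≟ d | b ≟ c
  ... | yes p | yes q | _     | _     = inj₁ (p , q)
  ... | yes p | no  q | yes r | yes s = inj₂ (r , s)
  ... | no  p | _     | yes r | yes s = inj₂ (r , s)
  ... | yes p | no  q | yes r | no  s with () ← e
  ... | yes p | no  q | no  r | _     with () ← e
  ... | no  p | _     | yes r | no  s with () ← e
  ... | no  p | _     | no  r | _     with () ← e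

  sameEdge-refl : ∀ (a b : Fin n) → sameEdge (a , b) (a , b) ≡ true
  sameEdge-refl a b rewrite eqF-refl a | eqF-refl b = refl

  sameEdge-swapʳ : ∀ (a b c d : Fin n) → sameEdge (a , b) (d , c) ≡ sameEdge (a , b) (c , d)
  sameEdge-swapʳ a b c d = ∨-comm (eqF a d ∧ eqF b c) _

  sameEdge-swapˡ : ∀ (a b c d : Fin n) → sameEdge (b , a) (c , d) ≡ sameEdge (a , b) (c , d)
  sameEdge-swapˡ a b c d = trans (∨-comm (eqF b c ∧ eqF a d) _)
    (cong₂ _∨_ (∧-comm (eqF b d) _) (∧-comm (eqF b c) _))

  ≢-sameEdge : ∀ {a b c d : Fin n} → ¬ SameEnds a b c d → sameEdge (a , b) (c , d) ≡ false
  ≢-sameEdge {a} {b} {c} {d} ne with sameEdge (a , b) (c , d) in e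
  ... | false = refl
  ... | true  = ⊥-elim (ne (sameEdge⇒ e))

  -- Counting traversals of the undirected edge ab, rather than comparing edges pairwise, makes
  -- trail conditions additive under joining and invariant under reversal.
  mult : Fin n → Fin n → List (Fin n) → ℕ
  mult a b (c ∷ d ∷ r) = b2n (sameEdge (a , b) (c , d)) ℕ.+ mult a b (d ∷ r)
  mult a b _           = 0

  EdgeSimple : List (Fin n) → Set
  EdgeSimple xs = ∀ a b → mult a b xs ℕ.≤ 1

  mult-swap : ∀ a b xs → mult b a xs ≡ mult a b xs
  mult-swap a b []          = refl
  mult-swap a b (c ∷ [])    = refl
  mult-swap a b (c ∷ d ∷ r) = cong₂ (λ x y → b2n x ℕ.+ y) (sameEdge-swapˡ a b c d) (mult-swap a b (d ∷ r))

  mult-∉ˡ : ∀ {a} b xs → a ∉ xs → mult a b xs ≡ 0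
  mult-∉ˡ b []       a∉ = refl
  mult-∉ˡ b (c ∷ []) a∉ = refl
  mult-∉ˡ {a} b (c ∷ d ∷ r) a∉ = cong₂ (λ x y → b2n x ℕ.+ y)
    (≢-sameEdge {a} {b} {c} {d} (λ { (inj₁ (p , _)) → a∉ (here p) ; (inj₂ (p , _)) → a∉ (there (here p)) }))
    (mult-∉ˡ b (d ∷ r) (a∉ ∘ there))

  mult-∉ʳ : ∀ a {b} xs → b ∉ xs → mult a b xs ≡ 0
  mult-∉ʳ a {b} xs b∉ = trans (mult-swap b a xs) (mult-∉ˡ a xs b∉)

  mult-drop : ∀ a b c xs → mult a b xs ℕ.≤ mult a b (c ∷ xs)
  mult-drop a b c []      = z≤n
  mult-drop a b c (d ∷ r) = ℕ.m≤n+m _ _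

  mult-take : ∀ a b c m xs → mult a b (c ∷ take m xs) ℕ.≤ mult a b (c ∷ xs)
  mult-take a b c zero    xs      = z≤n
  mult-take a b c (suc m) []      = z≤n
  mult-take a b c (suc m) (d ∷ r) = ℕ.+-monoʳ-≤ (b2n (sameEdge (a , b) (c , d))) (mult-take a b d m r)

  EdgeSimple⇒AllPairs : ∀ xs → EdgeSimple xs → AllPairs (λ e e′ → sameEdge e e′ ≡ false) (edges xs)
  EdgeSimple⇒AllPairs []          s = []
  EdgeSimple⇒AllPairs (c ∷ [])    s = []
  EdgeSimple⇒AllPairs (c ∷ d ∷ r) s =
      absent (d ∷ r) (ℕ.n≤0⇒n≡0 (ℕ.≤-pred (subst (λ z → b2n z ℕ.+ mult c d (d ∷ r) ℕ.≤ 1) (sameEdge-refl c d) (s c d))))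
    ∷ EdgeSimple⇒AllPairs (d ∷ r) (λ a b → ℕ.≤-trans (mult-drop a b c (d ∷ r)) (s a b))
    where
    absent : ∀ {a b} xs → mult a b xs ≡ 0 → All (λ e → sameEdge (a , b) e ≡ false) (edges xs)
    absent []       e = []
    absent (x ∷ []) e = []
    absent {a} {b} (x ∷ y ∷ r) e =
      b2n≡0 (ℕ.m+n≡0⇒m≡0 _ e) ∷ absent (y ∷ r) (ℕ.m+n≡0⇒n≡0 (b2n (sameEdge (a , b) (x , y))) e)
      where
      b2n≡0 : ∀ {b} → b2n b ≡ 0 → b ≡ false
      b2n≡0 {false} _ = refl

  sameEdge-trans : ∀ {a b c d e f : Fin n} → sameEdge (a , b) (c , d) ≡ true →
                   sameEdge (a , b) (e , f) ≡ true → sameEdge (c , d) (e , f) ≡ true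
  sameEdge-trans {a} {b} {c} {d} p q with sameEdge⇒ {a} {b} {c} {d} p
  ... | inj₁ (refl , refl) = q
  ... | inj₂ (refl , refl) = trans (sameEdge-swapˡ a b _ _) q

  AllPairs⇒EdgeSimple : ∀ xs → AllPairs (λ e e′ → sameEdge e e′ ≡ false) (edges xs) → EdgeSimple xs
  AllPairs⇒EdgeSimple []          _        a b = z≤n
  AllPairs⇒EdgeSimple (c ∷ [])    _        a b = z≤n
  AllPairs⇒EdgeSimple (c ∷ d ∷ r) (h ∷ hs) a b with sameEdge (a , b) (c , d) in e
  ... | false = AllPairs⇒EdgeSimple (d ∷ r) hs a b
  ... | true  = s≤s (ℕ.≤-reflexive (absent (d ∷ r) h))
    where
    absent : ∀ xs → All (λ e → sameEdge (c , d) e ≡ false) (edges xs) → mult a b xs ≡ 0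
    absent []       _ = refl
    absent (x ∷ []) _ = refl
    absent (x ∷ y ∷ r) (h ∷ hs) with sameEdge (a , b) (x , y) in e′
    ... | false = absent (y ∷ r) hs
    ... | true  = ⊥-elim (true≢false (sameEdge-trans {a} {b} {c} {d} {x} {y} e e′) h)

  -- Membership in a trail is Boolean, so a repeated edge would be toggled once but counted twice;
  -- with multiplicity at most 1 the two agree.
  anyB-mult : ∀ a b xs → mult a b xs ℕ.≤ 1 → b2n (anyB (sameEdge (a , b)) (edges xs)) ≡ mult a b xs
  anyB-mult a b []          s = refl
  anyB-mult a b (c ∷ [])    s = refl
  anyB-mult a b (c ∷ d ∷ r) s = go (sameEdge (a , b) (c , d)) s (anyB-mult a b (d ∷ r) (ℕ.≤-trans (ℕ.m≤n+m _ _) s))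
    where
    go : ∀ e {x m} → b2n e ℕ.+ m ℕ.≤ 1 → b2n x ≡ m → b2n (e ∨ x) ≡ b2n e ℕ.+ m
    go false s e = e
    go true  s e = cong suc (sym (ℕ.n≤0⇒n≡0 (ℕ.≤-pred s)))

  module _ (E : Fin n → Fin n → Bool) where

    -- The total degree change at `z` when the edges are toggled, each edge charged to both of its
    -- ends. A loop would be charged twice, hence `Loopless`.
    edgeSum : Fin n → List (Fin n) → ℤ
    edgeSum z (c ∷ d ∷ r) = (δ z c + δ z d) * σ (E c d) + edgeSum z (d ∷ r)
    edgeSum z _           = + 0

    module _ (symE : ∀ x y → E x y ≡ E y x) where

      Loopless : List (Fin n) → Set
      Loopless xs = All (λ e → proj₁ e ≢ proj₂ e) (edges xs)

      bit-xor : ∀ e b → bit (e xor b) ≡ bit e + bit b * σ e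
      bit-xor true  true  = refl
      bit-xor true  false = refl
      bit-xor false true  = refl
      bit-xor false false = refl

      ∑-sameEdge : ∀ z c d → c ≢ d →
        ∑ (λ y → bit (sameEdge (z , y) (c , d)) * σ (E z y)) ≡ (δ z c + δ z d) * σ (E c d)
      ∑-sameEdge z c d c≢d = go (z ≟ c) (z ≟ d)
        where
        vanish : ∀ {y} → ¬ SameEnds z y c d → bit (sameEdge (z , y) (c , d)) * σ (E z y) ≡ + 0
        vanish {y} ne = cong (λ b → bit b * σ (E z y)) (≢-sameEdge ne)
        go : Dec (z ≡ c) → Dec (z ≡ d) →
          ∑ (λ y → bit (sameEdge (z , y) (c , d)) * σ (E z y)) ≡ (δ z c + δ z d) * σ (E c d)
        go (yes refl) _ = trans
          (∑-single d (λ y y≢d → vanish λ { (inj₁ (_ , q)) → y≢d q ; (inj₂ (q , _)) → c≢d q }))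
          (cong (_* σ (E z d)) (trans (cong bit (sameEdge-refl z d)) (sym (cong₂ _+_ (δ-refl z) (δ-≢ c≢d)))))
        go (no z≢c) (yes refl) = trans
          (∑-single c (λ y y≢c → vanish λ { (inj₁ (q , _)) → z≢c q ; (inj₂ (_ , q)) → y≢c q }))
          (cong₂ _*_ (trans (cong bit (trans (sameEdge-swapʳ z c z c) (sameEdge-refl z c)))
                            (sym (cong₂ _+_ (δ-≢ z≢c) (δ-refl z))))
                     (cong σ (symE z c)))
        go (no z≢c) (no z≢d) = trans
          (∑-0 {n} (λ y → vanish {y} λ { (inj₁ (q , _)) → z≢c q ; (inj₂ (q , _)) → z≢d q }))
          (cong (_* σ (E c d)) (sym (cong₂ _+_ (δ-≢ z≢c) (δ-≢ z≢d))))

      ∑-mult : ∀ z xs → Loopless xs → ∑ (λ y → + mult z y xs * σ (E z y)) ≡ edgeSum z xs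
      ∑-mult z []          l = ∑-0 {n} (λ y → refl)
      ∑-mult z (c ∷ [])    l = ∑-0 {n} (λ y → refl)
      ∑-mult z (c ∷ d ∷ r) (l ∷ ls) = begin
        ∑ (λ y → + (b2n (sameEdge (z , y) (c , d)) ℕ.+ mult z y (d ∷ r)) * σ (E z y))
          ≡⟨ ∑-cong (λ y → ℤ.*-distribʳ-+ (σ (E z y)) (bit (sameEdge (z , y) (c , d))) (+ mult z y (d ∷ r))) ⟩
        ∑ (λ y → bit (sameEdge (z , y) (c , d)) * σ (E z y) + + mult z y (d ∷ r) * σ (E z y))
          ≡⟨ ∑-+ {n} _ _ ⟩
        ∑ (λ y → bit (sameEdge (z , y) (c , d)) * σ (E z y)) + ∑ (λ y → + mult z y (d ∷ r) * σ (E z y))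
          ≡⟨ cong₂ _+_ (∑-sameEdge z c d l) (∑-mult z (d ∷ r) ls) ⟩
        edgeSum z (c ∷ d ∷ r) ∎
        where open ≡-Reasoning

      deg-symDiff : ∀ P → EdgeSimple (toList P) → Loopless (toList P) → ∀ z →
        + deg (symDiff E P) z ≡ + deg E z + edgeSum z (toList P)
      deg-symDiff P s l z = begin
        + deg (symDiff E P) z
          ≡⟨ sum-∑ (λ y → b2n (symDiff E P z y)) ⟩
        ∑ (λ y → bit (symDiff E P z y))
          ≡⟨ ∑-cong (λ y → trans (bit-xor (E z y) (inP P z y))
               (cong (λ m → bit (E z y) + + m * σ (E z y)) (anyB-mult z y (toList P) (s z y)))) ⟩
        ∑ (λ y → bit (E z y) + + mult z y (toList P) * σ (E z y))
          ≡⟨ ∑-+ {n} _ _ ⟩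
        ∑ (λ y → bit (E z y)) + ∑ (λ y → + mult z y (toList P) * σ (E z y))
          ≡⟨ cong₂ _+_ (sym (sum-∑ (λ y → b2n (E z y)))) (∑-mult z (toList P) l) ⟩
        + deg E z + edgeSum z (toList P) ∎
        where open ≡-Reasoning

  inP-swap : ∀ P a b → inP P a b ≡ inP P b a
  inP-swap P a b = go (toList P)
    where
    go : ∀ xs → anyB (sameEdge (a , b)) (edges xs) ≡ anyB (sameEdge (b , a)) (edges xs)
    go []          = refl
    go (c ∷ [])    = refl
    go (c ∷ d ∷ r) = cong₂ _∨_ (sym (sameEdge-swapˡ a b c d)) (go (d ∷ r))

  Walk : (Fin n → Fin n → Bool) → List (Fin n) → Set
  Walk A xs = All (λ e → A (proj₁ e) (proj₂ e) ≡ true) (edges xs)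

module _ {n : ℕ} {G : Graph n} where

  adj⇒≢ : ∀ {a b} → adj G a b ≡ true → a ≢ b
  adj⇒≢ {a} e refl = true≢false e (irrefl G a)

  walk⇒loopless : ∀ {xs} (F : Spanning G) → Walk (adj G) xs → Loopless (E F) (symE F) xs
  walk⇒loopless F = All.map adj⇒≢

  inP⇒adj : ∀ P → Walk (adj G) (toList P) → ∀ x y → inP P x y ≡ true → adj G x y ≡ true
  inP⇒adj P w x y = go (toList P) w
    where
    go : ∀ xs → Walk (adj G) xs → anyB (sameEdge (x , y)) (edges xs) ≡ true → adj G x y ≡ true
    go (c ∷ d ∷ r) (a ∷ as) e with sameEdge (x , y) (c , d) in se
    ... | false = go (d ∷ r) as e
    ... | true with sameEdge⇒ {a = x} {y} {c} {d} se
    ...   | inj₁ (refl , refl) = a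
    ...   | inj₂ (refl , refl) = trans (adj-sym G x y) a

  toggle : (F : Spanning G) (P : List⁺ (Fin n)) → Walk (adj G) (toList P) → Spanning G
  E    (toggle F P w) = symDiff (E F) P
  symE (toggle F P w) x y = cong₂ _xor_ (symE F x y) (inP-swap P x y)
  subE (toggle F P w) x y e with E F x y in f
  ... | true  = subE F x y f
  ... | false = inP⇒adj P w x y e

-- Optimality of F

module _ {n : ℕ} {G : Graph n} where

  ∑def : ∀ H (F : Spanning G) → + defSum H (E F) ≡ ∑ (λ z → + defE H (E F) z)
  ∑def H F = sum-∑ (defE H (E F))

  neighbour : (F : Spanning G) → ∀ x → deg (E F) x ≢ 0 → ∃ λ y → E F x y ≡ true
  neighbour F x d≢0 with any? (λ y → E F x y Bool.≟ true)
  ... | yes p = p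
  ... | no ¬p = ⊥-elim (d≢0 (ℤ.+-injective (trans (sum-∑ (λ y → b2n (E F x y)))
                  (∑-0 (λ y → cong bit (isolated y))))))
    where
    isolated : ∀ y → E F x y ≡ false
    isolated y with E F x y in e
    ... | false = refl
    ... | true  = ⊥-elim (¬p (y , e))

  module Removal (F : Spanning G) {x y : Fin n} (xy∈F : E F x y ≡ true) where

    x≢y : x ≢ y
    x≢y = adj⇒≢ {G = G} (subE F x y xy∈F)

    F⁻ : Spanning G
    F⁻ = toggle F (x ∷ y ∷ []) (subE F x y xy∈F ∷ [])

    deg-removal : ∀ z → + deg (E F⁻) z + (δ z x + δ z y) ≡ + deg (E F) z
    deg-removal z = trans
      (cong (_+ (δ z x + δ z y)) (deg-symDiff (E F) (symE F) (x ∷ y ∷ []) simple (x≢y ∷ []) z))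
      (trans (cong (λ b → + deg (E F) z + ((δ z x + δ z y) * σ b + + 0) + (δ z x + δ z y)) xy∈F)
             (cancel (+ deg (E F) z) (δ z x + δ z y)))
      where
      simple : EdgeSimple (x ∷ y ∷ [])
      simple a b = ℕ.≤-trans (ℕ.≤-reflexive (ℕ.+-identityʳ _)) (b2n≤1 _)
      cancel : ∀ d e → (d + (e * - + 1 + + 0)) + e ≡ d
      cancel = solve-∀

    deg-x : deg (E F) x ≡ suc (deg (E F⁻) x)
    deg-x = ℤ.+-injective (trans (sym (deg-removal x))
      (trans (cong (_+_ (+ deg (E F⁻) x)) (cong₂ _+_ (δ-refl x) (δ-≢ x≢y))) (cong +_ (ℕ.+-comm _ 1))))

    deg-y : deg (E F) y ≡ suc (deg (E F⁻) y)
    deg-y = ℤ.+-injective (trans (sym (deg-removal y))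
      (trans (cong (_+_ (+ deg (E F⁻) y)) (cong₂ _+_ (δ-≢ (x≢y ∘ sym)) (δ-refl y))) (cong +_ (ℕ.+-comm _ 1))))

    deg-other : ∀ {z} → z ≢ x → z ≢ y → deg (E F⁻) z ≡ deg (E F) z
    deg-other {z} z≢x z≢y = ℤ.+-injective (trans (sym (+-identityʳ _))
      (trans (cong (_+_ (+ deg (E F⁻) z)) (sym (cong₂ _+_ (δ-≢ z≢x) (δ-≢ z≢y)))) (deg-removal z)))

    deg-removal-≤ : ∀ z → deg (E F⁻) z ℕ.≤ deg (E F) z
    deg-removal-≤ z = ℤ.drop‿+≤+ (ℤ.≤-trans (ℤ.i≤i+j _ (δ z x + δ z y)) (ℤ.≤-reflexive (deg-removal z)))

    removal-subset : ∀ a b → E F⁻ a b ≡ true → E F a b ≡ true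
    removal-subset a b e with E F a b in f
    ... | true  = refl
    ... | false with sameEdge (a , b) (x , y) in s
    ...   | true with sameEdge⇒ {a = a} {b} {x} {y} s
    ...     | inj₁ (refl , refl) = trans (sym f) xy∈F
    ...     | inj₂ (refl , refl) = trans (sym f) (trans (symE F a b) xy∈F)

    removed : E F⁻ x y ≡ false
    removed = cong₂ _xor_ xy∈F (cong (_∨ false) (sameEdge-refl x y))

    -- The gain of at least 1 at `x` pays for the loss of at most 1 at `y`. Adding `δ z x` on one
    -- side and `δ z y` on the other transfers this unit, so that the comparison can be made vertex
    -- by vertex.
    defSum-removal : ∀ H → defE H (E F⁻) x ℕ.< defE H (E F) x → defSum H (E F⁻) ℕ.≤ defSum H (E F)
    defSum-removal H lt = ℕ.+-cancelʳ-≤ 1 _ _ (ℤ.drop‿+≤+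
      (subst₂ ℤ._≤_ (shift F⁻ x) (shift F y) (∑-mono (λ z → pointwise z (z ≟ x) (z ≟ y)))))
      where
      shift : ∀ (F′ : Spanning G) w → ∑ (λ z → + defE H (E F′) z + δ z w) ≡ + (defSum H (E F′) ℕ.+ 1)
      shift F′ w = trans (∑-+ {n} _ (λ z → δ z w))
        (cong₂ _+_ (sym (∑def H F′)) (trans (∑-single w (λ z z≢w → δ-≢ z≢w)) (δ-refl w)))
      compare : ∀ {z a b} → δ z x ≡ + a → δ z y ≡ + b →
                defE H (E F⁻) z ℕ.+ a ℕ.≤ defE H (E F) z ℕ.+ b →
                + defE H (E F⁻) z + δ z x ≤ + defE H (E F) z + δ z y
      compare {z} p q le = subst₂ (λ a b → + defE H (E F⁻) z + a ≤ + defE H (E F) z + b) (sym p) (sym q) (ℤ.+≤+ le)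
      pointwise : ∀ z → Dec (z ≡ x) → Dec (z ≡ y) → + defE H (E F⁻) z + δ z x ≤ + defE H (E F) z + δ z y
      pointwise z (yes refl) _ = compare (δ-refl z) (δ-≢ x≢y)
        (ℕ.≤-trans (ℕ.≤-reflexive (ℕ.+-comm _ 1)) (ℕ.≤-trans lt (ℕ.m≤m+n _ 0)))
      pointwise z (no z≢x) (yes refl) = compare (δ-≢ z≢x) (δ-refl z)
        (ℕ.≤-trans (ℕ.≤-reflexive (ℕ.+-identityʳ _))
          (ℕ.≤-trans (dist-pred≤ (deg (E F⁻) z) (H z))
            (ℕ.≤-reflexive (trans (ℕ.+-comm 1 _) (cong (λ d → dist d (H z) ℕ.+ 1) (sym deg-y))))))
      pointwise z (no z≢x) (no z≢y) = compare (δ-≢ z≢x) (δ-≢ z≢y)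
        (ℕ.≤-reflexive (cong (λ d → dist d (H z) ℕ.+ 0) (deg-other z≢x z≢y)))

  -- An overfull vertex exceeds every element of its set, so dropping any F-edge there brings it
  -- closer. The degree sum decreases, so the trimming stops.
  bounded-below : ∀ H (F : Spanning G) → Σ (Spanning G) λ F′ → Bounded H F′ × defSum H (E F′) ℕ.≤ defSum H (E F)
  bounded-below H F = go F (<-wellFounded _)
    where
    size : Spanning G → ℕ
    size F = sum (map (deg (E F)) (allFin n))
    go : ∀ F → Acc ℕ._<_ (size F) → Σ (Spanning G) λ F′ → Bounded H F′ × defSum H (E F′) ℕ.≤ defSum H (E F)
    go F (acc rs) with any? (λ x → MH H x ℕ.<? deg (E F) x)
    ... | no ¬p = F , (λ x → ℕ.≮⇒≥ (λ lt → ¬p (x , lt))) , ℕ.≤-refl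
    ... | yes (x , lt) with neighbour F x (ℕ.m<n⇒n≢0 lt)
    ...   | y , xy with go F⁻ (rs smaller)
      where
      open Removal F xy
      smaller : size F⁻ ℕ.< size F
      smaller = ℤ.drop‿+<+ (subst₂ ℤ._<_ (sym (sum-∑ (deg (E F⁻)))) (sym (sum-∑ (deg (E F))))
        (∑-mono-< (λ z → ℤ.+≤+ (deg-removal-≤ z)) x (ℤ.+<+ (ℕ.≤-reflexive (sym deg-x)))))
    ...     | F′ , bd , le = F′ , bd , ℕ.≤-trans le (defSum-removal H closer)
      where
      open Removal F xy
      closer : defE H (E F⁻) x ℕ.< defE H (E F) x
      closer = subst (λ d → defE H (E F⁻) x ℕ.< dist d (H x)) (sym deg-x)
                 (dist-above (H x) (ℕ.≤-pred (subst (MH H x ℕ.<_) deg-x lt)))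

  module _ (H : Pres n) (F : Spanning G) (chosen : IsChosen G H F) where

    -- The total deficiency ranges over all spanning subgraphs, while `F` is optimal only among the
    -- bounded ones; trimming bridges the difference.
    totalDef≡defSum : ∀ k → IsTotalDef G H k → k ≡ defSum H (E F)
    totalDef≡defSum k ((F₁ , e) , least) with bounded-below H F₁
    ... | F₂ , bd , le = ℕ.≤-antisym (least F)
          (ℕ.≤-trans (proj₁ (proj₂ chosen) F₂ bd) (ℕ.≤-trans le (ℕ.≤-reflexive e)))

    no-improvement : ∀ (F′ : Spanning G) → Bounded H F′ → (∀ z → defE H (E F′) z ℕ.≤ defE H (E F) z) →
                     ∀ v → ¬ defE H (E F′) v ℕ.< defE H (E F) v
    no-improvement F′ bd le v lt = ℕ.<⇒≱ (ℤ.drop‿+<+ (subst₂ ℤ._<_ (sym (∑def H F′)) (sym (∑def H F))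
      (∑-mono-< (λ z → ℤ.+≤+ (le z)) v (ℤ.+<+ lt)))) (proj₁ (proj₂ chosen) F′ bd)

    -- By minimality of E(F): a vertex whose degree lies in a gap of H could drop an F-edge for free.
    B₀⇒below : Star H → ∀ {x} → B₀ H F x → deg (E F) x ℕ.< mH H x
    B₀⇒below star {x} x∈B₀ with deg (E F) x ℕ.<? mH H x
    ... | yes lt = lt
    ... | no  ≮  = ⊥-elim contra
      where
      mH≤d : mH H x ℕ.≤ deg (E F) x
      mH≤d = ℕ.≮⇒≥ ≮
      mH<d : mH H x ℕ.< deg (E F) x
      mH<d = ℕ.≤∧≢⇒< mH≤d (λ e → x∈B₀ (subst (_∈ toList (H x)) e (min∈ _ _)))
      contra : ⊥
      contra with neighbour F x (ℕ.m<n⇒n≢0 mH<d)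
      ... | y , xy = true≢false (keep x y xy) removed
        where
        open Removal F xy
        d⁻∈H : deg (E F⁻) x ∈ toList (H x)
        d⁻∈H with _∈?_ ℕ._≟_ (deg (E F⁻) x) (toList (H x))
        ... | yes p = p
        -- If one less than the degree of `x` were also missing from `H x`, then (*) would put the
        -- degree itself into `H x`.
        ... | no ¬p = ⊥-elim (x∈B₀ (subst (_∈ toList (H x)) (sym deg-x)
                (star x _ (ℕ.≤-pred (subst (mH H x ℕ.<_) deg-x mH<d))
                          (ℕ.≤-trans (deg-removal-≤ x) (proj₁ chosen x)) ¬p)))
        bd⁻ : Bounded H F⁻
        bd⁻ z = ℕ.≤-trans (deg-removal-≤ z) (proj₁ chosen z)
        closer : defE H (E F⁻) x ℕ.< defE H (E F) x
        closer rewrite ∈⇒dist≡0 (H x) d⁻∈H = ℕ.n≢0⇒n>0 (x∈B₀ ∘ dist≡0⇒∈ (H x))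
        keep : ∀ a b → E F a b ≡ true → E F⁻ a b ≡ true
        keep = proj₂ (proj₂ chosen) F⁻ bd⁻
          (ℕ.≤-antisym (defSum-removal H closer) (proj₁ (proj₂ chosen) F⁻ bd⁻)) removal-subset

-- Alternating trails

module _ {A : Set} where

  lastFrom : A → List A → A
  lastFrom x []       = x
  lastFrom _ (y ∷ ys) = lastFrom y ys

  -- `last` is computed through `snocView` and does not unfold along a cons, so all inductions are
  -- run on `lastFrom` instead.
  last≡lastFrom : ∀ x xs → last (x ∷ xs) ≡ lastFrom x xs
  last≡lastFrom x xs = ends (x ∷ xs)
    where
    final : ∀ x xs (ys : List A) y → x ∷ xs ≡ ys ++ [ y ] → y ≡ lastFrom x xs
    final x []       []           y refl = refl
    final x []       (z ∷ [])     y ()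
    final x []       (z ∷ _ ∷ _)  y ()
    final x (w ∷ xs) (z ∷ ys)     y e    = final w xs ys y (∷-injectiveʳ e)
    ends : ∀ (P : List⁺ A) → last P ≡ lastFrom (L⁺.head P) (L⁺.tail P)
    ends P with snocView P
    ... | []       ∷ʳ′ y = refl
    ... | (x ∷ xs) ∷ʳ′ y = final x (xs ++ [ y ]) (x ∷ xs) y refl

module Trails {n : ℕ} {G : Graph n} (H : Pres n) (F : Spanning G) where

  d : Fin n → ℕ
  d = deg (E F)

  -- Both toggled edges at v may be of type s (true for F-edges) although this changes the degree by ±2.
  Gap : Fin n → Bool → Set
  Gap v s = d v ∈ toList (H v) × Σ ℕ λ h → h ∈ toList (H v) × + h ≡ + d v + (σ s + σ s)

  data Pass (v : Fin n) (s t : Bool) : Set where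
    alt : t ≡ not s → Pass v s t
    gap : s ≡ t → Gap v s → Pass v s t

  not-swap : ∀ s {t} → t ≡ not s → s ≡ not t
  not-swap true  refl = refl
  not-swap false refl = refl

  passSym : ∀ {v s t} → Pass v s t → Pass v t s
  passSym (alt e)      = alt (not-swap _ e)
  passSym (gap refl g) = gap refl g

  -- Tr v s x t: a walk from v to x, thought of as entering v along an edge of type s and leaving x
  -- along an edge of type t (an edge has type true when it lies in F).
  data Tr : Fin n → Bool → Fin n → Bool → Set where
    one  : ∀ {v s t} → Pass v s t → Tr v s v t
    step : ∀ {v s w x t} → Pass v s (E F v w) → adj G v w ≡ true → Tr w (E F v w) x t → Tr v s x t

  tl : ∀ {v s x t} → Tr v s x t → List (Fin n)
  tl (one _)              = []
  tl (step {w = w} _ _ r) = w ∷ tl r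

  vs : ∀ {v s x t} → Tr v s x t → List (Fin n)
  vs {v} p = v ∷ tl p

  join : ∀ {v s a t b x u} → Tr v s a t → adj G a b ≡ true → E F a b ≡ t → Tr b t x u → Tr v s x u
  join (one p)      ab refl q = step p ab q
  join (step p a r) ab e    q = step p a (join r ab e q)

  vs-join : ∀ {v s a t b x u} (p : Tr v s a t) (ab : adj G a b ≡ true) (e : E F a b ≡ t) (q : Tr b t x u) →
            vs (join p ab e q) ≡ vs p ++ vs q
  vs-join (one p)      ab refl q = refl
  vs-join (step {v} p a r) ab e q = cong (v ∷_) (vs-join r ab e q)

  rev : ∀ {v s x t} → Tr v s x t → Tr x t v s
  rev (one p) = one (passSym p)
  rev (step {v} {w = w} p a r) =
    join (rev r) (trans (adj-sym G w v) a) (symE F w v) (one (passSym p))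

  ∈-rev : ∀ {v s x t z} (p : Tr v s x t) → z ∈ vs (rev p) → z ∈ vs p
  ∈-rev (one p) z∈ = z∈
  ∈-rev {z = z} (step {v} {w = w} p a r) z∈
    with ∈-++⁻ (vs (rev r)) (subst (z ∈_) (vs-join (rev r) (trans (adj-sym G w v) a) (symE F w v) (one (passSym p))) z∈)
  ... | inj₁ z∈r        = there (∈-rev r z∈r)
  ... | inj₂ (here refl) = here refl

  head∈ : ∀ {v s x t} (p : Tr v s x t) → v ∈ vs p
  head∈ p = here refl

  last∈ : ∀ {v s x t} (p : Tr v s x t) → x ∈ vs p
  last∈ (one p)      = here refl
  last∈ (step p a r) = there (last∈ r)

  lastFrom-tl : ∀ {v s x t} (p : Tr v s x t) → lastFrom v (tl p) ≡ x
  lastFrom-tl (one p)      = refl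
  lastFrom-tl (step p a r) = lastFrom-tl r

  walk : ∀ {v s x t} (p : Tr v s x t) → Walk (adj G) (vs p)
  walk (one p)      = []
  walk (step p a r) = a ∷ walk r

  gapCount : ∀ {v s t} → Pass v s t → ℕ
  gapCount (alt _)   = 0
  gapCount (gap _ _) = 1

  gapCount-sym : ∀ {v s t} (p : Pass v s t) → gapCount (passSym p) ≡ gapCount p
  gapCount-sym (alt e)      = refl
  gapCount-sym (gap refl g) = refl

  gaps : ∀ {v s x t} → Fin n → Tr v s x t → ℕ
  gaps z (one {v} p)      = b2n (eqF z v) ℕ.* gapCount p
  gaps z (step {v} p a r) = b2n (eqF z v) ℕ.* gapCount p ℕ.+ gaps z r

  gaps-join : ∀ {v s a t b x u} z (p : Tr v s a t) (ab : adj G a b ≡ true) (e : E F a b ≡ t) (q : Tr b t x u) →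
              gaps z (join p ab e q) ≡ gaps z p ℕ.+ gaps z q
  gaps-join z (one p)          ab refl q = refl
  gaps-join z (step {v} p a r) ab e    q =
    trans (cong (b2n (eqF z v) ℕ.* gapCount p ℕ.+_) (gaps-join z r ab e q))
          (sym (ℕ.+-assoc (b2n (eqF z v) ℕ.* gapCount p) _ _))

  gaps-rev : ∀ {v s x t} z (p : Tr v s x t) → gaps z (rev p) ≡ gaps z p
  gaps-rev z (one {v} p) = cong (b2n (eqF z v) ℕ.*_) (gapCount-sym p)
  gaps-rev z (step {v} p a r) =
    trans (gaps-join z (rev r) _ _ (one (passSym p)))
    (trans (cong₂ ℕ._+_ (gaps-rev z r) (cong (b2n (eqF z v) ℕ.*_) (gapCount-sym p)))
           (ℕ.+-comm (gaps z r) _))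

  gaps-∉ : ∀ {v s x t z} (p : Tr v s x t) → z ∉ vs p → gaps z p ≡ 0
  gaps-∉ (one p)      z∉ = cong (λ b → b2n b ℕ.* gapCount p) (eqF-≢ (z∉ ∘ here))
  gaps-∉ (step p a r) z∉ = cong₂ (λ b m → b2n b ℕ.* gapCount p ℕ.+ m) (eqF-≢ (z∉ ∘ here)) (gaps-∉ r (z∉ ∘ there))

  mult-join : ∀ {v s a t b x u} y z (p : Tr v s a t) (ab : adj G a b ≡ true) (e : E F a b ≡ t) (q : Tr b t x u) →
              mult y z (vs (join p ab e q)) ≡ mult y z (vs p) ℕ.+ (b2n (sameEdge (y , z) (a , b)) ℕ.+ mult y z (vs q))
  mult-join y z (one p) ab refl q = refl
  mult-join y z (step {v} {w = w} p a r) ab e q =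
    trans (cong (b2n (sameEdge (y , z) (v , w)) ℕ.+_) (mult-join y z r ab e q))
          (sym (ℕ.+-assoc (b2n (sameEdge (y , z) (v , w))) _ _))

  mult-rev : ∀ {v s x t} y z (p : Tr v s x t) → mult y z (vs (rev p)) ≡ mult y z (vs p)
  mult-rev y z (one p) = refl
  mult-rev y z (step {v} {w = w} p a r) =
    trans (mult-join y z (rev r) _ _ (one (passSym p)))
    (trans (cong₂ ℕ._+_ (mult-rev y z r) (trans (ℕ.+-identityʳ _) (cong b2n (sameEdge-swapʳ y z v w))))
           (ℕ.+-comm (mult y z (vs r)) _))

  -- Alternating visits leave the degree unchanged and may be repeated freely, but `Gap` vouches
  -- only for a single shift by 2; a second one could leave `H`.
  record Legal {v s x t} (p : Tr v s x t) : Set where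
    constructor legal
    field
      edgeSimple : EdgeSimple (vs p)
      gaps≤1     : ∀ z → gaps z p ℕ.≤ 1
  open Legal

  legal-one : ∀ {v s t} (p : Pass v s t) → Legal (one p)
  edgeSimple (legal-one p)     a b = z≤n
  gaps≤1     (legal-one {v} p) z   = ℕ.*-mono-≤ (b2n≤1 (eqF z v)) (bound p)
    where
    bound : ∀ {s t} (p : Pass v s t) → gapCount p ℕ.≤ 1
    bound (alt _)   = z≤n
    bound (gap _ _) = ℕ.≤-refl

  legal-rev : ∀ {v s x t} {p : Tr v s x t} → Legal p → Legal (rev p)
  edgeSimple (legal-rev {p = p} l) a b = subst (ℕ._≤ 1) (sym (mult-rev a b p)) (edgeSimple l a b)
  gaps≤1     (legal-rev {p = p} l) z   = subst (ℕ._≤ 1) (sym (gaps-rev z p)) (gaps≤1 l z)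

  Disjoint : List (Fin n) → List (Fin n) → Set
  Disjoint xs ys = ∀ {z} → z ∈ xs → z ∉ ys

  -- The connecting edge has one end on each side, so by disjointness it occurs in neither part; any
  -- other edge and any gap belong to at most one part.
  legal-join : ∀ {v s a t b x u} {p : Tr v s a t} (ab : adj G a b ≡ true) (e : E F a b ≡ t) {q : Tr b t x u} →
               Legal p → Legal q → Disjoint (vs p) (vs q) → Legal (join p ab e q)
  edgeSimple (legal-join {a = a} {b = b} {p = p} ab e {q} lp lq dj) y z =
    subst (ℕ._≤ 1) (sym (mult-join y z p ab e q)) bound
    where
    cross : b2n (sameEdge (y , z) (a , b)) ℕ.≤ 1
    cross = b2n≤1 (sameEdge (y , z) (a , b))
    crossing : SameEnds y z a b → mult y z (vs p) ≡ 0 × mult y z (vs q) ≡ 0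
    crossing (inj₁ (refl , refl)) = mult-∉ʳ y (vs p) (λ z∈ → dj z∈ (head∈ q)) , mult-∉ˡ z (vs q) (dj (last∈ p))
    crossing (inj₂ (refl , refl)) = mult-∉ˡ z (vs p) (λ y∈ → dj y∈ (head∈ q)) , mult-∉ʳ y (vs q) (dj (last∈ p))
    bound : mult y z (vs p) ℕ.+ (b2n (sameEdge (y , z) (a , b)) ℕ.+ mult y z (vs q)) ℕ.≤ 1
    bound with sameEdge (y , z) (a , b) in same
    ... | true with crossing (sameEdge⇒ {a = y} {z} {a} {b} same)
    ...   | p0 , q0 rewrite p0 | q0 = ℕ.≤-refl
    bound | false with _∈?_ _≟_ y (vs p)
    ... | yes y∈ = subst (λ m → mult y z (vs p) ℕ.+ m ℕ.≤ 1) (sym (mult-∉ˡ z (vs q) (dj y∈)))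
                     (ℕ.≤-trans (ℕ.≤-reflexive (ℕ.+-identityʳ _)) (edgeSimple lp y z))
    ... | no  y∉ = subst (λ m → m ℕ.+ mult y z (vs q) ℕ.≤ 1) (sym (mult-∉ˡ z (vs p) y∉)) (edgeSimple lq y z)
  gaps≤1 (legal-join {p = p} ab e {q} lp lq dj) z = subst (ℕ._≤ 1) (sym (gaps-join z p ab e q)) bound
    where
    bound : gaps z p ℕ.+ gaps z q ℕ.≤ 1
    bound with _∈?_ _≟_ z (vs p)
    ... | yes z∈ = subst (λ m → gaps z p ℕ.+ m ℕ.≤ 1) (sym (gaps-∉ q (dj z∈)))
                     (ℕ.≤-trans (ℕ.≤-reflexive (ℕ.+-identityʳ _)) (gaps≤1 lp z))
    ... | no  z∉ = subst (λ m → m ℕ.+ gaps z q ℕ.≤ 1) (sym (gaps-∉ p z∉)) (gaps≤1 lq z)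

  loop : ∀ {r s a u b v t} → s ≡ not u → t ≡ not v → adj G r a ≡ true → E F r a ≡ u → Tr a u b v →
         adj G b r ≡ true → E F b r ≡ v → Tr r s r t
  loop {u = u} s≡ t≡ ra ea p br eb = join (one (passSym (alt s≡))) ra ea (join p br eb (one (alt t≡)))

  -- The two edges at `r` differ because `a ≢ b`, and neither occurs in `p` because `p` avoids `r`.
  -- Both visits of `r` alternate, so its gap is not spent.
  legal-loop : ∀ {r s a u b v t} (s≡ : s ≡ not u) (t≡ : t ≡ not v) (ra : adj G r a ≡ true) (ea : E F r a ≡ u)
               (p : Tr a u b v) (br : adj G b r ≡ true) (eb : E F b r ≡ v) →
               Legal p → r ∉ vs p → a ≢ b → Legal (loop s≡ t≡ ra ea p br eb)
  edgeSimple (legal-loop {r} {a = a} {b = b} refl t≡ ra refl p br eb lp r∉ a≢b) y z =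
    subst (λ m → b2n (sameEdge (y , z) (r , a)) ℕ.+ m ℕ.≤ 1) (sym (mult-join y z p br eb (one (alt t≡)))) bound
    where
    aside : SameEnds y z r a → mult y z (vs p) ≡ 0 × sameEdge (y , z) (b , r) ≡ false
    aside (inj₁ (refl , refl)) = mult-∉ˡ z (vs p) r∉ ,
      ≢-sameEdge {a = y} {z} {b} {r} λ { (inj₁ (refl , _)) → r∉ (last∈ p) ; (inj₂ (_ , a≡b)) → a≢b a≡b }
    aside (inj₂ (refl , refl)) = mult-∉ʳ y (vs p) r∉ ,
      ≢-sameEdge {a = y} {z} {b} {r} λ { (inj₁ (a≡b , _)) → a≢b a≡b ; (inj₂ (_ , refl)) → r∉ (last∈ p) }
    aside′ : SameEnds y z b r → mult y z (vs p) ≡ 0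
    aside′ (inj₁ (refl , refl)) = mult-∉ʳ y (vs p) r∉
    aside′ (inj₂ (refl , refl)) = mult-∉ˡ z (vs p) r∉
    bound : b2n (sameEdge (y , z) (r , a)) ℕ.+ (mult y z (vs p) ℕ.+ (b2n (sameEdge (y , z) (b , r)) ℕ.+ 0)) ℕ.≤ 1
    bound with sameEdge (y , z) (r , a) in same
    ... | true with aside (sameEdge⇒ {a = y} {z} {r} {a} same)
    ...   | m0 , f rewrite m0 | f = ℕ.≤-refl
    bound | false with sameEdge (y , z) (b , r) in same′
    ... | true rewrite aside′ (sameEdge⇒ {a = y} {z} {b} {r} same′) = ℕ.≤-refl
    ... | false = ℕ.≤-trans (ℕ.≤-reflexive (ℕ.+-identityʳ _)) (edgeSimple lp y z)
  gaps≤1 (legal-loop {r} refl t≡ ra refl p br eb lp r∉ a≢b) z =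
    subst (ℕ._≤ 1) (sym (trans (cong (b2n (eqF z r) ℕ.* 0 ℕ.+_) (gaps-join z p br eb (one (alt t≡)))) count)) (gaps≤1 lp z)
    where
    count : b2n (eqF z r) ℕ.* 0 ℕ.+ (gaps z p ℕ.+ b2n (eqF z r) ℕ.* 0) ≡ gaps z p
    count rewrite ℕ.*-zeroʳ (b2n (eqF z r)) = ℕ.+-identityʳ _

  ∈-loop : ∀ {r s a u b v t z} (s≡ : s ≡ not u) (t≡ : t ≡ not v) (ra : adj G r a ≡ true) (ea : E F r a ≡ u)
           (p : Tr a u b v) (br : adj G b r ≡ true) (eb : E F b r ≡ v) →
           z ∈ vs (loop s≡ t≡ ra ea p br eb) → z ≡ r ⊎ z ∈ vs p
  ∈-loop refl t≡ ra refl p br eb (here e) = inj₁ e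
  ∈-loop {z = z} refl t≡ ra refl p br eb (there z∈)
    with ∈-++⁻ (vs p) (subst (z ∈_) (vs-join p br eb (one (alt t≡))) z∈)
  ... | inj₁ z∈p      = inj₂ z∈p
  ... | inj₂ (here e) = inj₁ e

  ∈-join : ∀ {v s a t b x u z} (p : Tr v s a t) (ab : adj G a b ≡ true) (e : E F a b ≡ t) (q : Tr b t x u) →
           z ∈ vs (join p ab e q) → z ∈ vs p ⊎ z ∈ vs q
  ∈-join {z = z} p ab e q z∈ = ∈-++⁻ (vs p) (subst (z ∈_) (vs-join p ab e q) z∈)

  -- The degree change with the virtual entry and exit edges counted as toggled too. Grouped by
  -- visits instead of edges, it vanishes at each alternating visit.
  passSum : ∀ {v s x t} → Fin n → Tr v s x t → ℤ
  passSum z (one {v} {s} {t} p)          = δ z v * (σ s + σ t)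
  passSum z (step {v} {s} {w} p a r) = δ z v * (σ s + σ (E F v w)) + passSum z r

  edgeSum-passSum : ∀ {v s x t} z (p : Tr v s x t) →
    edgeSum (E F) z (vs p) + (δ z v * σ s + δ z x * σ t) ≡ passSum z p
  edgeSum-passSum z (one {v} {s} {t} p) = base (δ z v) (σ s) (σ t)
    where
    base : ∀ e a b → + 0 + (e * a + e * b) ≡ e * (a + b)
    base = solve-∀
  edgeSum-passSum z (step {v} {s} {w} {x} {t} p a r) =
    trans (regroup (δ z v) (δ z w) (σ (E F v w)) (edgeSum (E F) z (vs r)) (σ s) (δ z x * σ t))
          (cong (_+_ (δ z v * (σ s + σ (E F v w)))) (edgeSum-passSum z r))
    where
    regroup : ∀ ev ew m S a c → ((ev + ew) * m + S) + (ev * a + c) ≡ ev * (a + m) + (S + (ew * m + c))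
    regroup = solve-∀

  altSum : ∀ s {t} → t ≡ not s → σ s + σ t ≡ + 0
  altSum true  refl = refl
  altSum false refl = refl

  passTerm-alt : ∀ {v s t} z (p : Pass v s t) → b2n (eqF z v) ℕ.* gapCount p ≡ 0 → δ z v * (σ s + σ t) ≡ + 0
  passTerm-alt {v} z (alt e) _ = trans (cong (δ z v *_) (altSum _ e)) (ℤ.*-zeroʳ (δ z v))
  passTerm-alt {v} {s} z (gap refl _) e =
    cong (λ m → + m * (σ s + σ s)) (trans (sym (ℕ.*-identityʳ (b2n (eqF z v)))) e)

  passSum-0 : ∀ {v s x t} z (p : Tr v s x t) → gaps z p ≡ 0 → passSum z p ≡ + 0
  passSum-0 z (one p) e = passTerm-alt z p e
  passSum-0 z (step {v} p a r) e =
    cong₂ _+_ (passTerm-alt z p (ℕ.m+n≡0⇒m≡0 _ e))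
              (passSum-0 z r (ℕ.m+n≡0⇒n≡0 (b2n (eqF z v) ℕ.* gapCount p) e))

  Net : Fin n → ℤ → Set
  Net z e = e ≡ + 0 ⊎ Σ Bool λ s → Gap z s × e ≡ σ s + σ s

  passTerm-net : ∀ {v s t} z (p : Pass v s t) →
    b2n (eqF z v) ℕ.* gapCount p ≡ 0 ⊎ (1 ℕ.≤ b2n (eqF z v) ℕ.* gapCount p × Gap z s × δ z v * (σ s + σ t) ≡ σ s + σ s)
  passTerm-net {v} z (alt _) = inj₁ (ℕ.*-zeroʳ (b2n (eqF z v)))
  passTerm-net {v} {s} z (gap refl g) with z ≟ v
  ... | yes refl = inj₂ (ℕ.≤-refl , g , ℤ.*-identityˡ (σ s + σ s))
  ... | no _     = inj₁ refl

  -- Once the single permitted gap has been met, all remaining visits alternate and cancel.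
  net : ∀ {v s x t} z (p : Tr v s x t) → gaps z p ℕ.≤ 1 → Net z (passSum z p)
  net z (one {s = s} p) _ with passTerm-net z p
  ... | inj₁ e           = inj₁ (passTerm-alt z p e)
  ... | inj₂ (_ , g , e) = inj₂ (s , g , e)
  net z (step {v} {s} p a r) le with passTerm-net z p
  ... | inj₁ e = subst (Net z) (trans (sym (+-identityˡ _)) (cong (_+ passSum z r) (sym (passTerm-alt z p e))))
                   (net z r (ℕ.≤-trans (ℕ.m≤n+m _ _) le))
  ... | inj₂ (1≤ , g , e) = inj₂ (s , g ,
          trans (cong₂ _+_ e (passSum-0 z r (ℕ.n≤0⇒n≡0 (ℕ.≤-pred (ℕ.≤-trans (ℕ.+-monoˡ-≤ (gaps z r) 1≤) le)))))
                (+-identityʳ _))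

  toggled : ∀ {v s x t} → Tr v s x t → Fin n → Fin n → Bool
  toggled {v} p = symDiff (E F) (v ∷ tl p)

  deg-toggled : ∀ {v s x t} (p : Tr v s x t) → EdgeSimple (vs p) → ∀ z →
    + deg (toggled p) z + (δ z v * σ s + δ z x * σ t) ≡ + d z + passSum z p
  deg-toggled {v} {s} {x} {t} p es z =
    trans (cong (_+ (δ z v * σ s + δ z x * σ t))
                (deg-symDiff (E F) (symE F) (v ∷ tl p) es (walk⇒loopless F (walk p)) z))
    (trans (ℤ.+-assoc (+ d z) (edgeSum (E F) z (vs p)) _) (cong (_+_ (+ d z)) (edgeSum-passSum z p)))

  deg-legal : ∀ {v s x t} (p : Tr v s x t) → Legal p → ∀ z →
    let d′ = + deg (toggled p) z + (δ z v * σ s + δ z x * σ t) in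
    d′ ≡ + d z ⊎ (d z ∈ toList (H z) × Σ ℕ λ h → h ∈ toList (H z) × d′ ≡ + h)
  deg-legal p l z with net z p (gaps≤1 l z)
  ... | inj₁ e = inj₁ (trans (deg-toggled p (edgeSimple l) z) (trans (cong (_+_ (+ d z)) e) (+-identityʳ _)))
  ... | inj₂ (s , (d∈ , h , h∈ , eh) , e) =
        inj₂ (d∈ , h , h∈ , trans (deg-toggled p (edgeSimple l) z) (trans (cong (_+_ (+ d z)) e) (sym eh)))

-- Legal trails from B₀: changeability, and the trails that optimality of F forbids

module Optimal {n : ℕ} {G : Graph n} (H : Pres n) (F : Spanning G) (star : Star H) (chosen : IsChosen G H F) where

  open Trails H F public
  open Legal public

  below : ∀ {x} → B₀ H F x → d x ℕ.< mH H x
  below = B₀⇒below H F chosen star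

  ends-cong : ∀ {v x : Fin n} z s t {a b} → δ z v ≡ a → δ z x ≡ b →
              δ z v * σ s + δ z x * σ t ≡ a * σ s + b * σ t
  ends-cong z s t refl refl = refl

  no-ends : ∀ {v x z k} s t → z ≢ v → z ≢ x → k ≡ k + (δ z v * σ s + δ z x * σ t)
  no-ends {z = z} {k} s t z≢v z≢x =
    trans (sym (+-identityʳ k)) (cong (_+_ k) (sym (ends-cong z s t (δ-≢ z≢v) (δ-≢ z≢x))))

  deg-inner : ∀ {v s x t} (p : Tr v s x t) → Legal p → ∀ {z} → z ≢ v → z ≢ x →
    deg (toggled p) z ≡ d z ⊎ (d z ∈ toList (H z) × deg (toggled p) z ∈ toList (H z))
  deg-inner {s = s} {t = t} p l {z} z≢v z≢x with deg-legal p l z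
  ... | inj₁ e = inj₁ (ℤ.+-injective (trans (no-ends s t z≢v z≢x) e))
  ... | inj₂ (d∈ , h , h∈ , e) =
        inj₂ (d∈ , subst (_∈ toList (H z)) (sym (ℤ.+-injective (trans (no-ends s t z≢v z≢x) e))) h∈)

  -- A `Gap` needs a degree in `H`, so a deficient vertex is only ever passed by alternation:
  -- nothing but the virtual end edges affects its degree.
  deg-root : ∀ {v s x t} (p : Tr v s x t) → Legal p → ∀ {z} → B₀ H F z →
    + deg (toggled p) z + (δ z v * σ s + δ z x * σ t) ≡ + d z
  deg-root p l {z} b with deg-legal p l z
  ... | inj₁ e        = e
  ... | inj₂ (d∈ , _) = ⊥-elim (b d∈)

  private
    pred≡ : ∀ {a b} → + a + - + 1 ≡ + b → a ≡ suc b
    pred≡ {a} {b} e = ℤ.+-injective (trans (back (+ a)) (trans (cong (_+ + 1) e) (cong +_ (ℕ.+-comm b 1))))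
      where
      back : ∀ i → i ≡ (i + - + 1) + + 1
      back = solve-∀

    pred²≡ : ∀ {a b} → + a + - + 2 ≡ + b → a ≡ suc (suc b)
    pred²≡ {a} {b} e = ℤ.+-injective (trans (back (+ a)) (trans (cong (_+ + 2) e) (cong +_ (ℕ.+-comm b 2))))
      where
      back : ∀ i → i ≡ (i + - + 2) + + 2
      back = solve-∀

  -- The virtual F-edge into the root is not actually toggled; discounting its -1 leaves a rise by
  -- 1.
  deg-start : ∀ {v x t} (p : Tr v true x t) → Legal p → B₀ H F v → v ≢ x → deg (toggled p) v ≡ suc (d v)
  deg-start {v} {t = t} p l b v≢x =
    pred≡ (trans (cong (_+_ (+ deg (toggled p) v)) (sym (ends-cong v true t (δ-refl v) (δ-≢ v≢x)))) (deg-root p l b))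

  -- `regular` provides the zero deficiency before toggling that condition (b) asks for; legality
  -- then preserves it under toggling.
  record RootTrail (x : Fin n) (t : Bool) : Set where
    constructor rootTrail
    field
      {root} : Fin n
      root∈B₀ : B₀ H F root
      trail   : Tr root true x t
      islegal : Legal trail
      regular : ∀ {z} → z ∈ vs trail → z ≡ root ⊎ d z ∈ toList (H z)
  open RootTrail public

  -- Condition (d) quantifies over initial subtrails. Cutting a trail turns the next edge's type
  -- into the exit type, so the last visit keeps its pass and no new gap arises.
  prefix : ∀ {v s x t} (p : Tr v s x t) m → Σ (Fin n) λ x′ → Σ Bool λ t′ → Σ (Tr v s x′ t′) λ q →
           tl q ≡ take m (tl p) × (∀ z → gaps z q ℕ.≤ gaps z p)
  prefix (one p)          zero    = _ , _ , one p , refl , λ z → ℕ.≤-refl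
  prefix (one p)          (suc m) = _ , _ , one p , refl , λ z → ℕ.≤-refl
  prefix (step p a r)     zero    = _ , _ , one p , refl , λ z → ℕ.m≤m+n _ _
  prefix (step {v} p a r) (suc m) with prefix r m
  ... | x′ , t′ , q , e , g = x′ , t′ , step p a q , cong (_ ∷_) e , λ z → ℕ.+-monoʳ-≤ (b2n (eqF z v) ℕ.* gapCount p) (g z)

  ∈-take : ∀ {A : Set} {z : A} m xs → z ∈ take m xs → z ∈ xs
  ∈-take (suc m) (x ∷ xs) (here e)   = here e
  ∈-take (suc m) (x ∷ xs) (there z∈) = there (∈-take m xs z∈)

  dist-H : ∀ {h} z → h ∈ toList (H z) → dist h (H z) ≡ 0
  dist-H z = ∈⇒dist≡0 (H z)

  condABC : ∀ {v x t} (p : Tr v true x t) → Legal p → B₀ H F v →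
            (∀ {z} → z ∈ vs p → z ≡ v ⊎ d z ∈ toList (H z)) → CondABC H F (v ∷ tl p)
  condABC {v} {x} p l b reg = condA p , condB , condC
    where
    condA : ∀ {x t} (p : Tr v true x t) → CondA H F (v ∷ tl p)
    condA (one _)                 = b
    condA (step (alt e) _ _)      = b , e
    -- A deficient root has no gap, so its virtual F-entry forces the first edge to lie outside `F`,
    -- as (a) requires.
    condA (step (gap _ g) _ _)    = ⊥-elim (b (proj₁ g))
    last≡x : last (v ∷ tl p) ≡ x
    last≡x = trans (last≡lastFrom v (tl p)) (lastFrom-tl p)
    condB : CondB H F (v ∷ tl p)
    condB z z∈ z≢v z≢last with reg z∈
    ... | inj₁ z≡v = ⊥-elim (z≢v z≡v)
    ... | inj₂ d∈ with deg-inner p l z≢v (λ z≡x → z≢last (trans z≡x (sym last≡x)))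
    ...   | inj₁ e         = dist-H z d∈ , trans (cong (λ k → dist k (H z)) e) (dist-H z d∈)
    ...   | inj₂ (_ , d′∈) = dist-H z d∈ , dist-H z d′∈
    condC : CondC H F (v ∷ tl p)
    condC _ v≢last = ℕ.≤-reflexive (trans
      (cong (λ k → suc (dist k (H v))) (deg-start p l b (λ v≡x → v≢last (trans v≡x (sym last≡x)))))
      (dist-suc< (H v) (below b)))

  changeable : ∀ {x t} (T : RootTrail x t) → Changeable H F (root T ∷ tl (trail T))
  changeable (rootTrail {v} b p l reg) =
    (walk p , EdgeSimple⇒AllPairs (vs p) (edgeSimple l)) , λ m _ → initial m
    where
    initial : ∀ m → CondABC H F (v ∷ take m (tl p))
    initial m with prefix p m
    ... | x′ , t′ , q , e , g = subst (λ l → CondABC H F (v ∷ l)) e (condABC q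
            (legal (λ a b → subst (λ l → mult a b (v ∷ l) ℕ.≤ 1) (sym e) (ℕ.≤-trans (mult-take a b v m (tl p)) (edgeSimple l a b)))
                   (λ z → ℕ.≤-trans (g z) (gaps≤1 l z)))
            b regular′)
      where
      regular′ : ∀ {z} → z ∈ v ∷ tl q → z ≡ v ⊎ d z ∈ toList (H z)
      regular′ (here z≡v) = inj₁ z≡v
      regular′ (there z∈) = reg (there (∈-take m (tl p) (subst (_ ∈_) e z∈)))

  Arrival : Bool → List (Fin n) → Set
  Arrival true  xs = LastEven H F xs
  Arrival false xs = LastOdd H F xs

  arrival-step : ∀ {v s w x t} (p : Pass v s (E F v w)) (a : adj G v w ≡ true) (r : Tr w (E F v w) x t) →
                 Σ Bool λ s′ → Pass x s′ t × Arrival s′ (v ∷ vs r)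
  arrival-step {v} {w = w} p a (one q) = E F v w , q , edge (E F v w) refl
    where
    edge : ∀ b → E F v w ≡ b → Arrival b (v ∷ w ∷ [])
    edge true  e = e
    edge false e = e
  arrival-step p a (step q b r) with arrival-step q b r
  ... | true  , pass , arr = true  , pass , arr
  ... | false , pass , arr = false , pass , arr

  arrival : ∀ {v x t} (p : Tr v true x t) → Σ Bool λ s → Pass x s t × Arrival s (vs p)
  -- Trails of length zero are even, which matches the virtual F-edge into the root.
  arrival (one p)      = true , p , tt
  arrival (step p a r) = arrival-step p a r

  reach : ∀ {x t} → RootTrail x t → (EvenTo H F x × Pass x true t) ⊎ (OddTo H F x × Pass x false t)
  reach {x} T with arrival (trail T)
  ... | true  , pass , arr = inj₁ ((root T ∷ tl (trail T) , changeable T , arr ,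
                               trans (last≡lastFrom (root T) (tl (trail T))) (lastFrom-tl (trail T))) , pass)
  ... | false , pass , arr = inj₂ ((root T ∷ tl (trail T) , changeable T , arr ,
                               trans (last≡lastFrom (root T) (tl (trail T))) (lastFrom-tl (trail T))) , pass)

  -- If both ends alternate, the two arrivals have different parity, which is clause (i). Otherwise
  -- some exit repeats the type of its arrival; the gap then puts `d x` shifted by 2 into `H x`, so
  -- `d x` is not the extreme excluded by clause (ii) or (iii).
  both-exits⇒D : ∀ {x} → RootTrail x true → RootTrail x false → D H F x
  both-exits⇒D {x} T₁ T₂ with reach T₁ | reach T₂
  ... | inj₂ (o , _)      | inj₁ (e , _)      = inj₁ (e , o)
  ... | inj₁ (e , gap _ (d∈ , h , h∈ , h≡)) | _ = inj₂ (inj₁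
        (ℕ.≤-trans (s≤s (mH≤ H h∈)) (ℕ.≤-trans (ℕ.n≤1+n _) (ℕ.≤-reflexive (sym (pred²≡ (sym h≡))))) , ≤MH H d∈ , e))
  ... | _ | inj₂ (o , gap _ (d∈ , h , h∈ , h≡)) = inj₂ (inj₂
        (mH≤ H d∈ , ℕ.≤-trans (ℕ.≤-trans (ℕ.n≤1+n _) (ℕ.≤-reflexive (trans (ℕ.+-comm 2 (d x)) (ℤ.+-injective (sym h≡))))) (≤MH H h∈) , o))
  ... | inj₁ (_ , alt ()) | _
  ... | inj₂ _            | inj₂ (_ , alt ())

  toggle-Tr : ∀ {v s x t} (p : Tr v s x t) → Spanning G
  toggle-Tr {v} p = toggle F (v ∷ tl p) (walk p)

  -- Inner vertices of a legal trail keep their degree or move within `H`, so only the two ends can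
  -- spoil the comparison with `F`.
  no-improving : ∀ {v s x t} (p : Tr v s x t) → Legal p →
    (∀ z → z ≡ v ⊎ z ≡ x → deg (toggled p) z ℕ.≤ MH H z × defE H (toggled p) z ℕ.≤ defE H (E F) z) →
    ¬ defE H (toggled p) v ℕ.< defE H (E F) v
  no-improving {v} {s} {x} p l ends =
    no-improvement H F chosen (toggle-Tr p) (λ z → proj₁ (all z)) (λ z → proj₂ (all z)) v
    where
    all : ∀ z → deg (toggled p) z ℕ.≤ MH H z × defE H (toggled p) z ℕ.≤ defE H (E F) z
    all z with z ≟ v | z ≟ x
    ... | yes e | _     = ends z (inj₁ e)
    ... | no _  | yes e = ends z (inj₂ e)
    ... | no z≢v | no z≢x with deg-inner p l z≢v z≢x
    ...   | inj₁ e         = ℕ.≤-trans (ℕ.≤-reflexive e) (proj₁ chosen z) , ℕ.≤-reflexive (cong (λ k → dist k (H z)) e)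
    ...   | inj₂ (_ , d′∈) = ≤MH H d′∈ , ℕ.≤-trans (ℕ.≤-reflexive (dist-H z d′∈)) z≤n

  mH≤MH : ∀ z → mH H z ℕ.≤ MH H z
  mH≤MH z = ≤MH H (min∈ _ _)

  raised : ∀ {v k} → B₀ H F v → k ≡ suc (d v) → k ℕ.≤ MH H v × dist k (H v) ℕ.< defE H (E F) v
  raised {v} b refl = ℕ.≤-trans (below b) (mH≤MH v) , ℕ.≤-reflexive (dist-suc< (H v) (below b))

  -- Otherwise the trail extended to y would lower the deficiency of F.
  no-stop : ∀ {x t y} (T : RootTrail x t) → adj G x y ≡ true → E F x y ≡ t → y ∉ vs (trail T) →
            d y ∈ toList (H y) → ∀ {h} → h ∈ toList (H y) → + h ≢ + d y + σ t
  no-stop {x} {t} {y} (rootTrail {v} b p l reg) xy e y∉ dy∈ {h} h∈ h≡ =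
    no-improving q lq ends (proj₂ (raised b (deg-start q lq b v≢y)))
    where
    -- With exit type `not t` the visit of `y` alternates; as the virtual exit is not toggled, the
    -- degree of `y` really becomes `d y + σ t`.
    q : Tr v true y (not t)
    q = join p xy e (one (alt refl))
    lq : Legal q
    lq = legal-join xy e l (legal-one (alt refl)) (λ { z∈ (here refl) → y∉ z∈ })
    v≢y : v ≢ y
    v≢y refl = b dy∈
    noGap : passSum y q ≡ + 0
    noGap = passSum-0 y q (trans (gaps-join y p xy e (one (alt refl)))
              (cong₂ ℕ._+_ (gaps-∉ p y∉) (ℕ.*-zeroʳ (b2n (eqF y y)))))
    σ-not : ∀ t → + 0 * σ true + + 1 * σ (not t) ≡ - σ t
    σ-not true  = refl
    σ-not false = refl
    move : ∀ a b → a ≡ (a + - b) + b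
    move = solve-∀
    deg-y : deg (toggled q) y ≡ h
    deg-y = ℤ.+-injective (begin
      + deg (toggled q) y                       ≡⟨ move _ (σ t) ⟩
      + deg (toggled q) y + - σ t + σ t         ≡⟨ cong (_+ σ t) (begin
          + deg (toggled q) y + - σ t
            ≡⟨ cong (_+_ (+ deg (toggled q) y)) (trans (ends-cong y true (not t) (δ-≢ (v≢y ∘ sym)) (δ-refl y)) (σ-not t)) ⟨
          + deg (toggled q) y + (δ y v * σ true + δ y y * σ (not t))
            ≡⟨ deg-toggled q (edgeSimple lq) y ⟩
          + d y + passSum y q                   ≡⟨ trans (cong (_+_ (+ d y)) noGap) (+-identityʳ _) ⟩
          + d y                                 ∎) ⟩
      + d y + σ t                               ≡⟨ h≡ ⟨
      + h                                       ∎)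
      where open ≡-Reasoning
    ends : ∀ z → z ≡ v ⊎ z ≡ y → deg (toggled q) z ℕ.≤ MH H z × defE H (toggled q) z ℕ.≤ defE H (E F) z
    ends z (inj₁ refl) = proj₁ r , ℕ.<⇒≤ (proj₂ r)
      where r = raised b (deg-start q lq b v≢y)
    ends z (inj₂ refl) = subst (ℕ._≤ MH H y) (sym deg-y) (≤MH H h∈) ,
      ℕ.≤-trans (ℕ.≤-reflexive (trans (cong (λ k → dist k (H y)) deg-y) (dist-H y h∈))) z≤n

  -- With a virtual F-edge at either end, toggling raises both deficient ends by 1, towards their
  -- minima.
  no-root-to-root : ∀ {v w} (p : Tr v true w true) → Legal p → B₀ H F v → B₀ H F w → v ≡ w
  no-root-to-root {v} {w} p l bv bw with v ≟ w
  ... | yes e  = e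
  ... | no v≢w = ⊥-elim (no-improving p l ends (proj₂ (raised bv start)))
    where
    start = deg-start p l bv v≢w
    finish : deg (toggled p) w ≡ suc (d w)
    finish = pred≡ (trans (cong (_+_ (+ deg (toggled p) w)) (sym (ends-cong w true true (δ-≢ (v≢w ∘ sym)) (δ-refl w))))
                          (deg-root p l bw))
    ends : ∀ z → z ≡ v ⊎ z ≡ w → deg (toggled p) z ℕ.≤ MH H z × defE H (toggled p) z ℕ.≤ defE H (E F) z
    ends z (inj₁ refl) = proj₁ (raised bv start) , ℕ.<⇒≤ (proj₂ (raised bv start))
    ends z (inj₂ refl) = proj₁ (raised bw finish) , ℕ.<⇒≤ (proj₂ (raised bw finish))

  -- A closed trail raises its root by 2, which is an improvement as soon as the deficiency of the
  -- root is at least 2.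
  closed-at-root : ∀ {v} (p : Tr v true v true) → Legal p → B₀ H F v → suc (d v) ≡ mH H v
  closed-at-root {v} p l b with suc (d v) ℕ.≟ mH H v
  ... | yes e = e
  ... | no ne = ⊥-elim (no-improving p l (λ { z (inj₁ refl) → both ; z (inj₂ refl) → both }) drops)
    where
    far : suc (d v) ℕ.< mH H v
    far = ℕ.≤∧≢⇒< (below b) ne
    deg-v : deg (toggled p) v ≡ suc (suc (d v))
    deg-v = pred²≡ (trans (cong (_+_ (+ deg (toggled p) v)) (sym (ends-cong v true true (δ-refl v) (δ-refl v)))) (deg-root p l b))
    drops : defE H (toggled p) v ℕ.< defE H (E F) v
    drops = ℕ.≤-trans (ℕ.≤-trans (ℕ.≤-reflexive (cong (λ k → suc (dist k (H v))) deg-v))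
              (ℕ.≤-trans (ℕ.≤-reflexive (dist-suc< (H v) far)) (ℕ.n≤1+n _)))
              (ℕ.≤-reflexive (dist-suc< (H v) (below b)))
    both : deg (toggled p) v ℕ.≤ MH H v × defE H (toggled p) v ℕ.≤ defE H (E F) v
    both = ℕ.≤-trans (ℕ.≤-reflexive deg-v) (ℕ.≤-trans far (mH≤MH v)) , ℕ.<⇒≤ drops

-- Alternating forests with blossoms

data Kind : Set where
  kA kB kD : Kind

ExitOK : Kind → Bool → Set
ExitOK kA t = t ≡ true
ExitOK kB t = t ≡ false
ExitOK kD t = ⊤

module Forests {n : ℕ} {G : Graph n} (H : Pres n) (F : Spanning G) (star : Star H) (chosen : IsChosen G H F) where

  open Optimal H F star chosen public

  record Inside (X : List (Fin n)) (v : Fin n) (s : Bool) (x : Fin n) (t : Bool) : Set where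
    constructor inside
    field
      tr     : Tr v s x t
      leg    : Legal tr
      within : ∀ {z} → z ∈ vs tr → z ∈ X
  open Inside public

  weaken : ∀ {X Y v s x t} → (∀ {z} → z ∈ X → z ∈ Y) → Inside X v s x t → Inside Y v s x t
  weaken sub (inside p l w) = inside p l (sub ∘ w)

  revI : ∀ {X v s x t} → Inside X v s x t → Inside X x t v s
  revI (inside p l w) = inside (rev p) (legal-rev l) (w ∘ ∈-rev p)

  joinI : ∀ {X Y v s a t b x u} → Inside X v s a t → adj G a b ≡ true → E F a b ≡ t → Inside Y b t x u →
          Disjoint X Y → Inside (X ++ Y) v s x u
  joinI {X} {Y} (inside p l w) ab e (inside q m w′) dj =
    inside (join p ab e q) (legal-join ab e l m (λ z∈p z∈q → dj (w z∈p) (w′ z∈q))) in++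
    where
    in++ : ∀ {z} → z ∈ vs (join p ab e q) → z ∈ X ++ Y
    in++ z∈ with ∈-join p ab e q z∈
    ... | inj₁ z∈p = ∈-++⁺ˡ (w z∈p)
    ... | inj₂ z∈q = ∈-++⁺ʳ X (w′ z∈q)

  ∈-++-swap : ∀ X {Y} {z : Fin n} → z ∈ X ++ Y → z ∈ Y ++ X
  ∈-++-swap X {Y} z∈ with ∈-++⁻ X z∈
  ... | inj₁ z∈X = ∈-++⁺ʳ Y z∈X
  ... | inj₂ z∈Y = ∈-++⁺ˡ z∈Y

  record Node : Set where
    constructor node
    field
      kind   : Kind
      verts  : List (Fin n)
      base   : Fin n
      parent : Maybe (Fin n)
  open Node public

  -- A root counts as entered along an F-edge, so that alternation sends trails out of it along
  -- edges outside `F`.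
  entryType : Maybe (Fin n) → Fin n → Bool
  entryType nothing  r = true
  entryType (just u) r = E F u r

  entry : Node → Bool
  entry K = entryType (parent K) (base K)

  Exit : Node → Fin n → Bool → Set
  Exit K x t = x ∈ verts K × ExitOK (kind K) t

  Singleton : Node → Set
  Singleton K = ∀ {z} → z ∈ verts K → z ≡ base K

  -- The degree conditions for `kA` and `kB` say that leaving along the entry type would carry the
  -- degree out of the range of `H`. The condition for `kD` gives a deficient blossom deficiency
  -- exactly 1, so that it contributes one unit to the formula.
  KindOK : Kind → Node → Set
  KindOK kA K = Singleton K × entry K ≡ false × d (base K) ≡ MH H (base K)
  KindOK kB K = Singleton K × entry K ≡ true × d (base K) ℕ.≤ mH H (base K)
  KindOK kD K = parent K ≡ nothing → suc (d (base K)) ≡ mH H (base K)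

  record GoodNode (K : Node) : Set where
    field
      base∈    : base K ∈ verts K
      sound    : ∀ {x t} → Exit K x t → Inside (verts K) (base K) (entry K) x t
      root-B₀  : parent K ≡ nothing → B₀ H F (base K)
      ordinary : ∀ {z} → z ∈ verts K → d z ∈ toList (H z) ⊎ (z ≡ base K × parent K ≡ nothing)
      kindOK   : KindOK (kind K) K
  open GoodNode public

  -- In a single vertex of type A or B the missing exit is opposite to the available one. Hence
  -- whoever arrives backwards through the available exit can alternate into the missing one; this
  -- is what a cycle supplies.
  exit-or-blocked : ∀ {K x} → GoodNode K → x ∈ verts K → ∀ t →
    Exit K x t ⊎ (Singleton K × (∀ {t′} → ExitOK (kind K) t′ → t ≡ not t′ × entry K ≡ not t′))
  exit-or-blocked {node kA X r p} g x∈ true  = inj₁ (x∈ , refl)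
  exit-or-blocked {node kA X r p} g x∈ false =
    inj₂ (proj₁ (kindOK g) , λ { refl → refl , proj₁ (proj₂ (kindOK g)) })
  exit-or-blocked {node kB X r p} g x∈ false = inj₁ (x∈ , refl)
  exit-or-blocked {node kB X r p} g x∈ true  =
    inj₂ (proj₁ (kindOK g) , λ { refl → refl , proj₁ (proj₂ (kindOK g)) })
  exit-or-blocked {node kD X r p} g x∈ t     = inj₁ (x∈ , tt)

  ExitIn : List Node → Fin n → Bool → Set
  ExitIn L x t = Any (λ K → Exit K x t) L

  In : List Node → Fin n → Set
  In L x = Any (λ K → x ∈ verts K) L

  exit⇒in : ∀ {L x t} → ExitIn L x t → In L x
  exit⇒in = Any.map proj₁

  ParentOK : Node → List Node → Set
  ParentOK K L = ∀ {u} → parent K ≡ just u → adj G u (base K) ≡ true × ExitIn L u (E F u (base K))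

  Apart : List (Fin n) → List Node → Set
  Apart X L = ∀ {z} → z ∈ X → ¬ In L z

  -- Newer nodes stand in front and hang on exits of older ones, so list induction doubles as
  -- induction along parent links.
  data Forest : List Node → Set where
    []   : Forest []
    cons : ∀ {K L} → GoodNode K → ParentOK K L → Apart (verts K) L → Forest L → Forest (K ∷ L)

  root-trail : ∀ {L x t} → Forest L → ExitIn L x t → Σ (RootTrail x t) λ T → ∀ {z} → z ∈ vs (trail T) → In L z
  root-trail (cons g po ap f) (there ex) with root-trail f ex
  ... | T , inL = T , there ∘ inL
  root-trail {node k X r nothing ∷ L} (cons g po ap f) (here ex) =
    rootTrail (root-B₀ g refl) (tr S) (leg S) reg , here ∘ within S
    where
    S = sound g ex
    reg : ∀ {z} → z ∈ vs (tr S) → z ≡ r ⊎ d z ∈ toList (H z)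
    reg z∈ with ordinary g (within S z∈)
    ... | inj₁ d∈      = inj₂ d∈
    ... | inj₂ (e , _) = inj₁ e
  root-trail {node k X r (just u) ∷ L} (cons g po ap f) (here ex) with root-trail f (proj₂ (po refl))
  ... | rootTrail {v} b p l reg , inL =
    rootTrail b (join p ur refl (tr S)) (legal-join ur refl l (leg S) (λ z∈p z∈S → ap (within S z∈S) (inL z∈p))) reg′ , in′
    where
    S  = sound g ex
    ur = proj₁ (po refl)
    reg′ : ∀ {z} → z ∈ vs (join p ur refl (tr S)) → z ≡ v ⊎ d z ∈ toList (H z)
    reg′ z∈ with ∈-join p ur refl (tr S) z∈
    ... | inj₁ z∈p = reg z∈p
    ... | inj₂ z∈S with ordinary g (within S z∈S)
    ...   | inj₁ d∈ = inj₂ d∈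
    in′ : ∀ {z} → z ∈ vs (join p ur refl (tr S)) → In (node k X r (just u) ∷ L) z
    in′ z∈ with ∈-join p ur refl (tr S) z∈
    ... | inj₁ z∈p = there (inL z∈p)
    ... | inj₂ z∈S = here (within S z∈S)

  -- Joining the trail that leads to `x`, the edge xy and the trail through `Y` would connect two
  -- deficient vertices, which are distinct because `Y` is apart from the forest.
  no-second-root : ∀ {L x t y r Y} → Forest L → ExitIn L x t → adj G x y ≡ true → E F x y ≡ t →
                   Inside Y y t r true → Apart Y L → ¬ B₀ H F r
  no-second-root f ex xy e S ap br with root-trail f ex
  ... | rootTrail b p l _ , inL
    with no-root-to-root (join p xy e (tr S)) (legal-join xy e l (leg S) (λ z∈p z∈S → ap (within S z∈S) (inL z∈p))) b br
  ...   | refl = ap (within S (last∈ (tr S))) (inL (head∈ p))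

  -- A pending set N hangs between the exits x₁ and x₂ of the forest; it can be crossed,
  -- and each of its vertices can be left along both edge types, from one of the two sides.

  record Pending (N : List (Fin n)) (x₁ n₁ : Fin n) (t₁ : Bool) (x₂ n₂ : Fin n) (t₂ : Bool) : Set where
    field
      adj₁    : adj G x₁ n₁ ≡ true
      type₁   : E F x₁ n₁ ≡ t₁
      adj₂    : adj G x₂ n₂ ≡ true
      type₂   : E F x₂ n₂ ≡ t₂
      -- The two attachment edges must differ even when they share their forest end; otherwise the
      -- cycle closed later would use one edge twice.
      distinct : x₁ ≡ x₂ → n₁ ≢ n₂
      cross   : Inside N n₁ t₁ n₂ t₂
      reachN  : ∀ {z} → z ∈ N → ∀ t → Inside N n₁ t₁ z t ⊎ Inside N n₂ t₂ z t
      regularN : ∀ {z} → z ∈ N → d z ∈ toList (H z)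
  open Pending

  flipP : ∀ {N x₁ n₁ t₁ x₂ n₂ t₂} → Pending N x₁ n₁ t₁ x₂ n₂ t₂ → Pending N x₂ n₂ t₂ x₁ n₁ t₁
  flipP P = record
    { adj₁ = adj₂ P ; type₁ = type₂ P ; adj₂ = adj₁ P ; type₂ = type₁ P
    ; distinct = λ e e′ → distinct P (sym e) (sym e′) ; cross = revI (cross P)
    ; reachN = λ z∈ t → swap (reachN P z∈ t) ; regularN = regularN P }

  adj-flip : ∀ {a b} → adj G a b ≡ true → adj G b a ≡ true
  adj-flip {a} {b} e = trans (adj-sym G b a) e

  E-flip : ∀ {a b t} → E F a b ≡ t → E F b a ≡ t
  E-flip {a} {b} e = trans (symE F b a) e

  nonroot-regular : ∀ {k X r u z} → GoodNode (node k X r (just u)) → z ∈ X → d z ∈ toList (H z)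
  nonroot-regular g z∈ with ordinary g z∈
  ... | inj₁ d∈ = d∈

  -- The node at the second attachment joins the pending set, and the attachment climbs to its
  -- parent edge. Vertices of `N` formerly reached from the second side are now reached by
  -- descending through the node; a blocked exit of the node is obtained by crossing `N` from the
  -- first side and alternating.
  absorb : ∀ {k X r u N x₁ n₁ t₁ x₂ n₂ t₂} → GoodNode (node k X r (just u)) → adj G u r ≡ true →
           Pending N x₁ n₁ t₁ x₂ n₂ t₂ → Exit (node k X r (just u)) x₂ t₂ → Disjoint N X →
           Pending (N ++ X) x₁ n₁ t₁ u r (E F u r)
  absorb {k} {X} {r} {u} {N} {x₁} {n₁} {t₁} {x₂} {n₂} {t₂} g ur P ex dj = record
    { adj₁ = adj₁ P ; type₁ = type₁ P ; adj₂ = ur ; type₂ = refl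
    ; distinct = λ { _ refl → dj (within (cross P) (head∈ (tr (cross P)))) (base∈ g) }
    ; cross = joinI (cross P) (adj-flip (adj₂ P)) (E-flip (type₂ P)) (revI (sound g ex)) dj
    ; reachN = reachN′ ; regularN = reg }
    where
    reachN′ : ∀ {z} → z ∈ N ++ X → ∀ t → Inside (N ++ X) n₁ t₁ z t ⊎ Inside (N ++ X) r (E F u r) z t
    reachN′ {z} z∈ t with ∈-++⁻ N z∈
    ... | inj₁ z∈N with reachN P z∈N t
    ...   | inj₁ S = inj₁ (weaken ∈-++⁺ˡ S)
    ...   | inj₂ S = inj₂ (weaken (∈-++-swap X) (joinI (sound g ex) (adj₂ P) (type₂ P) S (λ a b → dj b a)))
    reachN′ {z} z∈ t | inj₂ z∈X with exit-or-blocked g z∈X t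
    ... | inj₁ ez = inj₂ (weaken (∈-++⁺ʳ N) (sound g ez))
    ... | inj₂ (single , flip) with trans (single z∈X) (sym (single (proj₁ ex)))
    ...   | refl = inj₁ (joinI (cross P) (adj-flip (adj₂ P)) (E-flip (type₂ P))
                     (inside (one (alt (proj₁ (flip (proj₂ ex))))) (legal-one (alt (proj₁ (flip (proj₂ ex)))))
                             (λ { (here refl) → z∈X })) dj)
    reg : ∀ {z} → z ∈ N ++ X → d z ∈ toList (H z)
    reg z∈ with ∈-++⁻ N z∈
    ... | inj₁ z∈N = regularN P z∈N
    ... | inj₂ z∈X = nonroot-regular g z∈X

  start-pending : ∀ {k X r u x y t} → GoodNode (node k X r (just u)) → adj G u r ≡ true →
                  adj G x y ≡ true → E F x y ≡ t → Exit (node k X r (just u)) y t → (x ≡ u → y ≢ r) →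
                  Pending X x y t u r (E F u r)
  start-pending {k} {X} {r} {u} {x} {y} {t} g ur xy e ex ne = record
    { adj₁ = xy ; type₁ = e ; adj₂ = ur ; type₂ = refl ; distinct = ne ; cross = revI (sound g ex)
    ; reachN = reachN′ ; regularN = nonroot-regular g }
    where
    reachN′ : ∀ {z} → z ∈ X → ∀ t′ → Inside X y t z t′ ⊎ Inside X r (E F u r) z t′
    reachN′ z∈ t′ with exit-or-blocked g z∈ t′
    ... | inj₁ ez = inj₂ (sound g ez)
    ... | inj₂ (single , flip) with trans (single z∈) (sym (single (proj₁ ex)))
    ...   | refl = inj₁ (inside (one (alt (proj₁ (flip (proj₂ ex))))) (legal-one (alt (proj₁ (flip (proj₂ ex)))))
                                (λ { (here refl) → z∈ }))

  -- When both attachments have climbed to one node, every vertex of `N` is reached from one of the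
  -- two sides, and the blocked exit of a single vertex is obtained by going once around the cycle.
  close-cycle : ∀ {k X r p N x₁ n₁ t₁ x₂ n₂ t₂} → GoodNode (node k X r p) → Pending N x₁ n₁ t₁ x₂ n₂ t₂ →
                Exit (node k X r p) x₁ t₁ → Exit (node k X r p) x₂ t₂ → Disjoint N X →
                GoodNode (node kD (N ++ X) r p)
  close-cycle {k} {X} {r} {p} {N} {x₁} {n₁} {t₁} {x₂} {n₂} {t₂} g P ex₁ ex₂ dj = record
    { base∈ = ∈-++⁺ʳ N (base∈ g) ; sound = λ ez → sound′ (proj₁ ez) _ ; root-B₀ = root-B₀ g
    ; ordinary = ordinary′ ; kindOK = kind′ k g ex₁ ex₂ }
    where
    around : ∀ {k t} (g : GoodNode (node k X r p)) → Exit (node k X r p) x₁ t₁ → Exit (node k X r p) x₂ t₂ →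
             Singleton (node k X r p) → t ≡ not t₂ → entryType p r ≡ not t₁ →
             Inside (N ++ X) r (entryType p r) r t
    around g ex₁ ex₂ single t≡ s≡ with single (proj₁ ex₁) | single (proj₁ ex₂)
    ... | refl | refl = inside (loop s≡ t≡ (adj₁ P) (type₁ P) (tr (cross P)) (adj-flip (adj₂ P)) (E-flip (type₂ P)))
            (legal-loop s≡ t≡ (adj₁ P) (type₁ P) (tr (cross P)) (adj-flip (adj₂ P)) (E-flip (type₂ P))
               (leg (cross P)) (λ r∈ → dj (within (cross P) r∈) (base∈ g)) (distinct P refl))
            in′
      where
      in′ : ∀ {z} → z ∈ vs (loop s≡ t≡ (adj₁ P) (type₁ P) (tr (cross P)) (adj-flip (adj₂ P)) (E-flip (type₂ P))) → z ∈ N ++ X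
      in′ z∈ with ∈-loop s≡ t≡ (adj₁ P) (type₁ P) (tr (cross P)) (adj-flip (adj₂ P)) (E-flip (type₂ P)) z∈
      ... | inj₁ refl = ∈-++⁺ʳ N (base∈ g)
      ... | inj₂ z∈c  = ∈-++⁺ˡ (within (cross P) z∈c)
    sound′ : ∀ {z} → z ∈ N ++ X → ∀ t → Inside (N ++ X) r (entryType p r) z t
    sound′ z∈ t with ∈-++⁻ N z∈
    ... | inj₁ z∈N with reachN P z∈N t
    ...   | inj₁ S = weaken (∈-++-swap X) (joinI (sound g ex₁) (adj₁ P) (type₁ P) S (λ a b → dj b a))
    ...   | inj₂ S = weaken (∈-++-swap X) (joinI (sound g ex₂) (adj₂ P) (type₂ P) S (λ a b → dj b a))
    sound′ z∈ t | inj₂ z∈X with exit-or-blocked g z∈X t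
    ... | inj₁ ez = weaken (∈-++⁺ʳ N) (sound g ez)
    ... | inj₂ (single , flip) with single z∈X
    ...   | refl = around g ex₁ ex₂ single (proj₁ (flip (proj₂ ex₂))) (proj₂ (flip (proj₂ ex₁)))
    ordinary′ : ∀ {z} → z ∈ N ++ X → d z ∈ toList (H z) ⊎ (z ≡ r × p ≡ nothing)
    ordinary′ z∈ with ∈-++⁻ N z∈
    ... | inj₁ z∈N = inj₁ (regularN P z∈N)
    ... | inj₂ z∈X = ordinary g z∈X
    kind′ : ∀ k (g : GoodNode (node k X r p)) → Exit (node k X r p) x₁ t₁ → Exit (node k X r p) x₂ t₂ →
            p ≡ nothing → suc (d r) ≡ mH H r
    kind′ kD g _ _ = kindOK g
    kind′ kA g _ _ refl with () ← proj₁ (proj₂ (kindOK g))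
    -- For a root of type B the round trip is a closed trail with virtual F-edges at both ends,
    -- which bounds the deficiency of the root.
    kind′ kB g ex₁@(_ , refl) ex₂@(_ , refl) refl = closed-at-root (tr S) (leg S) (root-B₀ g refl)
      where S = around g ex₁ ex₂ (proj₁ (kindOK g)) refl refl

  -- Preserved `exits` let newer nodes keep their parents when older ones are rebuilt. The number
  -- `c` of nodes saved is what makes growth terminate.
  record Result (L : List Node) (N : List (Fin n)) (c : ℕ) : Set where
    constructor result
    field
      {new}  : List Node
      forest : Forest new
      exits  : ∀ {x t} → ExitIn L x t → ExitIn new x t
      covers : ∀ {z} → z ∈ N → ∀ t → ExitIn new z t
      only   : ∀ {z} → In new z → In L z ⊎ z ∈ N
      keeps  : ∀ {z} → In L z → In new z
      len    : length new ℕ.+ c ℕ.≤ length L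
  open Result public

  keep : ∀ {K L N c} → GoodNode K → ParentOK K L → Apart (verts K) L → Disjoint N (verts K) → Result L N c → Result (K ∷ L) N c
  keep {K} {L} {N} g po ap dj (result f ex cv on kp le) = result
    (cons g (λ e → proj₁ (po e) , ex (proj₂ (po e))) (λ z∈K z∈new → apart z∈K (on z∈new)) f)
    (λ { (here e) → here e ; (there e) → there (ex e) })
    (λ z∈ t → there (cv z∈ t))
    (λ { (here z∈) → inj₁ (here z∈) ; (there z∈) → lift (on z∈) })
    (λ { (here z∈) → here z∈ ; (there z∈) → there (kp z∈) })
    (s≤s le)
    where
    apart : ∀ {z} → z ∈ verts K → In L z ⊎ z ∈ N → ⊥
    apart z∈K (inj₁ z∈L) = ap z∈K z∈L
    apart z∈K (inj₂ z∈N) = dj z∈N z∈K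
    lift : ∀ {z} → In L z ⊎ z ∈ N → In (K ∷ L) z ⊎ z ∈ N
    lift (inj₁ a) = inj₁ (there a)
    lift (inj₂ a) = inj₂ a

  swallow : ∀ {K L} N {c} → Result L (N ++ verts K) c → Result (K ∷ L) N (suc c)
  swallow {K} {L} N (result {new} f ex cv on kp le) = result f
    (λ { (here (x∈ , _)) → cv (∈-++⁺ʳ N x∈) _ ; (there e) → ex e })
    (λ z∈ t → cv (∈-++⁺ˡ z∈) t)
    only′
    (λ { (here z∈) → exit⇒in (cv (∈-++⁺ʳ N z∈) true) ; (there z∈) → kp z∈ })
    (ℕ.≤-trans (ℕ.≤-reflexive (ℕ.+-suc (length new) _)) (s≤s le))
    where
    only′ : ∀ {z} → In new z → In (K ∷ L) z ⊎ z ∈ N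
    only′ z∈ with on z∈
    ... | inj₁ z∈L = inj₁ (there z∈L)
    ... | inj₂ z∈′ with ∈-++⁻ N z∈′
    ...   | inj₁ z∈N = inj₂ z∈N
    ...   | inj₂ z∈K = inj₁ (here z∈K)

  cheaper : ∀ {L N c} → Result L N (suc c) → Result L N c
  cheaper (result {new} f ex cv on kp le) =
    result f ex cv on kp (ℕ.≤-trans (ℕ.≤-trans (ℕ.n≤1+n _) (ℕ.≤-reflexive (sym (ℕ.+-suc (length new) _)))) le)

  enlarge : ∀ {k X r p L N} → GoodNode (node kD (N ++ X) r p) → ParentOK (node k X r p) L → Apart X L → Apart N (node k X r p ∷ L) →
            Forest L → Result (node k X r p ∷ L) N 0
  enlarge {k} {X} {r} {p} {L} {N} g po ap apN f = result (cons g po apart f)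
    (λ { (here (x∈ , _)) → here (∈-++⁺ʳ N x∈ , tt) ; (there e) → there e })
    (λ z∈ t → here (∈-++⁺ˡ z∈ , tt))
    only′
    (λ { (here z∈) → here (∈-++⁺ʳ N z∈) ; (there z∈) → there z∈ })
    (ℕ.≤-reflexive (ℕ.+-identityʳ _))
    where
    apart : Apart (N ++ X) L
    apart z∈ with ∈-++⁻ N z∈
    ... | inj₁ z∈N = apN z∈N ∘ there
    ... | inj₂ z∈X = ap z∈X
    only′ : ∀ {z} → In (node kD (N ++ X) r p ∷ L) z → In (node k X r p ∷ L) z ⊎ z ∈ N
    only′ (there z∈) = inj₁ (there z∈)
    only′ (here z∈) with ∈-++⁻ N z∈
    ... | inj₁ z∈N = inj₂ z∈N
    ... | inj₂ z∈X = inj₁ (here z∈X)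

  apart-++ : ∀ {K L} N → Apart N (K ∷ L) → Apart (verts K) L → Apart (N ++ verts K) L
  apart-++ N apN ap z∈ with ∈-++⁻ N z∈
  ... | inj₁ z∈N = apN z∈N ∘ there
  ... | inj₂ z∈K = ap z∈K

  -- The attachment in the newest node climbs first, so both climb to their lowest common node, and
  -- nodes off the cycle are kept. If one side runs out at a root while the other attachment is
  -- still in an older node, two deficient vertices would be joined.
  merge : ∀ {L N x₁ n₁ t₁ x₂ n₂ t₂} → Forest L → Pending N x₁ n₁ t₁ x₂ n₂ t₂ →
          ExitIn L x₁ t₁ → ExitIn L x₂ t₂ → Apart N L → Result L N 0
  merge (cons g po ap f) P (here ex₁) (here ex₂) apN =
    enlarge (close-cycle g P ex₁ ex₂ (λ z∈ → apN z∈ ∘ here)) po ap apN f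
  merge (cons g po ap f) P (there ex₁) (there ex₂) apN =
    keep g po ap (λ z∈ → apN z∈ ∘ here) (merge f P ex₁ ex₂ (λ z∈ → apN z∈ ∘ there))
  merge {node k X r (just u) ∷ L} {N} (cons g po ap f) P (there ex₁) (here ex₂) apN =
    cheaper (swallow N (merge f (absorb g (proj₁ (po refl)) P ex₂ (λ z∈ → apN z∈ ∘ here)) ex₁ (proj₂ (po refl)) (apart-++ N apN ap)))
  merge {node k X r (just u) ∷ L} {N} (cons g po ap f) P (here ex₁) (there ex₂) apN =
    cheaper (swallow N (merge f (absorb g (proj₁ (po refl)) (flipP P) ex₁ (λ z∈ → apN z∈ ∘ here)) ex₂ (proj₂ (po refl)) (apart-++ N apN ap)))
  merge {node k X r nothing ∷ L} {N} (cons g po ap f) P (there ex₁) (here ex₂) apN =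
    ⊥-elim (no-second-root f ex₁ (adj₁ P) (type₁ P)
      (joinI (cross P) (adj-flip (adj₂ P)) (E-flip (type₂ P)) (revI (sound g ex₂)) (λ z∈ → apN z∈ ∘ here))
      (apart-++ N apN ap) (root-B₀ g refl))
  merge {node k X r nothing ∷ L} {N} (cons g po ap f) P (here ex₁) (there ex₂) apN =
    ⊥-elim (no-second-root f ex₂ (adj₂ P) (type₂ P)
      (joinI (revI (cross P)) (adj-flip (adj₁ P)) (E-flip (type₁ P)) (revI (sound g ex₁)) (λ z∈ → apN z∈ ∘ here))
      (apart-++ N apN ap) (root-B₀ g refl))

  Together : List Node → Fin n → Fin n → Set
  Together L x y = Any (λ K → x ∈ verts K × y ∈ verts K) L

  TreeEdge : List Node → Fin n → Fin n → Set
  TreeEdge L u r = Any (λ K → parent K ≡ just u × base K ≡ r) L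

  -- The edge can be traversed from either end, so the two root trails close up through it. The
  -- newer end's node starts the pending set; excluding tree edges keeps its two attachment edges
  -- distinct.
  link : ∀ {L x y t} → Forest L → adj G x y ≡ true → E F x y ≡ t → ExitIn L x t → ExitIn L y t →
         ¬ Together L x y → ¬ TreeEdge L x y → ¬ TreeEdge L y x → Result L [] 1
  link (cons g po ap f) xy e (here ex) (here ey) ¬tog _ _ = ⊥-elim (¬tog (here (proj₁ ex , proj₁ ey)))
  link (cons g po ap f) xy e (there ex) (there ey) ¬tog ¬xy ¬yx =
    keep g po ap (λ ()) (link f xy e ex ey (¬tog ∘ there) (¬xy ∘ there) (¬yx ∘ there))
  link {node k X r (just u) ∷ L} (cons g po ap f) xy e (there ex) (here ey) ¬tog ¬xy ¬yx =
    swallow [] (merge f (start-pending g (proj₁ (po refl)) xy e ey λ { refl refl → ¬xy (here (refl , refl)) })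
                      ex (proj₂ (po refl)) ap)
  link {node k X r (just u) ∷ L} (cons g po ap f) xy e (here ex) (there ey) ¬tog ¬xy ¬yx =
    swallow [] (merge f (start-pending g (proj₁ (po refl)) (adj-flip xy) (E-flip e) ex λ { refl refl → ¬yx (here (refl , refl)) })
                      ey (proj₂ (po refl)) ap)
  link {node k X r nothing ∷ L} (cons g po ap f) xy e (there ex) (here ey) _ _ _ =
    ⊥-elim (no-second-root f ex xy e (revI (sound g ey)) ap (root-B₀ g refl))
  link {node k X r nothing ∷ L} (cons g po ap f) xy e (here ex) (there ey) _ _ _ =
    ⊥-elim (no-second-root f ey (adj-flip xy) (E-flip e) (revI (sound g ex)) ap (root-B₀ g refl))

  KindIn : Kind → List Node → Fin n → Set
  KindIn k L x = Any (λ K → x ∈ verts K × kind K ≡ k) L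

  -- A blossom vertex `u` can be left along the edge ur whatever its type, so the whole of `N`, with
  -- all exits, is reached through `u`; no second attachment is called for.
  hang : ∀ {L N u r} → Forest L → adj G u r ≡ true → (∀ {z} → z ∈ N → ∀ t → Inside N r (E F u r) z t) →
         (∀ {z} → z ∈ N → d z ∈ toList (H z)) → KindIn kD L u → Apart N L → Result L N 0
  hang (cons g po ap f) ur reachN reg (there uD) apN =
    keep g po ap (λ z∈ → apN z∈ ∘ here) (hang f ur reachN reg uD (λ z∈ → apN z∈ ∘ there))
  hang {node kD X b p ∷ L} {N} {u} {r} (cons g po ap f) ur reachN reg (here (u∈ , refl)) apN = enlarge good po ap apN f
    where
    sound′ : ∀ {z} → z ∈ N ++ X → ∀ t → Inside (N ++ X) b (entryType p b) z t
    sound′ z∈ t with ∈-++⁻ N z∈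
    ... | inj₁ z∈N = weaken (∈-++-swap X) (joinI (sound g (u∈ , tt)) ur refl (reachN z∈N t) (λ a b → apN b (here a)))
    ... | inj₂ z∈X = weaken (∈-++⁺ʳ N) (sound g (z∈X , tt))
    ordinary′ : ∀ {z} → z ∈ N ++ X → d z ∈ toList (H z) ⊎ (z ≡ b × p ≡ nothing)
    ordinary′ z∈ with ∈-++⁻ N z∈
    ... | inj₁ z∈N = inj₁ (reg z∈N)
    ... | inj₂ z∈X = ordinary g z∈X
    good : GoodNode (node kD (N ++ X) b p)
    good = record { base∈ = ∈-++⁺ʳ N (base∈ g) ; sound = λ ez → sound′ (proj₁ ez) _ ; root-B₀ = root-B₀ g
                  ; ordinary = ordinary′ ; kindOK = kindOK g }

  -- Two blossoms joined by a tree edge lie in one component of `G[D]`. Fusing them makes blossoms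
  -- and components correspond.
  fuse : ∀ {L u} → Forest L → Any (λ K → parent K ≡ just u × kind K ≡ kD) L → KindIn kD L u → Result L [] 1
  fuse (cons g po ap f) (there c) (there uD) = keep g po ap (λ ()) (fuse f c uD)
  fuse (cons g po ap f) (there c) (here (u∈ , _)) = ⊥-elim (ap u∈ (child⇒in f c))
    where
    child⇒in : ∀ {L u} → Forest L → Any (λ K → parent K ≡ just u × kind K ≡ kD) L → In L u
    child⇒in (cons g po ap f) (here (e , _)) = there (exit⇒in (proj₂ (po e)))
    child⇒in (cons g po ap f) (there c)      = there (child⇒in f c)
  fuse (cons g po ap f) (here (e , _)) (here (u∈ , _)) = ⊥-elim (ap u∈ (exit⇒in (proj₂ (po e))))
  fuse {node kD X r (just u) ∷ L} (cons g po ap f) (here (refl , refl)) (there uD) =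
    swallow [] (hang f (proj₁ (po refl)) (λ z∈ t → sound g (z∈ , tt)) (nonroot-regular g) uD ap)

-- Growing a closed forest

search : ∀ {n} {P : Fin n → Set} {Q : Set} → (∀ i → P i ⊎ Q) → (∀ i → P i) ⊎ Q
search {zero}  f = inj₁ λ ()
search {suc n} f with f zero | search (f ∘ suc)
... | inj₂ q | _      = inj₂ q
... | inj₁ _ | inj₂ q = inj₂ q
... | inj₁ p | inj₁ h = inj₁ λ { zero → p ; (suc i) → h i }

module Growth {n : ℕ} {G : Graph n} (H : Pres n) (F : Spanning G) (star : Star H) (chosen : IsChosen G H F) where

  open Forests H F star chosen public
  Choice : Kind → Fin n → Bool → Set
  Choice kA y t = t ≡ false × d y ≡ MH H y
  Choice kB y t = t ≡ true × d y ℕ.≤ mH H y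
  Choice kD y t = ⊤

  choose : ∀ y t → d y ∈ toList (H y) → (∀ {h} → h ∈ toList (H y) → + h ≢ + d y + σ t) →
           Σ Kind λ k → Choice k y t × (∀ {t′} → ExitOK k t′ → Pass y t t′)
  choose y false dy∈ no-h with d y ℕ.≟ MH H y
  ... | yes e = kA , (refl , e) , λ { refl → alt refl }
  ... | no ne = kD , tt , λ { {true} _ → alt refl ; {false} _ → gap refl
        (dy∈ , suc (suc (d y)) ,
         star y (suc (d y)) (ℕ.≤-trans (mH≤ H dy∈) (ℕ.n≤1+n _)) (ℕ.≤∧≢⇒< (≤MH H dy∈) ne)
           (λ s∈ → no-h s∈ (cong +_ (ℕ.+-comm 1 (d y)))) ,
         cong +_ (ℕ.+-comm 2 (d y))) }
  choose y true dy∈ no-h with d y ℕ.≟ mH H y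
  ... | yes e = kB , (refl , ℕ.≤-reflexive e) , λ { refl → alt refl }
  ... | no ne = kD , tt , λ { {false} _ → alt refl ; {true} _ → gap refl (dy∈ , down (d y) refl) }
    where
    -- Property (*) looks upwards: applied at the degree minus 2, it could only fail to give that
    -- value by giving the degree minus 1, which is excluded. Degrees 0 and 1 are separate because
    -- there is no such value: 0 would be the minimum, and for 1 the minimum would be the excluded
    -- 0.
    down : ∀ k → d y ≡ k → Σ ℕ λ h → h ∈ toList (H y) × + h ≡ + k + - + 2
    down zero eq = ⊥-elim (ne (trans eq (sym (ℕ.n≤0⇒n≡0 (ℕ.≤-trans (mH≤ H dy∈) (ℕ.≤-reflexive eq))))))
    down (suc zero) eq = ⊥-elim (no-h (subst (_∈ toList (H y)) mH≡0 (min∈ _ _)) (sym (cong (λ i → + i + - + 1) eq)))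
      where
      mH≡0 : mH H y ≡ 0
      mH≡0 = ℕ.n≤0⇒n≡0 (ℕ.≤-pred (subst (mH H y ℕ.<_) eq (ℕ.≤∧≢⇒< (mH≤ H dy∈) (ne ∘ sym))))
    down (suc (suc f)) eq with _∈?_ ℕ._≟_ f (toList (H y))
    ... | yes f∈ = f , f∈ , refl
    ... | no  f∉ = ⊥-elim (sf∉ (star y f mH≤f (ℕ.≤-trans (ℕ.n≤1+n f) (ℕ.≤-trans (ℕ.n≤1+n (suc f)) d≤)) f∉))
      where
      sf∉ : suc f ∉ toList (H y)
      sf∉ s∈ = no-h s∈ (sym (cong (λ i → + i + - + 1) eq))
      d≤ : suc (suc f) ℕ.≤ MH H y
      d≤ = subst (ℕ._≤ MH H y) eq (≤MH H dy∈)
      mH≤sf : mH H y ℕ.≤ suc f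
      mH≤sf = ℕ.≤-pred (subst (mH H y ℕ.<_) eq (ℕ.≤∧≢⇒< (mH≤ H dy∈) (ne ∘ sym)))
      mH≤f : mH H y ℕ.≤ f
      mH≤f = ℕ.≤-pred (ℕ.≤∧≢⇒< mH≤sf (λ e → sf∉ (subst (_∈ toList (H y)) e (min∈ _ _))))

  sprout : ∀ {L x y} → Forest L → ExitIn L x (E F x y) → adj G x y ≡ true → ¬ In L y → d y ∈ toList (H y) →
           Σ Kind λ k → Forest (node k (y ∷ []) y (just x) ∷ L)
  sprout {L} {x} {y} f ex xy y∉L dy∈ with root-trail f ex
  ... | T , inL with choose y (E F x y) dy∈ (no-stop T xy refl (y∉L ∘ inL) dy∈)
  ...   | k , ch , pass = k , cons good (λ { refl → xy , ex }) (λ { (here refl) → y∉L }) f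
    where
    K = node k (y ∷ []) y (just x)
    ok : ∀ k → Choice k y (E F x y) → KindOK k (node k (y ∷ []) y (just x))
    ok kA (e , m) = (λ { (here refl) → refl }) , e , m
    ok kB (e , m) = (λ { (here refl) → refl }) , e , m
    ok kD _       = λ ()
    good : GoodNode K
    good = record
      { base∈ = here refl
      ; sound = λ { (here refl , o) → inside (one (pass o)) (legal-one (pass o)) id }
      ; root-B₀ = λ ()
      ; ordinary = λ { (here refl) → inj₁ dy∈ }
      ; kindOK = ok k ch }

  plant : ∀ {L z} → Forest L → ¬ In L z → B₀ H F z → Forest (node kB (z ∷ []) z nothing ∷ L)
  plant f z∉ b = cons (record
    { base∈ = here refl
    ; sound = λ { (here refl , refl) → inside (one (alt refl)) (legal-one (alt refl)) id }
    ; root-B₀ = λ _ → b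
    ; ordinary = λ { (here refl) → inj₂ (refl , refl) }
    ; kindOK = (λ { (here refl) → refl }) , refl , ℕ.<⇒≤ (below b) })
    (λ ()) (λ { (here refl) → z∉ }) f

  in? : ∀ L z → Dec (In L z)
  in? L z = Any.any? (λ K → _∈?_ _≟_ z (verts K)) L

  exitOK? : ∀ k t → Dec (ExitOK k t)
  exitOK? kA t = t Bool.≟ true
  exitOK? kB t = t Bool.≟ false
  exitOK? kD t = yes tt

  exitIn? : ∀ L x t → Dec (ExitIn L x t)
  exitIn? L x t = Any.any? (λ K → (_∈?_ _≟_ x (verts K)) ×-dec exitOK? (kind K) t) L

  together? : ∀ L x y → Dec (Together L x y)
  together? L x y = Any.any? (λ K → (_∈?_ _≟_ x (verts K)) ×-dec (_∈?_ _≟_ y (verts K))) L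

  treeEdge? : ∀ L u r → Dec (TreeEdge L u r)
  treeEdge? L u r = Any.any? (λ K → ≡-dec _≟_ (parent K) (just u) ×-dec (base K ≟ r)) L

  isD? : ∀ k → Dec (k ≡ kD)
  isD? kA = no λ ()
  isD? kB = no λ ()
  isD? kD = yes refl

  record Closed (L : List Node) : Set where
    field
      rooted   : ∀ z → B₀ H F z → In L z
      explored : ∀ {x y} → adj G x y ≡ true → ExitIn L x (E F x y) → In L y
      linked   : ∀ {x y} → adj G x y ≡ true → ExitIn L x (E F x y) → ExitIn L y (E F x y) →
                 Together L x y ⊎ TreeEdge L x y ⊎ TreeEdge L y x
      fused    : ∀ {u} → Any (λ K → parent K ≡ just u × kind K ≡ kD) L → ¬ KindIn kD L u
  open Closed public

  outside : List Node → Fin n → ℕ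
  outside L z = b2n (not ⌊ in? L z ⌋)

  -- The weight 2 on a vertex outside pays for the node created when it is added; a merge lowers the
  -- length.
  Φ : List Node → ℕ
  Φ L = 2 ℕ.* sum (map (outside L) (allFin n)) ℕ.+ length L

  record Grow (L : List Node) : Set where
    constructor grow
    field
      {grown} : List Node
      forest′ : Forest grown
      smaller : Φ grown ℕ.< Φ L

  outside-mono : ∀ {L L′} → (∀ {z} → In L z → In L′ z) → ∀ z → outside L′ z ℕ.≤ outside L z
  outside-mono {L} {L′} sub z with in? L z | in? L′ z
  ... | yes a | yes b = ℕ.≤-refl
  ... | yes a | no ¬b = ⊥-elim (¬b (sub a))
  ... | no ¬a | yes b = z≤n
  ... | no ¬a | no ¬b = ℕ.≤-refl

  grow-merged : ∀ {L} → Result L [] 1 → Grow L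
  grow-merged {L} R = grow (forest R) (ℕ.+-mono-≤-< (ℕ.*-monoʳ-≤ 2 less) (ℕ.≤-trans (ℕ.≤-reflexive (ℕ.+-comm 1 _)) (len R)))
    where
    less : sum (map (outside (new R)) (allFin n)) ℕ.≤ sum (map (outside L) (allFin n))
    less = ℤ.drop‿+≤+ (subst₂ _≤_ (sym (sum-∑ (outside (new R)))) (sym (sum-∑ (outside L)))
             (∑-mono (λ z → ℤ.+≤+ (outside-mono {L} {new R} (keeps R) z))))

  grow-added : ∀ {L K z} → Forest (K ∷ L) → z ∈ verts K → ¬ In L z → Grow L
  grow-added {L} {K} {z} f z∈ z∉ = grow f
    (ℕ.≤-trans (ℕ.≤-reflexive (shape _ (length L))) (ℕ.+-monoˡ-≤ (length L) (ℕ.*-monoʳ-≤ 2 less)))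
    where
    shape : ∀ a l → suc (2 ℕ.* a ℕ.+ suc l) ≡ 2 ℕ.* suc a ℕ.+ l
    shape a l = trans (cong suc (ℕ.+-suc (2 ℕ.* a) l)) (cong (ℕ._+ l) (sym (ℕ.*-suc 2 a)))
    strict : outside (K ∷ L) z ℕ.< outside L z
    strict with in? L z | in? (K ∷ L) z
    ... | yes a | _     = ⊥-elim (z∉ a)
    ... | no _  | yes _ = ℕ.≤-refl
    ... | no _  | no ¬b = ⊥-elim (¬b (here z∈))
    less : suc (sum (map (outside (K ∷ L)) (allFin n))) ℕ.≤ sum (map (outside L) (allFin n))
    less = ℤ.drop‿+<+ (subst₂ _<_ (sym (sum-∑ (outside (K ∷ L)))) (sym (sum-∑ (outside L)))
             (∑-mono-< (λ z → ℤ.+≤+ (outside-mono {L} {K ∷ L} there z)) z (ℤ.+<+ strict)))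

  grow-or-closed : ∀ L → Forest L → Closed L ⊎ Grow L
  grow-or-closed L f with search rooted-or-grow
    where
    rooted-or-grow : ∀ z → (B₀ H F z → In L z) ⊎ Grow L
    rooted-or-grow z with in? L z | _∈?_ ℕ._≟_ (d z) (toList (H z))
    ... | yes z∈ | _     = inj₁ λ _ → z∈
    ... | no z∉  | yes m = inj₁ λ b → ⊥-elim (b m)
    ... | no z∉  | no b  = inj₂ (grow-added (plant f z∉ b) (here refl) z∉)
  ... | inj₂ g = inj₂ g
  ... | inj₁ roots with search (λ x → search (edge-or-grow x)) | search fused-or-grow
    where
    Settled : Fin n → Fin n → Set
    Settled x y = adj G x y ≡ true → ExitIn L x (E F x y) →
      In L y × (ExitIn L y (E F x y) → Together L x y ⊎ TreeEdge L x y ⊎ TreeEdge L y x)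
    edge-or-grow : ∀ x y → Settled x y ⊎ Grow L
    edge-or-grow x y with adj G x y Bool.≟ true | exitIn? L x (E F x y)
    ... | no ¬a | _     = inj₁ λ a → ⊥-elim (¬a a)
    ... | yes _ | no ¬e = inj₁ λ _ e → ⊥-elim (¬e e)
    ... | yes xy | yes ex with in? L y
    -- All roots are already planted, so a vertex outside the forest is regular and can be added as
    -- a child.
    ...   | no y∉ with _∈?_ ℕ._≟_ (d y) (toList (H y))
    ...     | no b    = ⊥-elim (y∉ (roots y b))
    ...     | yes dy∈ = inj₂ (grow-added (proj₂ (sprout f ex xy y∉ dy∈)) (here refl) y∉)
    edge-or-grow x y | yes xy | yes ex | yes y∈
      with exitIn? L y (E F x y) | together? L x y | treeEdge? L x y | treeEdge? L y x
    ... | no ¬e  | _     | _     | _     = inj₁ λ _ _ → y∈ , λ e → ⊥-elim (¬e e)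
    ... | yes _  | yes t | _     | _     = inj₁ λ _ _ → y∈ , λ _ → inj₁ t
    ... | yes _  | no _  | yes t | _     = inj₁ λ _ _ → y∈ , λ _ → inj₂ (inj₁ t)
    ... | yes _  | no _  | no _  | yes t = inj₁ λ _ _ → y∈ , λ _ → inj₂ (inj₂ t)
    ... | yes ey | no ¬t | no ¬l | no ¬r = inj₂ (grow-merged (link f xy refl ex ey ¬t ¬l ¬r))
    fused-or-grow : ∀ u → (Any (λ K → parent K ≡ just u × kind K ≡ kD) L → ¬ KindIn kD L u) ⊎ Grow L
    fused-or-grow u with Any.any? (λ K → ≡-dec _≟_ (parent K) (just u) ×-dec isD? (kind K)) L
                       | Any.any? (λ K → (_∈?_ _≟_ u (verts K)) ×-dec isD? (kind K)) L
    ... | no ¬c | _     = inj₁ λ c → ⊥-elim (¬c c)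
    ... | yes _ | no ¬D = inj₁ λ _ → ¬D
    ... | yes c | yes D = inj₂ (grow-merged (fuse f c D))
  ...   | inj₂ g | _      = inj₂ g
  ...   | inj₁ _ | inj₂ g = inj₂ g
  ...   | inj₁ s | inj₁ h = inj₁ record
          { rooted = roots ; explored = λ xy ex → proj₁ (s _ _ xy ex)
          ; linked = λ xy ex → proj₂ (s _ _ xy ex) ; fused = h _ }

  closed-forest : Σ (List Node) λ L → Forest L × Closed L
  closed-forest = go [] [] (<-wellFounded _)
    where
    go : ∀ L → Forest L → Acc ℕ._<_ (Φ L) → Σ (List Node) λ L → Forest L × Closed L
    go L f (acc rs) with grow-or-closed L f
    ... | inj₁ c            = L , f , c
    ... | inj₂ (grow g lt) = go _ g (rs lt)

-- Changeable trails in a closed forest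

lastFrom-snoc : ∀ {A : Set} (v : A) ys w → lastFrom v (ys ++ [ w ]) ≡ w
lastFrom-snoc v []       w = refl
lastFrom-snoc v (y ∷ ys) w = lastFrom-snoc y ys w

lastFrom∈ : ∀ {A : Set} (v : A) ys → lastFrom v ys ∈ v ∷ ys
lastFrom∈ v []       = here refl
lastFrom∈ v (y ∷ ys) = there (lastFrom∈ y ys)

take-length-++ : ∀ {A : Set} (xs ys : List A) → take (length xs) (xs ++ ys) ≡ xs
take-length-++ []       ys = refl
take-length-++ (x ∷ xs) ys = cong (x ∷_) (take-length-++ xs ys)

module _ {n : ℕ} where

  mult-snoc : ∀ a b (v : Fin n) ys w →
              mult a b (v ∷ ys ++ [ w ]) ≡ mult a b (v ∷ ys) ℕ.+ b2n (sameEdge (a , b) (lastFrom v ys , w))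
  mult-snoc a b v []       w = ℕ.+-identityʳ _
  mult-snoc a b v (y ∷ ys) w =
    trans (cong (b2n (sameEdge (a , b) (v , y)) ℕ.+_) (mult-snoc a b y ys w))
          (sym (ℕ.+-assoc (b2n (sameEdge (a , b) (v , y))) _ _))

  edgeSum-snoc : ∀ (E : Fin n → Fin n → Bool) z v ys w → edgeSum E z (v ∷ ys ++ [ w ]) ≡
                 edgeSum E z (v ∷ ys) + (δ z (lastFrom v ys) + δ z w) * σ (E (lastFrom v ys) w)
  edgeSum-snoc E z v []       w = trans (+-identityʳ ((δ z v + δ z w) * σ (E v w))) (sym (+-identityˡ _))
  edgeSum-snoc E z v (y ∷ ys) w =
    trans (cong (_+_ ((δ z v + δ z y) * σ (E v y))) (edgeSum-snoc E z y ys w))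
          (sym (ℤ.+-assoc ((δ z v + δ z y) * σ (E v y)) _ _))

  walk-snoc : ∀ {A : Fin n → Fin n → Bool} v ys {w} → Walk A (v ∷ ys ++ [ w ]) → A (lastFrom v ys) w ≡ true
  walk-snoc v []       (a ∷ _) = a
  walk-snoc v (y ∷ ys) (_ ∷ w) = walk-snoc y ys w

  walk-prefix : ∀ {A : Fin n → Fin n → Bool} v ys {zs} → Walk A (v ∷ ys ++ zs) → Walk A (v ∷ ys)
  walk-prefix v []       w       = []
  walk-prefix v (y ∷ ys) (a ∷ w) = a ∷ walk-prefix y ys w

module Completeness {n : ℕ} {G : Graph n} (H : Pres n) (F : Spanning G) (star : Star H) (chosen : IsChosen G H F) where

  open Growth H F star chosen public

  KindIn⇒In : ∀ {k L x} → KindIn k L x → In L x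
  KindIn⇒In = Any.map proj₁

  in-kind : ∀ {L x} → In L x → KindIn kA L x ⊎ KindIn kB L x ⊎ KindIn kD L x
  in-kind (here {node kA _ _ _} x∈) = inj₁ (here (x∈ , refl))
  in-kind (here {node kB _ _ _} x∈) = inj₂ (inj₁ (here (x∈ , refl)))
  in-kind (here {node kD _ _ _} x∈) = inj₂ (inj₂ (here (x∈ , refl)))
  in-kind (there x∈) with in-kind x∈
  ... | inj₁ a        = inj₁ (there a)
  ... | inj₂ (inj₁ b) = inj₂ (inj₁ (there b))
  ... | inj₂ (inj₂ c) = inj₂ (inj₂ (there c))

  kind-exit : ∀ {k L x t} → ExitOK k t → KindIn k L x → ExitIn L x t
  kind-exit o = Any.map λ { (x∈ , refl) → x∈ , o }

  -- Nodes are disjoint, so two facts that each place `x` in a node concern the same node. This is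
  -- how information about one vertex is combined below.
  same-node : ∀ {L x} {P Q : Node → Set} → Forest L → (∀ {K} → P K → x ∈ verts K) → (∀ {K} → Q K → x ∈ verts K) →
              Any P L → Any Q L → Any (λ K → P K × Q K) L
  same-node f                pin qin (here p)  (here q)  = here (p , q)
  same-node (cons g po ap f) pin qin (there p) (there q) = there (same-node f pin qin p q)
  same-node (cons g po ap f) pin qin (here p)  (there q) = ⊥-elim (ap (pin p) (Any.map qin q))
  same-node (cons g po ap f) pin qin (there p) (here q)  = ⊥-elim (ap (qin q) (Any.map pin p))

  with-good : ∀ {L} {P : Node → Set} → Forest L → Any P L → Σ Node λ K → GoodNode K × P K
  with-good (cons g po ap f) (here p)  = _ , g , p
  with-good (cons g po ap f) (there p) = with-good f p

  module _ {L : List Node} (f : Forest L) (cl : Closed L) where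

    kind-unique : ∀ {k k′ x} → KindIn k L x → KindIn k′ L x → k ≡ k′
    kind-unique a b with with-good f (same-node f proj₁ proj₁ a b)
    ... | _ , _ , (_ , e) , (_ , e′) = trans (sym e) e′

    deg-A : ∀ {x} → KindIn kA L x → d x ≡ MH H x
    deg-A a with with-good f a
    ... | node kA X r p , g , x∈ , refl with proj₁ (kindOK g) x∈
    ...   | refl = proj₂ (proj₂ (kindOK g))

    deg-B : ∀ {x} → KindIn kB L x → d x ℕ.≤ mH H x
    deg-B b with with-good f b
    ... | node kB X r p , g , x∈ , refl with proj₁ (kindOK g) x∈
    ...   | refl = proj₂ (proj₂ (kindOK g))

    regular-A : ∀ {x} → KindIn kA L x → d x ∈ toList (H x)
    regular-A a with with-good f a
    ... | node kA X r p , g , x∈ , refl with ordinary g x∈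
    ...   | inj₁ d∈ = d∈
    ...   | inj₂ (_ , refl) with () ← proj₁ (proj₂ (kindOK g))

    DEntry : Fin n → Fin n → Set
    DEntry u r = Any (λ K → (parent K ≡ just u × base K ≡ r) × kind K ≡ kD) L

    data Alternating : Kind → Kind → Bool → Set where
      atA : Alternating kA kB true
      atB : Alternating kB kA false

    alternating-exit : ∀ {k k′ t} → Alternating k k′ t → ExitOK k t
    alternating-exit atA = refl
    alternating-exit atB = refl

    singleton-entry : ∀ {k k′ t K} → Alternating k k′ t → GoodNode K → kind K ≡ k → Singleton K × entry K ≡ not t
    singleton-entry atA g refl = proj₁ (kindOK g) , proj₁ (proj₂ (kindOK g))
    singleton-entry atB g refl = proj₁ (kindOK g) , proj₁ (proj₂ (kindOK g))

    not-kind : ∀ {k k′ t} → Alternating k k′ t → k ≢ kD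
    not-kind atA ()
    not-kind atB ()

    tree∈ : ∀ {u r} → TreeEdge L u r → Any (λ K → r ∈ verts K × (parent K ≡ just u × base K ≡ r)) L
    tree∈ = go f
      where
      go : ∀ {L u r} → Forest L → TreeEdge L u r → Any (λ K → r ∈ verts K × (parent K ≡ just u × base K ≡ r)) L
      go (cons g po ap f) (here (e , refl)) = here (base∈ g , e , refl)
      go (cons g po ap f) (there t)         = there (go f t)

    -- The entry type of an A- or B-vertex is opposite to its exit type, so an edge of the exit type
    -- cannot be its entry edge.
    no-tree-into : ∀ {k k′ t u r} → Alternating k k′ t → KindIn k L r → E F u r ≡ t → ¬ TreeEdge L u r
    no-tree-into {t = t} al k∈ e te with with-good f (same-node f proj₁ proj₁ k∈ (tree∈ te))
    ... | node k X r (just u) , g , (r∈ , kd) , (_ , refl , refl) =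
          not-self t (trans (sym e) (proj₂ (singleton-entry al g kd)))
      where
      not-self : ∀ t → t ≢ not t
      not-self true ()
      not-self false ()

    -- If `y` had the same kind as `x`, the edge would be an exit at both ends, hence inside one
    -- singleton or a tree edge, and both are impossible. A blossom at `y` is likewise linked to
    -- `x`, and only its own entry edge remains.
    from-alternating : ∀ {k k′ t x y} → Alternating k k′ t → KindIn k L x → adj G x y ≡ true → E F x y ≡ t →
                       KindIn k′ L y ⊎ (KindIn kD L y × DEntry x y)
    from-alternating {k} {k′} {t} {x} {y} al x∈ xy refl = cases al not-same (in-kind (explored cl xy ex))
      where
      ex = kind-exit (alternating-exit al) x∈
      x≢y : x ≢ y
      x≢y = adj⇒≢ {G = G} xy
      not-same : ¬ KindIn k L y
      not-same y∈ with linked cl xy ex (kind-exit (alternating-exit al) y∈)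
      ... | inj₂ (inj₁ te) = no-tree-into al y∈ refl te
      ... | inj₂ (inj₂ te) = no-tree-into al x∈ (symE F y x) te
      ... | inj₁ tog with with-good f (same-node f proj₁ proj₁ x∈ tog)
      ...   | K , g , (_ , kd) , (x∈K , y∈K) = x≢y (trans (single x∈K) (sym (single y∈K)))
        where single = proj₁ (singleton-entry al g kd)
      into-D : KindIn kD L y → DEntry x y
      into-D y∈ with linked cl xy ex (kind-exit tt y∈)
      ... | inj₁ tog = ⊥-elim (not-kind al (kind-unique x∈ (Any.map (λ { ((_ , kd) , (x∈K , _)) → x∈K , kd })
                                                                     (same-node f proj₁ proj₂ y∈ tog))))
      ... | inj₂ (inj₁ te) = Any.map (λ { ((_ , kd) , (_ , te′)) → te′ , kd }) (same-node f proj₁ proj₁ y∈ (tree∈ te))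
      ... | inj₂ (inj₂ te) = ⊥-elim (no-tree-into al x∈ (symE F y x) te)
      cases : ∀ {k k′ t} → Alternating k k′ t → ¬ KindIn k L y → KindIn kA L y ⊎ KindIn kB L y ⊎ KindIn kD L y →
              KindIn k′ L y ⊎ (KindIn kD L y × DEntry x y)
      cases atA ¬s (inj₁ a)        = ⊥-elim (¬s a)
      cases atA ¬s (inj₂ (inj₁ b)) = inj₁ b
      cases atB ¬s (inj₁ a)        = inj₁ a
      cases atB ¬s (inj₂ (inj₁ b)) = ⊥-elim (¬s b)
      cases _   ¬s (inj₂ (inj₂ c)) = inj₂ (c , into-D c)

    -- An F-edge to A or an edge outside `F` to B is an exit seen from its other end, hence the
    -- entry edge of the blossom. Two different blossoms are not adjacent: they would be linked by a
    -- tree edge, which `fused` excludes.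
    from-D : ∀ {x y} → KindIn kD L x → adj G x y ≡ true → Together L x y
           ⊎ (KindIn kA L y × (E F x y ≡ false ⊎ DEntry y x)) ⊎ (KindIn kB L y × (E F x y ≡ true ⊎ DEntry y x))
    from-D {x} {y} x∈ xy with in-kind (explored cl xy (kind-exit tt x∈))
    ... | inj₂ (inj₂ y∈) with linked cl xy (kind-exit tt x∈) (kind-exit tt y∈)
    ...   | inj₁ tog = inj₁ tog
    ...   | inj₂ (inj₁ te) = ⊥-elim (fused cl (Any.map (λ { ((_ , kd) , (_ , e , _)) → e , kd })
                               (same-node f proj₁ proj₁ y∈ (tree∈ te))) x∈)
    ...   | inj₂ (inj₂ te) = ⊥-elim (fused cl (Any.map (λ { ((_ , kd) , (_ , e , _)) → e , kd })
                               (same-node f proj₁ proj₁ x∈ (tree∈ te))) y∈)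
    from-D {x} {y} x∈ xy | inj₁ y∈ with E F x y in e
    ... | false = inj₂ (inj₁ (y∈ , inj₁ refl))
    ... | true with from-alternating atA y∈ (adj-flip xy) (E-flip e)
    ...   | inj₂ (_ , de) = inj₂ (inj₁ (y∈ , inj₂ de))
    ...   | inj₁ b with () ← kind-unique b x∈
    from-D {x} {y} x∈ xy | inj₂ (inj₁ y∈) with E F x y in e
    ... | true = inj₂ (inj₂ (y∈ , inj₁ refl))
    ... | false with from-alternating atB y∈ (adj-flip xy) (E-flip e)
    ...   | inj₂ (_ , de) = inj₂ (inj₂ (y∈ , inj₂ de))
    ...   | inj₁ b with () ← kind-unique b x∈

    -- Following one changeable trail through a closed forest

    module Along (v₀ : Fin n) (v₀∈B₀ : B₀ H F v₀) where

      -- The entry edge has been traversed, so the trail cannot take it again to leave the blossom;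
      -- for a root blossom there is no such edge.
      Used : Node → List (Fin n) → Set
      Used K pre = ∀ u → parent K ≡ just u → 1 ℕ.≤ mult u (base K) (v₀ ∷ pre)

      InUsed : Fin n → List (Fin n) → Set
      InUsed x pre = Any (λ K → (x ∈ verts K × kind K ≡ kD) × Used K pre) L

      Location : List (Fin n) → Fin n → Set
      Location pre x = (KindIn kB L x × LastEven H F (v₀ ∷ pre)) ⊎ (KindIn kA L x × LastOdd H F (v₀ ∷ pre)) ⊎ InUsed x pre

      -- Every earlier visit of an A- or B-vertex was alternating.
      record Inv (pre : List (Fin n)) : Set where
        field
          location : Location pre (lastFrom v₀ pre)
          -- A B-vertex is entered along `F`, contributing -1, and left outside `F`, contributing
          -- +1; only the departure from `v₀` and the latest arrival stay unpaired. At A-vertices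
          -- the signs are reversed, and `v₀` is never one of them.
          sumB : ∀ {z} → KindIn kB L z → edgeSum (E F) z (v₀ ∷ pre) ≡ δ z v₀ + - δ z (lastFrom v₀ pre)
          sumA : ∀ {z} → KindIn kA L z → edgeSum (E F) z (v₀ ∷ pre) ≡ δ z (lastFrom v₀ pre)
      open Inv

      record PrefixOK (pre : List (Fin n)) : Set where
        field
          conds  : CondABC H F (v₀ ∷ pre)
          simple : EdgeSimple (v₀ ∷ pre)
          walks  : Walk (adj G) (v₀ ∷ pre)
      open PrefixOK

      deg-prefix : ∀ {pre} → PrefixOK pre → ∀ z →
                   + deg (symDiff (E F) (v₀ ∷ pre)) z ≡ + d z + edgeSum (E F) z (v₀ ∷ pre)
      deg-prefix ok = deg-symDiff (E F) (symE F) _ (simple ok) (walk⇒loopless F (walks ok))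

      v₀∉A : ∀ {z} → KindIn kA L z → z ≢ v₀
      v₀∉A a refl = v₀∈B₀ (regular-A a)

      initial : Inv []
      location initial with in-kind (rooted cl v₀ v₀∈B₀)
      ... | inj₁ a        = ⊥-elim (v₀∉A a refl)
      ... | inj₂ (inj₁ b) = inj₁ (b , tt)
      ... | inj₂ (inj₂ c) = inj₂ (inj₂ (rootless f c))
        where
        rootless : ∀ {L} → Forest L → KindIn kD L v₀ → Any (λ K → (v₀ ∈ verts K × kind K ≡ kD) × Used K []) L
        rootless (cons g po ap f) (there c) = there (rootless f c)
        rootless (cons g po ap f) (here (v∈ , kd)) with ordinary g v∈
        ... | inj₁ d∈      = ⊥-elim (v₀∈B₀ d∈)
        ... | inj₂ (_ , e) = here ((v∈ , kd) , λ _ e′ → case trans (sym e) e′ of λ ())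
      sumB initial {z} _ = sym (ℤ.+-inverseʳ (δ z v₀))
      sumA initial {z} a = sym (δ-≢ (v₀∉A a))

      lastOdd-snoc : ∀ v ys {w} → E F (lastFrom v ys) w ≡ false → LastOdd H F (v ∷ ys ++ [ w ])
      lastOdd-snoc v []           e = e
      lastOdd-snoc v (y ∷ [])     e = e
      lastOdd-snoc v (y ∷ z ∷ ys) e = lastOdd-snoc y (z ∷ ys) e

      lastEven-snoc : ∀ v ys {w} → E F (lastFrom v ys) w ≡ true → LastEven H F (v ∷ ys ++ [ w ])
      lastEven-snoc v []           e = e
      lastEven-snoc v (y ∷ [])     e = e
      lastEven-snoc v (y ∷ z ∷ ys) e = lastEven-snoc y (z ∷ ys) e

      module Step (pre : List (Fin n)) (w : Fin n) (inv : Inv pre) (ok : PrefixOK (pre ++ [ w ])) where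

        x : Fin n
        x = lastFrom v₀ pre

        t : Bool
        t = E F x w

        xw : adj G x w ≡ true
        xw = walk-snoc v₀ pre (walks ok)

        x≢w : x ≢ w
        x≢w = adj⇒≢ {G = G} xw

        last≡w : last (v₀ ∷ pre ++ [ w ]) ≡ w
        last≡w = trans (last≡lastFrom v₀ (pre ++ [ w ])) (lastFrom-snoc v₀ pre w)

        x≢last : x ≢ last (v₀ ∷ pre ++ [ w ])
        x≢last e = x≢w (trans e last≡w)

        x∈ : x ∈ v₀ ∷ pre ++ [ w ]
        x∈ = ∈-++⁺ˡ (lastFrom∈ v₀ pre)

        deg-x : ∀ {s b} → edgeSum (E F) x (v₀ ∷ pre) ≡ s → t ≡ b →
                + deg (symDiff (E F) (v₀ ∷ pre ++ [ w ])) x ≡ + d x + (s + σ b)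
        deg-x {s} {b} e refl = trans (deg-prefix ok x) (cong (_+_ (+ d x)) (trans (edgeSum-snoc (E F) x v₀ pre w)
          (cong₂ _+_ e (trans (cong (_* σ b) (cong₂ _+_ (δ-refl x) (δ-≢ x≢w))) (ℤ.*-identityˡ (σ b))))))

        toggled∈ : x ≢ v₀ → d x ∈ toList (H x) × deg (symDiff (E F) (v₀ ∷ pre ++ [ w ])) x ∈ toList (H x)
        toggled∈ x≢v₀ with proj₁ (proj₂ (conds ok)) x x∈ x≢v₀ x≢last
        ... | e , e′ = dist≡0⇒∈ (H x) e , dist≡0⇒∈ (H x) e′

        -- Leaving along an edge outside `F` would give an A-vertex degree `MH + 2`, against (b).
        leave-A : KindIn kA L x → t ≡ true
        leave-A a with t in e
        ... | true  = refl
        ... | false = ⊥-elim (ℕ.<⇒≱ (ℕ.≤-trans (ℕ.≤-reflexive (ℕ.+-comm 1 (d x))) (ℕ.+-monoʳ-≤ (d x) (s≤s z≤n)))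
                        (ℕ.≤-trans (ℕ.≤-reflexive (sym up)) (ℕ.≤-trans (≤MH H (proj₂ (toggled∈ (v₀∉A a))))
                                   (ℕ.≤-reflexive (sym (deg-A a))))))
          where
          up : deg (symDiff (E F) (v₀ ∷ pre ++ [ w ])) x ≡ d x ℕ.+ 2
          up = ℤ.+-injective (deg-x (trans (sumA inv a) (δ-refl x)) e)

        -- Away from `v₀`, leaving along `F` would lower a degree that is at most `mH` by 2, against
        -- (b). At `v₀` itself the first edge is settled by (a), and after a return the degree would
        -- drop by 1, increasing the deficiency against (c).
        leave-B : KindIn kB L x → t ≡ false
        leave-B b with t in e
        ... | false = refl
        ... | true with x ≟ v₀
        ...   | no x≢v₀ = ⊥-elim (ℕ.<⇒≱ lower (ℕ.≤-trans (deg-B b) (mH≤ H (proj₂ (toggled∈ x≢v₀)))))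
          where
          back : ∀ d → (d + (+ 0 + - + 1 + - + 1)) + + 2 ≡ d
          back = solve-∀
          down : deg (symDiff (E F) (v₀ ∷ pre ++ [ w ])) x ℕ.+ 2 ≡ d x
          down = ℤ.+-injective (trans (cong (_+ + 2) (deg-x (trans (sumB inv b) (cong₂ (λ i j → i + - j) (δ-≢ x≢v₀) (δ-refl x))) e))
                                      (back (+ d x)))
          lower : deg (symDiff (E F) (v₀ ∷ pre ++ [ w ])) x ℕ.< d x
          lower = ℕ.≤-trans (ℕ.≤-reflexive (ℕ.+-comm 1 _)) (ℕ.≤-trans (ℕ.+-monoʳ-≤ _ (s≤s z≤n)) (ℕ.≤-reflexive down))
        ...   | yes x≡v₀ = ⊥-elim (again pre inv ok e x≡v₀ b)
          where
          back : ∀ d → (d + (+ 1 + - + 1 + - + 1)) + + 1 ≡ d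
          back = solve-∀
          again : ∀ pre (inv : Inv pre) (ok : PrefixOK (pre ++ [ w ])) → E F (lastFrom v₀ pre) w ≡ true →
                  lastFrom v₀ pre ≡ v₀ → KindIn kB L (lastFrom v₀ pre) → ⊥
          again []       inv ok e _ _ = true≢false e (proj₂ (proj₁ (conds ok)))
          again (y ∷ ys) inv ok e x≡v₀ b =
            ℕ.<-asym closer (ℕ.≤-reflexive (subst (λ k → suc (dist k (H v₀)) ≡ defE H (symDiff (E F) P) v₀) down
              (dist-suc< (H v₀) (ℕ.<-trans (ℕ.≤-reflexive down) (below v₀∈B₀)))))
            where
            P = v₀ ∷ (y ∷ ys) ++ [ w ]
            v₀∈ : v₀ ∈ (y ∷ ys) ++ [ w ]
            v₀∈ = ∈-++⁺ˡ (subst (_∈ y ∷ ys) x≡v₀ (lastFrom∈ y ys))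
            w≢v₀ : v₀ ≢ w
            w≢v₀ = subst (_≢ w) x≡v₀ (adj⇒≢ {G = G} (walk-snoc v₀ (y ∷ ys) (walks ok)))
            sumv : edgeSum (E F) v₀ (v₀ ∷ y ∷ ys) ≡ + 1 + - + 1
            sumv = trans (sumB inv (subst (KindIn kB L) x≡v₀ b))
                     (cong₂ (λ i j → i + - j) (δ-refl v₀) (trans (cong (δ v₀) x≡v₀) (δ-refl v₀)))
            down : suc (deg (symDiff (E F) P) v₀) ≡ d v₀
            down = ℤ.+-injective (trans (cong +_ (ℕ.+-comm 1 (deg (symDiff (E F) P) v₀)))
              (trans (cong (_+ + 1) (trans (deg-prefix ok v₀) (cong (_+_ (+ d v₀))
                 (trans (edgeSum-snoc (E F) v₀ v₀ (y ∷ ys) w)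
                   (cong₂ _+_ sumv (trans (cong₂ _*_ (cong₂ _+_ (trans (cong (δ v₀) x≡v₀) (δ-refl v₀)) (δ-≢ w≢v₀)) (cong σ e)) refl))))))
                 (back (+ d v₀))))
            closer : defE H (symDiff (E F) P) v₀ ℕ.< defE H (E F) v₀
            closer = proj₂ (proj₂ (conds ok)) v₀∈ (λ e → w≢v₀ (trans e
                       (trans (last≡lastFrom v₀ ((y ∷ ys) ++ [ w ])) (lastFrom-snoc v₀ (y ∷ ys) w))))

        grows : ∀ a b → mult a b (v₀ ∷ pre) ℕ.≤ mult a b (v₀ ∷ pre ++ [ w ])
        grows a b = ℕ.≤-trans (ℕ.m≤m+n _ _) (ℕ.≤-reflexive (sym (mult-snoc a b v₀ pre w)))

        -- The blossom of `x` was entered along this very edge, so going out along it would traverse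
        -- it a second time.
        no-reuse : InUsed x pre → ¬ DEntry w x
        no-reuse used de with with-good f (same-node f (proj₁ ∘ proj₁) proj₁ used (tree∈ (Any.map proj₁ de)))
        ... | K , _ , (_ , u) , (_ , e , refl) = ℕ.<⇒≱ (ℕ.≤-trans (ℕ.+-mono-≤ (u w e) crossing)
              (ℕ.≤-reflexive (sym (mult-snoc w x v₀ pre w)))) (simple ok w x)
          where
          crossing : 1 ℕ.≤ b2n (sameEdge (w , x) (x , w))
          crossing = ℕ.≤-reflexive (cong b2n (sym (trans (sameEdge-swapʳ w x w x) (sameEdge-refl w x))))

        entered : KindIn kD L w → DEntry x w → InUsed w (pre ++ [ w ])
        entered w∈ de = Any.map (λ { ((w∈K , kd) , (_ , e , refl)) → (w∈K , kd) , λ _ e′ → use (just-injective (trans (sym e) e′)) })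
                          (same-node f proj₁ proj₁ w∈ (tree∈ (Any.map proj₁ de)))
          where
          use : ∀ {u} → x ≡ u → 1 ℕ.≤ mult u w (v₀ ∷ pre ++ [ w ])
          use refl = ℕ.≤-trans (ℕ.≤-reflexive (cong b2n (sym (sameEdge-refl x w))))
                       (ℕ.≤-trans (ℕ.m≤n+m _ _) (ℕ.≤-reflexive (sym (mult-snoc x w v₀ pre w))))

        stay : InUsed x pre → Together L x w → InUsed w (pre ++ [ w ])
        stay used tog = Any.map (λ { {K} (((_ , kd) , u) , (_ , w∈)) → (w∈ , kd) , λ y e → ℕ.≤-trans (u y e) (grows y (base K)) })
                          (same-node f (proj₁ ∘ proj₁) proj₁ used tog)

        used⇒D : ∀ {y} ys → InUsed y ys → KindIn kD L y
        used⇒D ys = Any.map proj₁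

        Next : Set
        Next = Location (pre ++ [ w ]) w × (KindIn kB L w → t ≡ true) × (KindIn kA L w → t ≡ false)

        to-A : KindIn kA L w → t ≡ false → Next
        to-A a e = inj₂ (inj₁ (a , lastOdd-snoc v₀ pre e)) , (λ b → case kind-unique a b of λ ()) , λ _ → e

        to-B : KindIn kB L w → t ≡ true → Next
        to-B b e = inj₁ (b , lastEven-snoc v₀ pre e) , (λ _ → e) , λ a → case kind-unique a b of λ ()

        to-D : InUsed w (pre ++ [ w ]) → Next
        to-D u = inj₂ (inj₂ u) , (λ b → case kind-unique b (used⇒D (pre ++ [ w ]) u) of λ ()) , λ a → case kind-unique a (used⇒D (pre ++ [ w ]) u) of λ ()

        next : Next
        next with location inv
        ... | inj₁ (b , _) with from-alternating atB b xw (leave-B b)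
        ...   | inj₁ a        = to-A a (leave-B b)
        ...   | inj₂ (c , de) = to-D (entered c de)
        next | inj₂ (inj₁ (a , _)) with from-alternating atA a xw (leave-A a)
        ... | inj₁ b        = to-B b (leave-A a)
        ... | inj₂ (c , de) = to-D (entered c de)
        next | inj₂ (inj₂ u) with from-D (used⇒D pre u) xw
        ... | inj₁ tog                  = to-D (stay u tog)
        ... | inj₂ (inj₁ (a , inj₁ e))  = to-A a e
        ... | inj₂ (inj₁ (_ , inj₂ de)) = ⊥-elim (no-reuse u de)
        ... | inj₂ (inj₂ (b , inj₁ e))  = to-B b e
        ... | inj₂ (inj₂ (_ , inj₂ de)) = ⊥-elim (no-reuse u de)

        edgeSum-step : ∀ z {a b s c} → δ z x ≡ a → δ z w ≡ b → edgeSum (E F) z (v₀ ∷ pre) ≡ s → t ≡ c →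
                       edgeSum (E F) z (v₀ ∷ pre ++ [ w ]) ≡ s + (a + b) * σ c
        edgeSum-step z refl refl refl refl = edgeSum-snoc (E F) z v₀ pre w

        private
          cancel : ∀ i → i + - + 1 + + 1 ≡ i + + 0
          cancel = solve-∀

        sumB′ : ∀ {z} → KindIn kB L z → edgeSum (E F) z (v₀ ∷ pre ++ [ w ]) ≡ δ z v₀ + - δ z w
        sumB′ {z} b = go (z ≟ x) (z ≟ w)
          where
          go : Dec (z ≡ x) → Dec (z ≡ w) → edgeSum (E F) z (v₀ ∷ pre ++ [ w ]) ≡ δ z v₀ + - δ z w
          go (yes z≡x) _ = trans (edgeSum-step z x1 w0 (trans (sumB inv b) (cong (λ i → δ z v₀ + - i) x1)) (leave-B (subst (KindIn kB L) z≡x b)))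
                                (trans (cancel (δ z v₀)) (cong (λ i → δ z v₀ + - i) (sym w0)))
            where
            x1 : δ z x ≡ + 1
            x1 = trans (cong (δ z) (sym z≡x)) (δ-refl z)
            w0 : δ z w ≡ + 0
            w0 = δ-≢ (λ z≡w → x≢w (trans (sym z≡x) z≡w))
          go (no z≢x) (yes refl) = trans (edgeSum-step z (δ-≢ z≢x) (δ-refl z) (trans (sumB inv b) (cong (λ i → δ z v₀ + - i) (δ-≢ z≢x)))
                                             (proj₁ (proj₂ next) b))
                                (trans (cong (_+ - + 1) (+-identityʳ (δ z v₀))) (cong (λ i → δ z v₀ + - i) (sym (δ-refl z))))
          go (no z≢x) (no z≢w) = trans (edgeSum-step z (δ-≢ z≢x) (δ-≢ z≢w) (trans (sumB inv b) (cong (λ i → δ z v₀ + - i) (δ-≢ z≢x))) refl)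
                                (trans (+-identityʳ _) (cong (λ i → δ z v₀ + - i) (sym (δ-≢ z≢w))))

        sumA′ : ∀ {z} → KindIn kA L z → edgeSum (E F) z (v₀ ∷ pre ++ [ w ]) ≡ δ z w
        sumA′ {z} a = go (z ≟ x) (z ≟ w)
          where
          go : Dec (z ≡ x) → Dec (z ≡ w) → edgeSum (E F) z (v₀ ∷ pre ++ [ w ]) ≡ δ z w
          go (yes z≡x) _ = trans (edgeSum-step z x1 w0 (trans (sumA inv a) x1) (leave-A (subst (KindIn kA L) z≡x a))) (sym w0)
            where
            x1 : δ z x ≡ + 1
            x1 = trans (cong (δ z) (sym z≡x)) (δ-refl z)
            w0 : δ z w ≡ + 0
            w0 = δ-≢ (λ z≡w → x≢w (trans (sym z≡x) z≡w))
          go (no z≢x) (yes refl) = trans (edgeSum-step z (δ-≢ z≢x) (δ-refl z) (trans (sumA inv a) (δ-≢ z≢x)) (proj₂ (proj₂ next) a)) (sym (δ-refl z))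
          go (no z≢x) (no z≢w) = trans (edgeSum-step z (δ-≢ z≢x) (δ-≢ z≢w) (trans (sumA inv a) (δ-≢ z≢x)) refl) (sym (δ-≢ z≢w))

        advance : Inv (pre ++ [ w ])
        advance = record
          { location = subst (Location (pre ++ [ w ])) (sym (lastFrom-snoc v₀ pre w)) (proj₁ next)
          ; sumB = λ {z} b → trans (sumB′ b) (cong (λ y → δ z v₀ + - δ z y) (sym (lastFrom-snoc v₀ pre w)))
          ; sumA = λ {z} a → trans (sumA′ a) (cong (δ z) (sym (lastFrom-snoc v₀ pre w))) }

      along : ∀ pre suf → Inv pre → (∀ ys zs → pre ++ suf ≡ ys ++ zs → PrefixOK ys) → Inv (pre ++ suf)
      along pre []        inv ok = subst Inv (sym (++-identityʳ pre)) inv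
      along pre (w ∷ suf) inv ok = subst Inv (++-assoc pre [ w ] suf)
        (along (pre ++ [ w ]) suf (Step.advance pre w inv (ok (pre ++ [ w ]) suf (sym (++-assoc pre [ w ] suf))))
               (λ ys zs e → ok ys zs (trans (sym (++-assoc pre [ w ] suf)) e)))

      changeable-inv : ∀ {vs} → Changeable H F (v₀ ∷ vs) → Inv vs
      changeable-inv {vs} ((w , ap) , conds) = along [] vs initial prefix-ok
        where
        prefix-ok : ∀ ys zs → vs ≡ ys ++ zs → PrefixOK ys
        prefix-ok ys zs refl = record
          { conds = subst (λ l → CondABC H F (v₀ ∷ l)) (take-length-++ ys zs)
                      (conds (length ys) (ℕ.≤-trans (ℕ.m≤m+n _ _) (ℕ.≤-reflexive (sym (length-++ ys)))))
          ; simple = λ a b → ℕ.≤-trans (ℕ.≤-reflexive (cong (λ l → mult a b (v₀ ∷ l)) (sym (take-length-++ ys zs))))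
                       (ℕ.≤-trans (mult-take a b v₀ (length ys) (ys ++ zs)) (AllPairs⇒EdgeSimple (v₀ ∷ ys ++ zs) ap a b))
          ; walks = walk-prefix v₀ ys w }

    parity : ∀ xs → LastEven H F xs → ¬ LastOdd H F xs
    parity (a ∷ b ∷ [])    e o = true≢false e o
    parity (a ∷ b ∷ c ∷ r) e o = parity (b ∷ c ∷ r) e o

    start∈B₀ : ∀ v vs → Changeable H F (v ∷ vs) → B₀ H F v
    start∈B₀ v vs (_ , conds) = proj₁ (conds 0 z≤n)

    even-to : ∀ {v} → EvenTo H F v → KindIn kB L v ⊎ KindIn kD L v
    even-to {v} (v₀ ∷ vs , ch , even , last≡)
      with Along.Inv.location (Along.changeable-inv v₀ (start∈B₀ v₀ vs ch) ch)
    ... | loc rewrite trans (sym (last≡lastFrom v₀ vs)) last≡ with loc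
    ...   | inj₁ (b , _)          = inj₁ b
    ...   | inj₂ (inj₁ (_ , odd)) = ⊥-elim (parity (v₀ ∷ vs) even odd)
    ...   | inj₂ (inj₂ u)         = inj₂ (Any.map proj₁ u)

    odd-to : ∀ {v} → OddTo H F v → KindIn kA L v ⊎ KindIn kD L v
    odd-to {v} (v₀ ∷ vs , ch , odd , last≡)
      with Along.Inv.location (Along.changeable-inv v₀ (start∈B₀ v₀ vs ch) ch)
    ... | loc rewrite trans (sym (last≡lastFrom v₀ vs)) last≡ with loc
    ...   | inj₁ (_ , even)     = ⊥-elim (parity (v₀ ∷ vs) even odd)
    ...   | inj₂ (inj₁ (a , _)) = inj₁ a
    ...   | inj₂ (inj₂ u)       = inj₂ (Any.map proj₁ u)

    kD⇒D : ∀ {v} → KindIn kD L v → D H F v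
    kD⇒D c = both-exits⇒D (proj₁ (root-trail f (kind-exit tt c))) (proj₁ (root-trail f (kind-exit tt c)))

    D⇒kD : ∀ {v} → D H F v → KindIn kD L v
    D⇒kD (inj₁ (e , o)) with even-to e | odd-to o
    ... | inj₂ c | _      = c
    ... | inj₁ _ | inj₂ c = c
    ... | inj₁ b | inj₁ a with () ← kind-unique a b
    D⇒kD (inj₂ (inj₁ (lt , _ , e))) with even-to e
    ... | inj₂ c = c
    ... | inj₁ b = ⊥-elim (ℕ.<⇒≱ lt (deg-B b))
    D⇒kD (inj₂ (inj₂ (_ , lt , o))) with odd-to o
    ... | inj₂ c = c
    ... | inj₁ a = ⊥-elim (ℕ.<⇒≢ lt (deg-A a))

    kB⇒B : ∀ {v} → KindIn kB L v → Bset H F v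
    kB⇒B b with reach (proj₁ (root-trail f (kind-exit refl b)))
    ... | inj₁ (e , _) = e , λ D → case kind-unique b (D⇒kD D) of λ ()
    ... | inj₂ (o , _) with odd-to o
    ...   | inj₁ a with () ← kind-unique a b
    ...   | inj₂ c with () ← kind-unique c b

    kA⇒A : ∀ {v} → KindIn kA L v → Aset H F v
    kA⇒A a with reach (proj₁ (root-trail f (kind-exit refl a)))
    ... | inj₂ (o , _) = o , λ D → case kind-unique a (D⇒kD D) of λ ()
    ... | inj₁ (e , _) with even-to e
    ...   | inj₁ b with () ← kind-unique a b
    ...   | inj₂ c with () ← kind-unique c a

    B⇒kB : ∀ {v} → Bset H F v → KindIn kB L v
    B⇒kB (e , ¬D) with even-to e
    ... | inj₁ b = b
    ... | inj₂ c = ⊥-elim (¬D (kD⇒D c))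

    A⇒kA : ∀ {v} → Aset H F v → KindIn kA L v
    A⇒kA (o , ¬D) with odd-to o
    ... | inj₁ a = a
    ... | inj₂ c = ⊥-elim (¬D (kD⇒D c))

-- Counting

∑-ones : ∀ {n} {f : Fin n → ℤ} → (∀ i → f i ≡ + 1) → ∑ f ≡ + n
∑-ones {zero}  e = refl
∑-ones {suc n} e = cong₂ _+_ (e zero) (∑-ones (e ∘ suc))

⌊⌋-yes : ∀ {P : Set} (P? : Dec P) → P → ⌊ P? ⌋ ≡ true
⌊⌋-yes (yes _) p = refl
⌊⌋-yes (no ¬p) p = ⊥-elim (¬p p)

⌊⌋-no : ∀ {P : Set} (P? : Dec P) → ¬ P → ⌊ P? ⌋ ≡ false
⌊⌋-no (yes p) ¬p = ⊥-elim (¬p p)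
⌊⌋-no (no _)  ¬p = refl

witness : ∀ {P : Set} (P? : Dec P) → ⌊ P? ⌋ ≡ true → P
witness (yes p) _ = p

infixr 7 _when_
_when_ : ℤ → Bool → ℤ
x when b = if b then x else + 0

∑-when : ∀ {n} (f : Fin n → ℤ) b → (∑ f) when b ≡ ∑ (λ y → f y when b)
∑-when f true  = refl
∑-when {n} f false = sym (∑-0 {n} (λ _ → refl))

module Counting {n : ℕ} {G : Graph n} (H : Pres n) (F : Spanning G) (star : Star H) (chosen : IsChosen G H F)
  (decA : ∀ v → Dec (Aset H F v)) (decB : ∀ v → Dec (Bset H F v))
  (τ : ℕ) (c : (v : Fin n) → D H F v → Fin τ) (labelling : ComponentLabelling H F τ c) where

  open Completeness H F star chosen

  module Count (L : List Node) (f : Forest L) (cl : Closed L) where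

    isA isB : Fin n → Bool
    isA v = ⌊ decA v ⌋
    isB v = ⌊ decB v ⌋

    data Class (v : Fin n) : Set where
      inA : KindIn kA L v → isA v ≡ true → isB v ≡ false → Class v
      inB : KindIn kB L v → isA v ≡ false → isB v ≡ true → Class v
      inD : KindIn kD L v → isA v ≡ false → isB v ≡ false → Class v
      inC : ¬ In L v → isA v ≡ false → isB v ≡ false → Class v

    notA : ∀ {v} → ¬ KindIn kA L v → isA v ≡ false
    notA {v} ¬a = ⌊⌋-no (decA v) (¬a ∘ A⇒kA f cl)

    notB : ∀ {v} → ¬ KindIn kB L v → isB v ≡ false
    notB {v} ¬b = ⌊⌋-no (decB v) (¬b ∘ B⇒kB f cl)

    classify : ∀ v → Class v
    classify v with in? L v
    ... | no v∉ = inC v∉ (notA (v∉ ∘ KindIn⇒In)) (notB (v∉ ∘ KindIn⇒In))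
    ... | yes v∈ with in-kind v∈
    ...   | inj₁ a = inA a (⌊⌋-yes (decA v) (kA⇒A f cl a)) (notB (λ b → case kind-unique f cl a b of λ ()))
    ...   | inj₂ (inj₁ b) = inB b (notA (λ a → case kind-unique f cl a b of λ ())) (⌊⌋-yes (decB v) (kB⇒B f cl b))
    ...   | inj₂ (inj₂ e) = inD e (notA (λ a → case kind-unique f cl a e of λ ())) (notB (λ b → case kind-unique f cl b e of λ ()))

    dEntry? : ∀ u r → Dec (DEntry f cl u r)
    dEntry? u r = Any.any? (λ K → (≡-dec _≟_ (parent K) (just u) ×-dec (base K ≟ r)) ×-dec isD? (kind K)) L

    DRoot DBase : Fin n → Set
    DRoot r = Any (λ K → (parent K ≡ nothing × base K ≡ r) × kind K ≡ kD) L
    DBase r = Any (λ K → base K ≡ r × kind K ≡ kD) L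

    dRoot? : ∀ r → Dec (DRoot r)
    dRoot? r = Any.any? (λ K → (≡-dec _≟_ (parent K) nothing ×-dec (base K ≟ r)) ×-dec isD? (kind K)) L

    dBase? : ∀ r → Dec (DBase r)
    dBase? r = Any.any? (λ K → (base K ≟ r) ×-dec isD? (kind K)) L

    ent : Fin n → Fin n → ℤ
    ent u r = bit ⌊ dEntry? u r ⌋

    ent-1 : ∀ {u r} → DEntry f cl u r → ent u r ≡ + 1
    ent-1 {u} {r} de = cong bit (⌊⌋-yes (dEntry? u r) de)

    ent-0 : ∀ {u r} → ¬ DEntry f cl u r → ent u r ≡ + 0
    ent-0 {u} {r} ¬de = cong bit (⌊⌋-no (dEntry? u r) ¬de)

    with-base : ∀ {L} {P : Node → Set} → Forest L → Any P L → Any (λ K → base K ∈ verts K × P K) L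
    with-base (cons g po ap f) (here p)  = here (base∈ g , p)
    with-base (cons g po ap f) (there p) = there (with-base f p)

    base-kD : ∀ {r} → DBase r → KindIn kD L r
    base-kD b = Any.map (λ { (r∈ , (refl , kd)) → r∈ , kd }) (with-base f b)

    entry⇒base : ∀ {u r} → DEntry f cl u r → DBase r
    entry⇒base = Any.map λ { ((_ , e) , kd) → e , kd }

    root⇒base : ∀ {r} → DRoot r → DBase r
    root⇒base = Any.map λ { ((_ , e) , kd) → e , kd }

    entry-parent : ∀ {u r} → DEntry f cl u r → adj G u r ≡ true × ExitIn L u (E F u r)
    entry-parent = go f
      where
      go : ∀ {L u r} → Forest L → Any (λ K → (parent K ≡ just u × base K ≡ r) × kind K ≡ kD) L →
           adj G u r ≡ true × ExitIn L u (E F u r)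
      go (cons g po ap f) (here ((e , refl) , _)) = proj₁ (po e) , there (proj₂ (po e))
      go (cons g po ap f) (there de) with go f de
      ... | a , ex = a , there ex

    entry-exit : ∀ {k u r} → KindIn k L u → DEntry f cl u r → ExitOK k (E F u r)
    entry-exit u∈ de with with-good f (same-node f proj₁ proj₁ u∈ (proj₂ (entry-parent de)))
    ... | _ , _ , (_ , refl) , (_ , o) = o

    no-entry-from-D : ∀ {u r} → KindIn kD L u → ¬ DEntry f cl u r
    no-entry-from-D u∈ de = fused cl (Any.map (λ { ((e , _) , kd) → e , kd }) de) u∈

    no-entry-into : ∀ {k u r} → KindIn k L r → k ≢ kD → ¬ DEntry f cl u r
    no-entry-into r∈ k≢ de = k≢ (kind-unique f cl r∈ (base-kD (entry⇒base de)))

    -- Summed over `y`, this is the F-degree of `v` minus its degree in `G - A` when `v` is in B,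
    -- and minus the F-degree when `v` is in A.
    balance : Fin n → Fin n → ℤ
    balance v y = (bit (E F v y) - bit (adj G v y ∧ not (isA y))) when isB v - bit (E F v y) when isA v

    AB BA : Fin n → Fin n → ℤ
    AB v y = bit (E F v y ∧ (isA v ∧ isB y))
    BA v y = bit (E F v y ∧ (isB v ∧ isA y))

    Balanced : Bool → Bool → Bool → Bool → Bool → Bool → ℤ → Set
    Balanced e a Av Bv Ay By x =
      (bit e - bit (a ∧ not Ay)) when Bv - bit e when Av ≡ bit (e ∧ (Bv ∧ Ay)) - bit (e ∧ (Av ∧ By)) - x

    balanced : ∀ v y {e a Av Bv Ay By x} → E F v y ≡ e → adj G v y ≡ a → isA v ≡ Av → isB v ≡ Bv →
               isA y ≡ Ay → isB y ≡ By → ent v y ≡ x → Balanced e a Av Bv Ay By x →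
               balance v y ≡ BA v y - AB v y - ent v y
    balanced v y refl refl refl refl refl refl refl b = b

    no-edge : ∀ Av Bv Ay By → Balanced false false Av Bv Ay By (+ 0)
    no-edge true  true  _ _ = refl
    no-edge true  false _ _ = refl
    no-edge false true  _ _ = refl
    no-edge false false _ _ = refl

    F-edge-from-B : ∀ Ay By → Balanced true true false true Ay By (+ 0)
    F-edge-from-B true  By = refl
    F-edge-from-B false By = refl

    -- An edge outside `F` from B ends in A or enters a blossom, and an F-edge from A ends in B or
    -- enters a blossom. F-edges from B to vertices outside A cancel against the same edges of
    -- `G - A`, leaving +1 for each F-edge from B to A.
    balance≡ : ∀ v y → balance v y ≡ BA v y - AB v y - ent v y
    balance≡ v y = go _ _ refl refl (classify v) (classify y)
      where
      Goal : Set
      Goal = balance v y ≡ BA v y - AB v y - ent v y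
      go : ∀ e a → E F v y ≡ e → adj G v y ≡ a → Class v → Class y → Goal
      go true  false e a _ _ = ⊥-elim (true≢false (subE F v y e) a)
      go false false e a _ _ = balanced v y e a refl refl refl refl
        (ent-0 (λ de → true≢false (proj₁ (entry-parent de)) a)) (no-edge (isA v) (isB v) (isA y) (isB y))
      go true true e a (inD vd p q) _ = balanced v y e a p q refl refl (ent-0 (no-entry-from-D vd)) refl
      go true true e a (inC v∉ p q) _ = balanced v y e a p q refl refl
        (ent-0 (λ de → v∉ (exit⇒in (proj₂ (entry-parent de))))) refl
      go true true e a (inB vb p q) _ = balanced v y e a p q refl refl
        (ent-0 (λ de → true≢false e (entry-exit vb de))) (F-edge-from-B (isA y) (isB y))
      go true true e a (inA va p q) cy = to (from-alternating f cl atA va a e) cy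
        where
        to : KindIn kB L y ⊎ (KindIn kD L y × DEntry f cl v y) → Class y → Goal
        to _                (inB yb r s) = balanced v y e a p q r s (ent-0 (no-entry-into yb λ ())) refl
        to (inj₂ (_ , de))  (inD _ r s)  = balanced v y e a p q r s (ent-1 de) refl
        to (inj₁ yb)        (inD yd _ _) = ⊥-elim (case kind-unique f cl yd yb of λ ())
        to (inj₁ yb)        (inA ya _ _) = ⊥-elim (case kind-unique f cl ya yb of λ ())
        to (inj₂ (yd , _))  (inA ya _ _) = ⊥-elim (case kind-unique f cl ya yd of λ ())
        to (inj₁ yb)        (inC y∉ _ _) = ⊥-elim (y∉ (KindIn⇒In yb))
        to (inj₂ (yd , _))  (inC y∉ _ _) = ⊥-elim (y∉ (KindIn⇒In yd))
      go false true e a (inD vd p q) _ = balanced v y e a p q refl refl (ent-0 (no-entry-from-D vd)) refl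
      go false true e a (inC v∉ p q) _ = balanced v y e a p q refl refl
        (ent-0 (λ de → v∉ (exit⇒in (proj₂ (entry-parent de))))) refl
      go false true e a (inA va p q) _ = balanced v y e a p q refl refl
        (ent-0 (λ de → true≢false (entry-exit va de) e)) refl
      go false true e a (inB vb p q) cy = to (from-alternating f cl atB vb a e) cy
        where
        to : KindIn kA L y ⊎ (KindIn kD L y × DEntry f cl v y) → Class y → Goal
        to _                (inA ya r s) = balanced v y e a p q r s (ent-0 (no-entry-into ya λ ())) refl
        to (inj₂ (_ , de))  (inD _ r s)  = balanced v y e a p q r s (ent-1 de) refl
        to (inj₁ ya)        (inD yd _ _) = ⊥-elim (case kind-unique f cl yd ya of λ ())
        to (inj₁ ya)        (inB yb _ _) = ⊥-elim (case kind-unique f cl ya yb of λ ())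
        to (inj₂ (yd , _))  (inB yb _ _) = ⊥-elim (case kind-unique f cl yb yd of λ ())
        to (inj₁ ya)        (inC y∉ _ _) = ⊥-elim (y∉ (KindIn⇒In ya))
        to (inj₂ (yd , _))  (inC y∉ _ _) = ⊥-elim (y∉ (KindIn⇒In yd))

    def : Fin n → ℕ
    def = defE H (E F)

    rt : Fin n → ℤ
    rt v = bit ⌊ dRoot? v ⌋

    root-B : ∀ {r} → DRoot r → B₀ H F r
    root-B dr with with-good f dr
    ... | _ , g , ((e , refl) , _) = root-B₀ g e

    rt-0 : ∀ {v} → ¬ DRoot v → rt v ≡ + 0
    rt-0 {v} ¬r = cong bit (⌊⌋-no (dRoot? v) ¬r)

    split : ∀ {v} → isB v ≡ false → + def v ≡ rt v → + def v ≡ (+ def v) when isB v + rt v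
    split {v} q e = trans e (trans (sym (+-identityˡ _)) (cong (λ b → (+ def v) when b + rt v) (sym q)))

    def-root : ∀ {v} → suc (d v) ≡ mH H v → def v ≡ 1
    def-root {v} e = ℕ.+-cancelˡ-≡ (d v) _ _ (trans (min-distance (d v) (H v) (ℕ.≤-trans (ℕ.n≤1+n _) (ℕ.≤-reflexive e)))
                       (trans (sym e) (ℕ.+-comm 1 (d v))))

    regular⇒def : ∀ {v} → d v ∈ toList (H v) → + def v ≡ rt v
    regular⇒def {v} d∈ = trans (cong +_ (dist-H v d∈)) (sym (rt-0 (λ dr → root-B dr d∈)))

    -- Outside B the only deficient vertices are the bases of blossoms without parent, each of
    -- deficiency 1; everything else is regular since all of B₀ lies in the forest.
    def-split : ∀ v → + def v ≡ (+ def v) when isB v + rt v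
    def-split v with classify v
    ... | inA a _ q = split q (regular⇒def (regular-A f cl a))
    ... | inB b _ q = sym (trans (cong₂ (λ b x → (+ def v) when b + x) q
                               (rt-0 (λ dr → case kind-unique f cl b (base-kD (root⇒base dr)) of λ ()))) (+-identityʳ _))
    ... | inC v∉ _ q with _∈?_ ℕ._≟_ (d v) (toList (H v))
    ...   | yes d∈ = split q (regular⇒def d∈)
    ...   | no b   = ⊥-elim (v∉ (rooted cl v b))
    def-split v | inD e _ q with with-good f (self e)
      where
      -- `with-good` forgets where in `L` the node lies, so the means of recognising `v` as a root
      -- of `L` is carried along with it.
      self : KindIn kD L v → Any (λ K → (v ∈ verts K × kind K ≡ kD) × (parent K ≡ nothing × base K ≡ v → DRoot v)) L
      self = go id
        where
        go : ∀ {L′} → (Any (λ K → (parent K ≡ nothing × base K ≡ v) × kind K ≡ kD) L′ → DRoot v) → KindIn kD L′ v →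
             Any (λ K → (v ∈ verts K × kind K ≡ kD) × (parent K ≡ nothing × base K ≡ v → DRoot v)) L′
        go emb (here (v∈ , kd)) = here ((v∈ , kd) , λ e → emb (here (e , kd)))
        go emb (there v∈)       = there (go (emb ∘ there) v∈)
    ... | node kD X r p , g , (v∈ , refl) , mkRoot with ordinary g v∈
    ...   | inj₁ d∈ = split q (regular⇒def d∈)
    ...   | inj₂ (refl , refl) = split q (trans (cong +_ (def-root (kindOK g refl)))
                                   (sym (cong bit (⌊⌋-yes (dRoot? v) (mkRoot (refl , refl))))))

    bs : Fin n → ℤ
    bs y = bit ⌊ dBase? y ⌋

    same-parent : ∀ {r} {P Q : Maybe (Fin n) → Set} → Any (λ K → (P (parent K) × base K ≡ r) × kind K ≡ kD) L →
                  Any (λ K → (Q (parent K) × base K ≡ r) × kind K ≡ kD) L → Σ (Maybe (Fin n)) λ p → P p × Q p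
    same-parent a b with with-good f (same-node f proj₁ proj₁
        (Any.map (λ { (r∈ , ((p , refl) , kd)) → r∈ , p }) (with-base f a))
        (Any.map (λ { (r∈ , ((p , refl) , kd)) → r∈ , p }) (with-base f b)))
    ... | K , _ , (_ , p) , (_ , q) = parent K , p , q

    -- A blossom is either a root or has exactly one parent, and disjointness of nodes makes its
    -- base determine it.
    base-split : ∀ y → rt y + ∑ (λ v → ent v y) ≡ bs y
    base-split y = go (dBase? y)
      where
      go : Dec (DBase y) → rt y + ∑ (λ v → ent v y) ≡ bs y
      go (no ¬b) = trans (cong₂ _+_ (rt-0 (¬b ∘ root⇒base)) (∑-0 (λ v → ent-0 {v} {y} (¬b ∘ entry⇒base))))
                         (sym (cong bit (⌊⌋-no (dBase? y) ¬b)))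
      go (yes b) = trans (with-parent (owner b)) (sym (cong bit (⌊⌋-yes (dBase? y) b)))
        where
        owner : ∀ {L} → Any (λ K → base K ≡ y × kind K ≡ kD) L →
                Any (λ K → (parent K ≡ nothing × base K ≡ y) × kind K ≡ kD) L ⊎
                Σ (Fin n) λ u → Any (λ K → (parent K ≡ just u × base K ≡ y) × kind K ≡ kD) L
        owner (here {node _ _ _ nothing}  (e , kd)) = inj₁ (here ((refl , e) , kd))
        owner (here {node _ _ _ (just u)} (e , kd)) = inj₂ (u , here ((refl , e) , kd))
        owner (there b) with owner b
        ... | inj₁ a       = inj₁ (there a)
        ... | inj₂ (u , a) = inj₂ (u , there a)
        with-parent : DRoot y ⊎ Σ (Fin n) (λ u → DEntry f cl u y) → rt y + ∑ (λ v → ent v y) ≡ + 1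
        with-parent (inj₁ dr) = cong₂ _+_ (cong bit (⌊⌋-yes (dRoot? y) dr))
          (∑-0 (λ v → ent-0 {v} {y} (λ de → case same-parent {P = _≡ nothing} {Q = _≡ just v} dr de of λ { (_ , refl , ()) })))
        with-parent (inj₂ (u , de)) = cong₂ _+_
          (rt-0 (λ dr → case same-parent {P = _≡ nothing} {Q = _≡ just u} dr de of λ { (_ , refl , ()) }))
          (trans (∑-single u (λ v v≢u → ent-0 {v} {y} (λ de′ →
             case same-parent {P = _≡ just v} {Q = _≡ just u} de′ de of λ { (_ , refl , refl) → v≢u refl })))
             (ent-1 de))

    -- Blossom bases and the components of G[D]

    baseLabel : ∀ {y} → DBase y → Fin τ
    baseLabel {y} b = c y (kD⇒D f cl (base-kD b))

    mark : ∀ {y} → Dec (DBase y) → Fin τ → ℤ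
    mark (yes b) i = δ i (baseLabel b)
    mark (no _)  i = + 0

    ∑-mark : ∀ {y} (b? : Dec (DBase y)) → ∑ (mark b?) ≡ bit ⌊ b? ⌋
    ∑-mark (yes b) = trans (∑-single (baseLabel b) (λ i ne → δ-≢ ne)) (δ-refl (baseLabel b))
    ∑-mark (no _)  = ∑-0 {τ} (λ _ → refl)

    -- By `from-D` an edge leaving a blossom ends in A or B, hence outside D, so a walk in `G[D]`
    -- never changes its blossom.
    walk-together : ∀ {Q : Node → Set} u vs → All (D H F) (u ∷ vs) → Walk (adj G) (u ∷ vs) →
                    Any (λ K → u ∈ verts K × Q K) L → Any (λ K → lastFrom u vs ∈ verts K × Q K) L
    walk-together u []       _            _        a = a
    walk-together u (v ∷ vs) (du ∷ dv ∷ ds) (uv ∷ w) a with from-D f cl (D⇒kD f cl du) uv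
    ... | inj₁ tog = walk-together v vs (dv ∷ ds) w
            (Any.map (λ { ((_ , q) , (_ , v∈)) → v∈ , q }) (same-node f proj₁ proj₁ a tog))
    ... | inj₂ (inj₁ (ya , _)) = ⊥-elim (case kind-unique f cl ya (D⇒kD f cl dv) of λ ())
    ... | inj₂ (inj₂ (yb , _)) = ⊥-elim (case kind-unique f cl yb (D⇒kD f cl dv) of λ ())

    conn⇒same-base : ∀ {y r} → DBase y → DBase r → ConnD H F y r → y ≡ r
    conn⇒same-base {y} {r} by br (u ∷ vs , refl , last≡ , ds , w)
      with with-good f (same-node f proj₁ proj₁
             (walk-together {λ K → base K ≡ y} u vs ds w (Any.map (λ { (r∈ , (refl , _)) → r∈ , refl }) (with-base f by)))
             (Any.map (λ { {K} (r∈ , (refl , _)) → subst (_∈ verts K) (trans (sym last≡) (last≡lastFrom u vs)) r∈ , refl }) (with-base f br)))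
    ... | _ , _ , (_ , e) , (_ , e′) = trans (sym e) e′

    -- A blossom is connected inside D: the trail from its base that witnesses an exit at `v` stays
    -- within its vertices.
    base-of : ∀ {v} → KindIn kD L v → Σ (Fin n) λ r → DBase r × ConnD H F r v
    base-of {v} v∈ = go id f v∈
      where
      go : ∀ {L′} → (∀ {P : Node → Set} → Any P L′ → Any P L) → Forest L′ → KindIn kD L′ v → Σ (Fin n) λ r → DBase r × ConnD H F r v
      go emb (cons g po ap f′) (there v∈) = go (λ p → emb (there p)) f′ v∈
      go emb (cons {node kD X r p} g po ap f′) (here (v∈ , refl)) =
        r , emb (here (refl , refl)) , (r ∷ tl (tr S) , refl , trans (last≡lastFrom r (tl (tr S))) (lastFrom-tl (tr S)) ,
          All.tabulate (λ z∈ → kD⇒D f cl (emb (here (within S z∈ , refl)))) , walk (tr S))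
        where
        S = sound g {t = true} (v∈ , tt)

    -- Each component contains a base by `base-of`, and only one by `conn⇒same-base`.
    ∑-marks : ∀ i → ∑ (λ y → mark (dBase? y) i) ≡ + 1
    ∑-marks i with proj₁ labelling i
    ... | v , dv , refl with base-of (D⇒kD f cl dv)
    ...   | r , br , conn = trans (∑-single r others) (at-base (dBase? r))
      where
      open Equivalence
      label : ∀ (b : DBase r) → baseLabel b ≡ c v dv
      label b = from (proj₂ labelling r (kD⇒D f cl (base-kD b)) v dv) conn
      at-base : ∀ b? → mark b? (c v dv) ≡ + 1
      at-base (yes b) = trans (cong (δ (c v dv)) (label b)) (δ-refl (c v dv))
      at-base (no ¬b) = ⊥-elim (¬b br)
      others : ∀ y → y ≢ r → mark (dBase? y) (c v dv) ≡ + 0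
      others y y≢r with dBase? y
      ... | no _  = refl
      ... | yes b = δ-≢ (λ e → y≢r (conn⇒same-base b br
                      (to (proj₂ labelling y (kD⇒D f cl (base-kD b)) r (kD⇒D f cl (base-kD br))) (trans (sym e) (sym (label br))))))

    -- Double counting of pairs of a base and its label: every base has one label and every label
    -- one base.
    ∑-bases : ∑ bs ≡ + τ
    ∑-bases = begin
      ∑ bs                                            ≡⟨ ∑-cong (λ y → ∑-mark (dBase? y)) ⟨
      ∑ (λ y → ∑ (λ i → mark (dBase? y) i))           ≡⟨ ∑-swap (λ y i → mark (dBase? y) i) ⟩
      ∑ (λ i → ∑ (λ y → mark (dBase? y) i))           ≡⟨ ∑-ones ∑-marks ⟩
      + τ                                             ∎
      where open ≡-Reasoning

    -- Summing the balances

    ∑∑ : (Fin n → Fin n → ℤ) → ℤ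
    ∑∑ g = ∑ (λ v → ∑ (g v))

    -- The degree of a B-vertex is at most `mH`, so `mH` splits as degree plus deficiency.
    B-term : ∀ v → (+ mH H v - + degMinus G decA v) when isB v ≡
                   (+ def v) when isB v + ∑ (λ y → (bit (E F v y) - bit (adj G v y ∧ not (isA y))) when isB v)
    B-term v = trans (go (isB v) refl) (cong (_+_ ((+ def v) when isB v)) (∑-when {n} _ (isB v)))
      where
      degrees : ∑ (λ y → bit (E F v y) - bit (adj G v y ∧ not (isA y))) ≡ + d v - + degMinus G decA v
      degrees = trans (∑-+ {n} _ _) (cong₂ _+_ (sym (sum-∑ (λ y → b2n (E F v y))))
        (trans (∑-neg {n} _) (cong -_ (sym (sum-∑ (λ y → b2n (adj G v y ∧ not (isA y))))))))
      regroup : ∀ a b c → (a + b) - c ≡ b + (a - c)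
      regroup = solve-∀
      go : ∀ b → isB v ≡ b → (+ mH H v - + degMinus G decA v) when b ≡
                             (+ def v) when b + (∑ (λ y → bit (E F v y) - bit (adj G v y ∧ not (isA y)))) when b
      go false _ = refl
      go true  e = trans (cong (λ m → + m - + degMinus G decA v) (sym (min-distance (d v) (H v) (deg-B f cl v∈B))))
                     (trans (regroup (+ d v) (+ def v) (+ degMinus G decA v)) (cong (_+_ (+ def v)) (sym degrees)))
        where
        v∈B : KindIn kB L v
        v∈B = B⇒kB f cl (witness (decB v) e)

    A-term : ∀ v → (+ MH H v) when isA v ≡ ∑ (λ y → bit (E F v y) when isA v)
    A-term v = trans (go (decA v)) (∑-when {n} _ (isA v))
      where
      go : ∀ (a? : Dec (Aset H F v)) → (+ MH H v) when ⌊ a? ⌋ ≡ (∑ (λ y → bit (E F v y))) when ⌊ a? ⌋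
      go (no _)  = refl
      go (yes a) = trans (cong +_ (sym (deg-A f cl (A⇒kA f cl a)))) (sum-∑ (λ y → b2n (E F v y)))

    -- Both sides count the F-edges between A and B, from opposite ends.
    BA≡AB : ∑∑ BA ≡ ∑∑ AB
    BA≡AB = trans (∑-swap BA) (∑-cong (λ v → ∑-cong (λ y →
      cong bit (cong₂ _∧_ (symE F y v) (∧-comm (isB y) (isA v))))))

    ∑-sub : (g h : Fin n → ℤ) → ∑ (λ v → g v - h v) ≡ ∑ g - ∑ h
    ∑-sub g h = trans (∑-+ g (λ v → - h v)) (cong (_+_ (∑ g)) (∑-neg h))

    ∑∑-sub : (g h : Fin n → Fin n → ℤ) → ∑∑ (λ v y → g v y - h v y) ≡ ∑∑ g - ∑∑ h
    ∑∑-sub g h = trans (∑-cong (λ v → ∑-sub (g v) (h v))) (∑-sub _ _)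

    ∑∑-balance : ∑∑ balance ≡ - ∑∑ ent
    ∑∑-balance = begin
      ∑∑ balance                                ≡⟨ ∑-cong (λ v → ∑-cong (balance≡ v)) ⟩
      ∑∑ (λ v y → BA v y - AB v y - ent v y)    ≡⟨ ∑∑-sub (λ v y → BA v y - AB v y) ent ⟩
      ∑∑ (λ v y → BA v y - AB v y) - ∑∑ ent     ≡⟨ cong (_- ∑∑ ent) (∑∑-sub BA AB) ⟩
      ∑∑ BA - ∑∑ AB - ∑∑ ent                    ≡⟨ cong (λ s → s - ∑∑ AB - ∑∑ ent) BA≡AB ⟩
      ∑∑ AB - ∑∑ AB - ∑∑ ent                    ≡⟨ cancel (∑∑ AB) (∑∑ ent) ⟩
      - ∑∑ ent                                  ∎
      where
      open ≡-Reasoning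
      cancel : ∀ a e → a - a - e ≡ - e
      cancel = solve-∀

    defB : ℤ
    defB = ∑ (λ v → (+ def v) when isB v)

    sum-B-A : sumOver decB (λ v → + mH H v - + degMinus G decA v) - sumOver decA (λ v → + MH H v) ≡ defB - ∑∑ ent
    sum-B-A = begin
      sumOver decB (λ v → + mH H v - + degMinus G decA v) - sumOver decA (λ v → + MH H v)
        ≡⟨ cong₂ _-_ (trans (sumℤ-∑ {n} _) (trans (∑-cong B-term) (∑-+ {n} _ _)))
                     (trans (sumℤ-∑ {n} _) (∑-cong A-term)) ⟩
      (defB + ∑∑ tB) - ∑∑ tA
        ≡⟨ ℤ.+-assoc defB (∑∑ tB) (- ∑∑ tA) ⟩
      defB + (∑∑ tB - ∑∑ tA)
        ≡⟨ cong (_+_ defB) (trans (sym (∑∑-sub tB tA)) ∑∑-balance) ⟩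
      defB - ∑∑ ent ∎
      where
      open ≡-Reasoning
      tA tB : Fin n → Fin n → ℤ
      tB v y = (bit (E F v y) - bit (adj G v y ∧ not (isA y))) when isB v
      tA v y = bit (E F v y) when isA v

    deficiency : + defSum H (E F) ≡ (+ τ + sumOver decB (λ v → + mH H v - + degMinus G decA v)) - sumOver decA (λ v → + MH H v)
    deficiency = begin
      + defSum H (E F)                      ≡⟨ ∑def H F ⟩
      ∑ (λ v → + def v)                     ≡⟨ ∑-cong def-split ⟩
      ∑ (λ v → (+ def v) when isB v + rt v) ≡⟨ ∑-+ {n} _ rt ⟩
      -- The number of entry edges is added and subtracted: with the root blossoms it completes τ,
      -- and with `defB` it forms the sums over B and A.
      defB + ∑ rt                           ≡⟨ regroup defB (∑ rt) (∑∑ ent) ⟩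
      (∑ rt + ∑∑ ent) + (defB - ∑∑ ent)     ≡⟨ cong₂ _+_ (trans (cong (_+_ (∑ rt)) (∑-swap ent)) (trans (sym (∑-+ rt _))
                                                 (trans (∑-cong base-split) ∑-bases))) (sym sum-B-A) ⟩
      + τ + (sB - sA)                       ≡⟨ ℤ.+-assoc (+ τ) sB (- sA) ⟨
      (+ τ + sB) - sA                       ∎
      where
      open ≡-Reasoning
      sA sB : ℤ
      sA = sumOver decA (λ v → + MH H v)
      sB = sumOver decB (λ v → + mH H v - + degMinus G decA v)
      regroup : ∀ a b x → a + b ≡ (b + x) + (a - x)
      regroup = solve-∀

theorem1 : {n : ℕ} (G : Graph n) (H : Pres n) (F : Spanning G) →
    Star H → ¬ HasHFactor G H → IsChosen G H F →
    (decA : ∀ v → Dec (Aset H F v)) → (decB : ∀ v → Dec (Bset H F v)) →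
    (τ : ℕ) (c : (v : Fin n) → D H F v → Fin τ) → ComponentLabelling H F τ c →
    (k : ℕ) → IsTotalDef G H k →
    + k ≡ (+ τ + sumOver decB (λ v → + mH H v - + degMinus G decA v))
    - sumOver decA (λ v → + MH H v)
theorem1 G H F star _ chosen decA decB τ c labelling k total =
  trans (cong +_ (totalDef≡defSum H F chosen k total)) (deficiency L f cl)
  where
  open Growth H F star chosen using (closed-forest)
  open Counting.Count H F star chosen decA decB τ c labelling
  L = proj₁ closed-forest
  f = proj₁ (proj₂ closed-forest)
  cl = proj₂ (proj₂ closed-forest)
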